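{- Let $n\ge1$ and let $t_n$ be the linear operator on $\mathbb{C}\mathfrak{S}_n$ given by $t_n(f)=f\tau_n$, where $$\tau_n=12\cdots n+2134\cdots n+3124\cdots n+\cdots+n12\cdots(n-1)\in\mathbb{C}\mathfrak{S}_n$$ (sum of the $n$ permutations obtained from the identity word by moving one letter to the front). Then $t_n$ is diagonalizable, its spectrum is $\{0,1,\dots,n-2\}\cup\{n\}$, and its minimal polynomial is $$P_n(x)=(x-n)\prod_{k=0}^{n-2}(x-k).$$ Moreover, under the identification of $\mathbf{Sym}_n$ with the descent algebra, $\tau_n$ corresponds to $T_n=S_1S_{n-1}$, and for each $k$ with $0\le k\le n$ the spectral projector of $t_n$ onto the eigenspace of eigenvalue $k$ (the zero operator if $k$ is not an eigenvalue) is right multiplication by the element corresponding to $D_{n,k}$, where the $D_{n,k}\in\mathbf{Sym}_n$ are given by the generating series $$\sum_{n\ge0}\sum_{k=0}^n t^{n-k}u^kD_{n,k}=e^{(u-t)S_1}\sum_{m\ge0}t^mS_m .$$ In particular the projector onto the kernel of $t_n$ corresponds to $D_n=D_{n,0}$, where $\sum_{n\ge0}D_nx^n=e^{ -xS_1}\sum_{m\ge0}x^mS_m$.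
   Context: Permutations are written as words $\sigma_1\cdots\sigma_n$ with $\sigma_i=\sigma(i)$, and products are compositions $(\sigma\tau)(i)=\sigma(\tau(i))$. $\mathbf{Sym}=\bigoplus_n\mathbf{Sym}_n$ is the free associative unital $\mathbb{C}$-algebra on generators $S_1,S_2,\dots$, $\deg S_n=n$, $S_0=1$; for a composition $I=(i_1,\dots,i_r)$ of $n$, $S^I=S_{i_1}\cdots S_{i_r}$. The identification of $\mathbf{Sym}_n$ with Solomon's descent algebra (a subalgebra of $\mathbb{C}\mathfrak{S}_n$) is the linear map sending $S^I$ to the sum of all permutations $\sigma\in\mathfrak{S}_n$ whose descent set $\{i:\sigma_i>\sigma_{i+1}\}$ is contained in $\{i_1,i_1+i_2,\dots,i_1+\cdots+i_{r-1}\}$. (This operator describes the Tsetlin library Markov chain in the uniform case.) -}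

module Defs where

open import Algebra.Apartness.Bundles using (HeytingField; HeytingCommutativeRing)
open import Algebra.Bundles using (CommutativeRing; Monoid; Group)
open import Algebra.Module.Bundles using (LeftModule)
import Algebra.Module.Morphism.Structures as ModuleMorphisms
import Algebra.Definitions.RawMonoid as RawMonoidDefs
open import Data.Bool.Base using (true; false; if_then_else_)
open import Data.Fin.Base as Fin using (Fin; toℕ)
import Data.Fin.Properties as Fin
open import Data.Fin.Patterns using (0F)
open import Data.Fin.Permutation as Perm using (Permutation′; _⟨$⟩ʳ_; _∘ₚ_; insert)
open import Data.List.Base using (List; []; _∷_; _++_; map; concatMap; foldr; filter; allFin; upTo)
open import Data.List.Membership.Propositional using (_∈_)
open import Data.List.Membership.DecPropositional using () renaming (_∈?_ to mk-∈?)
import Data.List.Properties as List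
open import Data.Nat.Base as ℕ using (ℕ; zero; suc; _∸_)
open import Data.Nat.GeneralisedArithmetic using (fold)
import Data.Nat.ListAction as ℕ
import Data.Nat.Properties as ℕ
open import Data.Product.Base using (Σ; ∃-syntax; _×_; _,_; proj₁; proj₂)
open import Data.Vec.Base as Vec using (Vec; []; _∷_)
import Data.Vec.Properties as Vec
open import Level using (0ℓ; _⊔_)
open import Relation.Binary.Definitions using (Decidable)
open import Relation.Binary.PropositionalEquality as ≡ using (_≡_; _≢_)
open import Relation.Nullary using (¬_; Dec; does)
open import Relation.Nullary.Decidable using (_→-dec_)

------------------------------------------------------------------------
-- The ground field
--
-- The complex numbers are not available here.  Everything is done over an
-- arbitrary Heyting field of characteristic zero: this covers ℂ, read
-- either classically (with _#_ the negation of _≈_) or constructively.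

module Scalars {c ℓ₁ ℓ₂} (F : HeytingField c ℓ₁ ℓ₂) where
  open HeytingField F using (heytingCommutativeRing)

  commutativeRing : CommutativeRing c ℓ₁
  commutativeRing = record
    { isCommutativeRing = HeytingCommutativeRing.isCommutativeRing heytingCommutativeRing }

  open CommutativeRing commutativeRing public
  open RawMonoidDefs +-rawMonoid public using () renaming (_×_ to _·ℕ_)

  fromℕ : ℕ → Carrier
  fromℕ n = n ·ℕ 1#

CharacteristicZero : ∀ {c ℓ₁ ℓ₂} → HeytingField c ℓ₁ ℓ₂ → Set ℓ₂
CharacteristicZero F = ∀ n → fromℕ (suc n) # 0#
  where
  open Scalars F using (fromℕ)
  open HeytingField F using (_#_; 0#)

------------------------------------------------------------------------
-- Monoid algebras
--
-- Elements of K[M] are formal finite sums Σ cᵢ xᵢ, represented as lists of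
-- pairs (cᵢ , xᵢ) and compared coefficient by coefficient.  The group
-- algebra of 𝔖ₙ, the free associative algebra Sym and the polynomials K[x]
-- are the instances M = 𝔖ₙ, M = a free monoid, and M = (ℕ , +).

module MonoidAlgebra {c ℓ m ℓm} (K : CommutativeRing c ℓ) (M : Monoid m ℓm)
                     (_≟_ : Decidable (Monoid._≈_ M)) where
  open CommutativeRing K
  private module M = Monoid M
  open import Algebra.Properties.Ring ring using (-0#≈0#; -‿+-comm)
  open import Relation.Binary.Reasoning.Setoid setoid
  open import Algebra.Properties.CommutativeSemigroup +-commutativeSemigroup using (interchange)

  Element : Set (c ⊔ m)
  Element = List (Carrier × M.Carrier)

  δ : Carrier → M.Carrier → M.Carrier → Carrier
  δ a x y = if does (x ≟ y) then a else 0#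

  coeff : Element → M.Carrier → Carrier
  coeff []            y = 0#
  coeff ((a , x) ∷ f) y = δ a x y + coeff f y

  infix 4 _≈ᴬ_
  record _≈ᴬ_ (f g : Element) : Set (ℓ ⊔ m) where
    constructor ext
    field at : ∀ y → coeff f y ≈ coeff g y
  open _≈ᴬ_ public

  infixl 6 _+ᴬ_
  infixl 7 _*ᴬ_
  infixr 7 _∙ᴬ_

  single : M.Carrier → Element
  single x = (1# , x) ∷ []

  0ᴬ 1ᴬ : Element
  0ᴬ = []
  1ᴬ = single M.ε

  _+ᴬ_ : Element → Element → Element
  _+ᴬ_ = _++_

  _∙ᴬ_ : Carrier → Element → Element
  a ∙ᴬ f = map (λ (b , x) → (a * b , x)) f

  -ᴬ_ : Element → Element
  -ᴬ f = map (λ (b , x) → (- b , x)) f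

  _*ᴬ_ : Element → Element → Element
  f *ᴬ g = concatMap (λ (a , x) → map (λ (b , y) → (a * b , x M.∙ y)) g) f

  sumᴬ : List Element → Element
  sumᴬ = foldr _+ᴬ_ 0ᴬ

  private
    δ-cong : ∀ {a b} x y → a ≈ b → δ a x y ≈ δ b x y
    δ-cong x y a≈b with does (x ≟ y)
    ... | true  = a≈b
    ... | false = refl

    δ-* : ∀ a b x y → δ (a * b) x y ≈ a * δ b x y
    δ-* a b x y with does (x ≟ y)
    ... | true  = refl
    ... | false = sym (zeroʳ a)

    δ-neg : ∀ b x y → δ (- b) x y ≈ - δ b x y
    δ-neg b x y with does (x ≟ y)
    ... | true  = refl
    ... | false = sym -0#≈0#

  coeff-+ : ∀ f g y → coeff (f +ᴬ g) y ≈ coeff f y + coeff g y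
  coeff-+ []            g y = sym (+-identityˡ _)
  coeff-+ ((a , x) ∷ f) g y = trans (+-congˡ (coeff-+ f g y)) (sym (+-assoc _ _ _))

  coeff-∙ : ∀ a f y → coeff (a ∙ᴬ f) y ≈ a * coeff f y
  coeff-∙ a []            y = sym (zeroʳ a)
  coeff-∙ a ((b , x) ∷ f) y =
    trans (+-cong (δ-* a b x y) (coeff-∙ a f y)) (sym (distribˡ _ _ _))

  coeff-neg : ∀ f y → coeff (-ᴬ f) y ≈ - coeff f y
  coeff-neg []            y = sym -0#≈0#
  coeff-neg ((b , x) ∷ f) y =
    trans (+-cong (δ-neg b x y) (coeff-neg f y)) (-‿+-comm _ _)

  leftModule : LeftModule ring (c ⊔ m) (ℓ ⊔ m)
  leftModule = record
    { Carrierᴹ = Element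
    ; _≈ᴹ_ = _≈ᴬ_
    ; _+ᴹ_ = _+ᴬ_
    ; _*ₗ_ = _∙ᴬ_
    ; 0ᴹ = 0ᴬ
    ; -ᴹ_ = -ᴬ_
    ; isLeftModule = record
      { isLeftSemimodule = record
        { +ᴹ-isCommutativeMonoid = record
          { isMonoid = record
            { isSemigroup = record
              { isMagma = record
                { isEquivalence = record
                  { refl  = ext λ _ → refl
                  ; sym   = λ p → ext λ y → sym (at p y)
                  ; trans = λ p q → ext λ y → trans (at p y) (at q y)
                  }
                ; ∙-cong = λ {f} {f′} {g} {g′} p q → ext λ y → begin
                    coeff (f +ᴬ g) y       ≈⟨ coeff-+ f g y ⟩
                    coeff f y + coeff g y  ≈⟨ +-cong (at p y) (at q y) ⟩
                    coeff f′ y + coeff g′ y ≈⟨ coeff-+ f′ g′ y ⟨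
                    coeff (f′ +ᴬ g′) y     ∎
                }
              ; assoc = λ f g h → ext λ y →
                  reflexive (≡.cong (λ k → coeff k y) (List.++-assoc f g h))
              }
            ; identity = (λ f → ext λ _ → refl)
                       , (λ f → ext λ y → reflexive (≡.cong (λ k → coeff k y) (List.++-identityʳ f)))
            }
          ; comm = λ f g → ext λ y → begin
              coeff (f +ᴬ g) y       ≈⟨ coeff-+ f g y ⟩
              coeff f y + coeff g y  ≈⟨ +-comm _ _ ⟩
              coeff g y + coeff f y  ≈⟨ coeff-+ g f y ⟨
              coeff (g +ᴬ f) y       ∎
          }
        ; isPreleftSemimodule = record
          { *ₗ-cong = λ {a} {b} {f} {g} p q → ext λ y →
              trans (coeff-∙ a f y) (trans (*-cong p (at q y)) (sym (coeff-∙ b g y)))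
          ; *ₗ-zeroˡ = λ f → ext λ y → trans (coeff-∙ 0# f y) (zeroˡ _)
          ; *ₗ-distribʳ = λ f a b → ext λ y → begin
              coeff ((a + b) ∙ᴬ f) y             ≈⟨ coeff-∙ (a + b) f y ⟩
              (a + b) * coeff f y                ≈⟨ distribʳ _ _ _ ⟩
              a * coeff f y + b * coeff f y      ≈⟨ +-cong (coeff-∙ a f y) (coeff-∙ b f y) ⟨
              coeff (a ∙ᴬ f) y + coeff (b ∙ᴬ f) y ≈⟨ coeff-+ (a ∙ᴬ f) (b ∙ᴬ f) y ⟨
              coeff (a ∙ᴬ f +ᴬ b ∙ᴬ f) y         ∎
          ; *ₗ-identityˡ = λ f → ext λ y → trans (coeff-∙ 1# f y) (*-identityˡ _)
          ; *ₗ-assoc = λ a b f → ext λ y → begin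
              coeff ((a * b) ∙ᴬ f) y   ≈⟨ coeff-∙ (a * b) f y ⟩
              a * b * coeff f y        ≈⟨ *-assoc _ _ _ ⟩
              a * (b * coeff f y)      ≈⟨ *-congˡ (coeff-∙ b f y) ⟨
              a * coeff (b ∙ᴬ f) y     ≈⟨ coeff-∙ a (b ∙ᴬ f) y ⟨
              coeff (a ∙ᴬ (b ∙ᴬ f)) y  ∎
          ; *ₗ-zeroʳ = λ a → ext λ _ → refl
          ; *ₗ-distribˡ = λ a f g → ext λ y →
              reflexive (≡.cong (λ k → coeff k y) (List.map-++ _ f g))
          }
        }
      ; -ᴹ‿cong = λ {f} {g} p → ext λ y →
          trans (coeff-neg f y) (trans (-‿cong (at p y)) (sym (coeff-neg g y)))
      ; -ᴹ‿inverse =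
            (λ f → ext λ y → trans (coeff-+ (-ᴬ f) f y)
                               (trans (+-congʳ (coeff-neg f y)) (-‿inverseˡ _)))
          , (λ f → ext λ y → trans (coeff-+ f (-ᴬ f) y)
                               (trans (+-congˡ (coeff-neg f y)) (-‿inverseʳ _)))
      }
    }

------------------------------------------------------------------------
-- Polynomials in one variable

module Polynomial {c ℓ} (K : CommutativeRing c ℓ) where
  open CommutativeRing K
  open MonoidAlgebra K ℕ.+-0-monoid ℕ._≟_ public

  X-_ : Carrier → Element
  X- a = single 1 +ᴬ -ᴬ (a ∙ᴬ 1ᴬ)

  productᴬ : List Element → Element
  productᴬ = foldr _*ᴬ_ 1ᴬ

  _∣ᴬ_ : Element → Element → Set (c ⊔ ℓ)
  p ∣ᴬ q = ∃[ r ] q ≈ᴬ p *ᴬ r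

  IsMonic : Element → Set ℓ
  IsMonic p = ∃[ d ] coeff p d ≈ 1# × (∀ i → d ℕ.< i → coeff p i ≈ 0#)

------------------------------------------------------------------------
-- Linear algebra in a vector space V over K

module LinearAlgebra {c ℓ m ℓm} (K : CommutativeRing c ℓ)
                     (V : LeftModule (CommutativeRing.ring K) m ℓm) where
  open CommutativeRing K using (Carrier; _≈_; 0#)
  open LeftModule V
  open RawMonoidDefs (LeftModule.+ᴹ-rawMonoid V) using (sum)
  open ModuleMorphisms.LeftModuleMorphisms rawLeftModule rawLeftModule
  private module K[x] = Polynomial K

  Operator : Set m
  Operator = Carrierᴹ → Carrierᴹ

  IsLinear : Operator → Set (c ⊔ m ⊔ ℓm)
  IsLinear = IsLeftModuleHomomorphism

  IsEigenvector : Operator → Carrier → Carrierᴹ → Set ℓm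
  IsEigenvector t a v = ¬ (v ≈ᴹ 0ᴹ) × t v ≈ᴹ a *ₗ v

  IsEigenvalue : Operator → Carrier → Set (m ⊔ ℓm)
  IsEigenvalue t a = ∃[ v ] IsEigenvector t a v

  record IsBasis {N : ℕ} (b : Fin N → Carrierᴹ) : Set (c ⊔ ℓ ⊔ m ⊔ ℓm) where
    field
      independent : ∀ (a : Fin N → Carrier) →
                    sum (λ i → a i *ₗ b i) ≈ᴹ 0ᴹ → ∀ i → a i ≈ 0#
      spanning    : ∀ v → Σ (Fin N → Carrier) λ a → v ≈ᴹ sum (λ i → a i *ₗ b i)

  IsDiagonalizable : Operator → Set (c ⊔ ℓ ⊔ m ⊔ ℓm)
  IsDiagonalizable t =
    ∃[ N ] Σ (Fin N → Carrierᴹ) λ b → IsBasis b × (∀ i → ∃[ a ] IsEigenvector t a (b i))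

  -- p(t) v
  evalAt : K[x].Element → Operator → Operator
  evalAt []            t v = 0ᴹ
  evalAt ((a , i) ∷ p) t v = a *ₗ fold v t i +ᴹ evalAt p t v

  Annihilates : K[x].Element → Operator → Set (m ⊔ ℓm)
  Annihilates p t = ∀ v → evalAt p t v ≈ᴹ 0ᴹ

  -- The monic generator of the ideal of polynomials annihilating t.
  record IsMinimalPolynomial (t : Operator) (p : K[x].Element) : Set (c ⊔ ℓ ⊔ m ⊔ ℓm) where
    field
      monic       : K[x].IsMonic p
      annihilates : Annihilates p t
      minimal     : ∀ q → Annihilates q t → p K[x].∣ᴬ q

  -- The projector onto the eigenspace of a along the other eigenspaces.
  -- When t is diagonalizable this determines P; when a is not an eigenvalue
  -- it forces P to be zero.
  record IsSpectralProjector (t : Operator) (a : Carrier) (P : Operator)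
         : Set (c ⊔ ℓ ⊔ m ⊔ ℓm) where
    field
      linear : IsLinear P
      range  : ∀ v → t (P v) ≈ᴹ a *ₗ P v
      fixes  : ∀ v → t v ≈ᴹ a *ₗ v → P v ≈ᴹ v
      kills  : ∀ b v → ¬ (b ≈ a) → t v ≈ᴹ b *ₗ v → P v ≈ᴹ 0ᴹ

------------------------------------------------------------------------
-- Symmetric groups

-- σ ∙ τ is the composition i ↦ σ (τ i), whereas π ∘ₚ ρ applies π first.
𝔖 : ℕ → Group 0ℓ 0ℓ
𝔖 n = record
  { Carrier = Permutation′ n
  ; _≈_     = Perm._≈_
  ; _∙_     = λ σ τ → τ ∘ₚ σ
  ; ε       = Perm.id
  ; _⁻¹     = Perm.flip
  ; isGroup = record
    { isMonoid = record
      { isSemigroup = record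
        { isMagma = record
          { isEquivalence = record
            { refl  = λ _ → ≡.refl
            ; sym   = λ p i → ≡.sym (p i)
            ; trans = λ p q i → ≡.trans (p i) (q i)
            }
          ; ∙-cong = λ {σ} p q i → ≡.trans (≡.cong (σ ⟨$⟩ʳ_) (q i)) (p _)
          }
        ; assoc = λ _ _ _ _ → ≡.refl
        }
      ; identity = (λ _ _ → ≡.refl) , (λ _ _ → ≡.refl)
      }
    ; inverse = (λ σ i → Perm.inverseˡ σ) , (λ σ i → Perm.inverseʳ σ)
    ; ⁻¹-cong = λ {σ} {τ} p i → ≡.trans
        (≡.cong (Perm.flip σ ⟨$⟩ʳ_)
          (≡.trans (≡.sym (Perm.inverseʳ τ)) (≡.sym (p (Perm.flip τ ⟨$⟩ʳ i)))))
        (Perm.inverseˡ σ)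
    }
  }

_≟ₚ_ : ∀ {n} → Decidable (Group._≈_ (𝔖 n))
σ ≟ₚ τ = Fin.all? λ i → (σ ⟨$⟩ʳ i) Fin.≟ (τ ⟨$⟩ʳ i)

-- Every permutation exactly once, sorted by its first letter.
allPermutations : ∀ n → List (Permutation′ n)
allPermutations zero    = Perm.id ∷ []
allPermutations (suc n) =
  concatMap (λ j → map (insert 0F j) (allPermutations n)) (allFin (suc n))

-- The word j 1 2 ⋯ n with the letter j moved to the front.
toFront : ∀ {n} → Fin n → Permutation′ n
toFront {suc n} j = insert 0F j Perm.id

-- Positions are numbered from 1, so i : Fin n stands for position suc (toℕ i).
DescentsIn : ∀ {n} → List ℕ → Permutation′ n → Set
DescentsIn D σ = ∀ i j → toℕ j ≡ suc (toℕ i) → (σ ⟨$⟩ʳ j) Fin.< (σ ⟨$⟩ʳ i) →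
                 suc (toℕ i) ∈ D

descentsIn? : ∀ {n} (D : List ℕ) (σ : Permutation′ n) → Dec (DescentsIn D σ)
descentsIn? D σ = Fin.all? λ i → Fin.all? λ j →
  (toℕ j ℕ.≟ suc (toℕ i)) →-dec ((σ ⟨$⟩ʳ j) Fin.<? (σ ⟨$⟩ʳ i)) →-dec
  mk-∈? ℕ._≟_ (suc (toℕ i)) D

------------------------------------------------------------------------
-- Compositions

-- The letter p stands for the part p + 1.
Composition : Set
Composition = List ℕ

parts : Composition → List ℕ
parts = map suc

∣_∣ᶜ : Composition → ℕ
∣ I ∣ᶜ = ℕ.sum (parts I)

-- i₁, i₁ + i₂, …, i₁ + ⋯ + iᵣ₋₁
partialSums : List ℕ → List ℕ
partialSums []          = []
partialSums (a ∷ [])    = []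
partialSums (a ∷ b ∷ I) = a ∷ map (a ℕ.+_) (partialSums (b ∷ I))

------------------------------------------------------------------------
-- Noncommutative symmetric functions and the operator tₙ

module Tsetlin {c ℓ₁ ℓ₂} (F : HeytingField c ℓ₁ ℓ₂) (char0 : CharacteristicZero F) where
  open Scalars F public using (commutativeRing; fromℕ; _≈_; 0#)
  open Scalars F using (Carrier; _*_; 1#)

  module K[x] = Polynomial commutativeRing
  module Kᴳ {n : ℕ} = MonoidAlgebra commutativeRing (Group.monoid (𝔖 n)) _≟ₚ_

  -- S^I is the word I, so that Sym is the algebra of the free monoid of words.
  module Sym = MonoidAlgebra commutativeRing (List.++-monoid ℕ) (List.≡-dec ℕ._≟_)

  K𝔖 : ℕ → Set c
  K𝔖 n = Kᴳ.Element {n}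

  Vectors : ∀ n → LeftModule (CommutativeRing.ring commutativeRing) c ℓ₁
  Vectors n = Kᴳ.leftModule {n}

  τ : ∀ n → K𝔖 n
  τ n = Kᴳ.sumᴬ (map (λ j → Kᴳ.single (toFront j)) (allFin n))

  rightMul : ∀ {n} → K𝔖 n → K𝔖 n → K𝔖 n
  rightMul x f = f Kᴳ.*ᴬ x

  t : ∀ n → K𝔖 n → K𝔖 n
  t n = rightMul (τ n)

  P : ℕ → K[x].Element
  P n = (K[x].X- fromℕ n) K[x].*ᴬ
        K[x].productᴬ (map (λ k → K[x].X- fromℕ k) (upTo (n ∸ 1)))

  S : ℕ → Sym.Element
  S zero    = Sym.1ᴬ
  S (suc p) = Sym.single (p ∷ [])

  InSym : ℕ → Sym.Element → Set ℓ₁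
  InSym n f = ∀ I → ∣ I ∣ᶜ ≢ n → Sym.coeff f I ≈ 0#

  descentSum : ∀ n → Composition → K𝔖 n
  descentSum n I =
    Kᴳ.sumᴬ (map Kᴳ.single (filter (descentsIn? (partialSums (parts I))) (allPermutations n)))

  -- The identification of Symₙ with the descent algebra, extended by zero to
  -- the components of Sym of degree ≠ n.
  α : ∀ n → Sym.Element → K𝔖 n
  α n f = Kᴳ.sumᴬ (map term f)
    where
    term : Carrier × Composition → K𝔖 n
    term (a , I) = if does (∣ I ∣ᶜ ℕ.≟ n) then a Kᴳ.∙ᴬ descentSum n I else Kᴳ.0ᴬ

  1/! : ℕ → Carrier
  1/! zero    = 1#
  1/! (suc n) = proj₁ (HeytingField.#⇒invertible F (char0 n)) * 1/! n

  -- Formal power series over Sym in d commuting central variables, as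
  -- functions from exponent vectors to coefficients.
  module Series (d : ℕ) where
    Series : Set c
    Series = Vec ℕ d → Sym.Element

    splits : ∀ {d} → Vec ℕ d → List (Vec ℕ d × Vec ℕ d)
    splits []      = ([] , []) ∷ []
    splits (a ∷ e) =
      concatMap (λ i → map (λ (p , q) → (i ∷ p , (a ∸ i) ∷ q)) (splits e)) (upTo (suc a))

    infixl 6 _-ˢ_
    infixl 7 _*ˢ_

    monomial : Vec ℕ d → Sym.Element → Series
    monomial e a e′ = if does (Vec.≡-dec ℕ._≟_ e e′) then a else Sym.0ᴬ

    const : Sym.Element → Series
    const = monomial (Vec.replicate d 0)

    var : Fin d → Series
    var i = monomial (Vec.replicate d 0 Vec.[ i ]≔ 1) Sym.1ᴬ

    -ˢ_ : Series → Series
    (-ˢ f) e = Sym.-ᴬ f e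

    _-ˢ_ : Series → Series → Series
    (f -ˢ g) e = f e Sym.+ᴬ (Sym.-ᴬ g e)

    _*ˢ_ : Series → Series → Series
    (f *ˢ g) e = Sym.sumᴬ (map (λ (p , q) → f p Sym.*ᴬ g q) (splits e))

    _^ˢ_ : Series → ℕ → Series
    f ^ˢ j = fold (const Sym.1ᴬ) (f *ˢ_) j

    -- exp f = Σ_j f^j / j! for f without constant term: f^j then has no terms
    -- of total degree < j, so each coefficient is the finite sum below.
    exp : Series → Series
    exp f e = Sym.sumᴬ (map (λ j → 1/! j Sym.∙ᴬ (f ^ˢ j) e) (upTo (suc (Vec.sum e))))

    -- Σ_m xᵢᵐ S_m
    complete : Fin d → Series
    complete i e = if does (Vec.≡-dec ℕ._≟_ e (Vec.replicate d 0 Vec.[ i ]≔ m)) then S m else Sym.0ᴬ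
      where m = Vec.lookup e i

  -- D n k is the coefficient of tⁿ⁻ᵏ uᵏ in e^{(u - t) S₁} Σ_m tᵐ S_m, for k ≤ n.
  D : ℕ → ℕ → Sym.Element
  D n k = (exp ((𝑢 -ˢ 𝑡) *ˢ const (S 1)) *ˢ complete 0F) ((n ∸ k) ∷ k ∷ [])
    where
    open Series 2
    𝑡 𝑢 : Series
    𝑡 = var 0F
    𝑢 = var (Fin.suc 0F)

  -- The coefficient of xⁿ in e^{- x S₁} Σ_m xᵐ S_m.
  D₀ : ℕ → Sym.Element
  D₀ n = (exp (-ˢ (var 0F *ˢ const (S 1))) *ˢ complete 0F) (n ∷ [])
    where open Series 1

{-# OPTIONS --safe #-}
module Submission where

-- Let B_j be the image of S₁ʲ Sₙ₋ⱼ.  Its coefficient at σ is 1 if the word of σ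
-- increases after its first j letters, and 0 otherwise, so that
-- B_j τ = j B_j + B_{j+1} for j < n, B_0 = 1 and B_n = B_{n-1}.  Hence t is
-- annihilated by the product of the t - a over a ∈ {0, …, n - 2, n}.  As these
-- numbers are distinct, every vector is a sum of eigenvectors, and a basis of
-- eigenvectors arises by Steinitz exchange, without deciding equality of scalars.
-- The generating series gives D_{n,k} ↦ E_k = Σᵢ (-1)ⁱ / (i! k!) B_{k+i}.  The
-- relations telescope to E_k τ = k E_k, and v τ = b v implies
-- v B_j = b (b - 1) ⋯ (b - j + 1) v; hence E_k acts as the spectral projector.

open import Defs
open import Algebra.Apartness.Bundles using (HeytingField)
import Algebra.Apartness.Properties.HeytingCommutativeRing as HeytingCommutativeRingProperties
open import Algebra.Bundles using (CommutativeMonoid; CommutativeRing; Monoid; Group)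
open import Algebra.Module.Bundles using (LeftModule)
import Algebra.Module.Construct.TensorUnit as TensorUnit
open import Algebra.Module.Morphism.Structures using (module LeftModuleMorphisms)
import Algebra.Properties.CommutativeMonoid.Sum as CommutativeMonoidSum
import Algebra.Properties.CommutativeSemigroup as CommutativeSemigroupProperties
import Algebra.Properties.Monoid.Mult as MonoidMult
import Algebra.Properties.Ring as RingProperties
import Algebra.Properties.Semiring.Mult as SemiringMult
import Algebra.Properties.Semiring.Sum as SemiringSum
open import Data.Bool.Base using (true; false; if_then_else_)
open import Data.Empty using (⊥-elim)
open import Data.Fin.Base as Fin using (Fin; zero; suc; toℕ; fromℕ<; punchIn; punchOut)
open import Data.Fin.Patterns using (0F)
open import Data.Fin.Permutation as Perm using (Permutation′; _⟨$⟩ʳ_; _⟨$⟩ˡ_; insert; remove; flip)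
import Data.Fin.Properties as Fin
open import Data.List.Base using (List; []; _∷_; _++_; length; map; foldr; filter; lookup; concatMap; cartesianProductWith; tabulate; replicate; allFin; upTo; applyUpTo)
open import Data.List.Membership.Propositional using (_∈_)
import Data.List.Membership.Propositional.Properties as ∈ₚ
import Data.List.Membership.Setoid as Membership
import Data.List.Membership.Setoid.Properties as Membershipₚ
import Data.List.Properties as List
open import Data.List.Relation.Unary.All as All using (All; []; _∷_)
import Data.List.Relation.Unary.All.Properties as All
open import Data.List.Relation.Unary.AllPairs as AllPairs using (AllPairs; []; _∷_)
import Data.List.Relation.Unary.AllPairs.Properties as AllPairs
open import Data.List.Relation.Unary.Any as Any using (Any; here; there)
import Data.List.Relation.Unary.Any.Properties as Any
import Data.List.Relation.Unary.Unique.Propositional.Properties as UniquePropositional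
import Data.List.Relation.Unary.Unique.Setoid as Unique
import Data.List.Relation.Unary.Unique.Setoid.Properties as Uniqueₚ
open import Data.Nat.Base as ℕ using (ℕ; zero; suc; _≤_; _<_; s≤s; z≤n; _∸_)
open import Data.Nat.GeneralisedArithmetic using (fold)
import Data.Nat.Properties as ℕ
open import Data.Nat.Tactic.RingSolver using (solve-∀)
open import Data.Product.Base using (Σ; ∃-syntax; _×_; _,_; proj₁; proj₂)
open import Data.Sum.Base using (_⊎_; inj₁; inj₂)
open import Data.Vec.Base as Vec using (Vec; []; _∷_)
open import Data.Vec.Functional using (Vector; head; tail; insertAt; updateAt)
import Data.Vec.Functional.Properties as Vector
import Data.Vec.Properties as Vec
open import Function.Base using (_∘_)
open import Function.Bundles using (_⇔_; mk⇔)
open import Level using (_⊔_)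
open import Relation.Binary.Definitions using (Decidable; _Respects_; tri<; tri≈; tri>)
open import Relation.Binary.PropositionalEquality as ≡ using (_≡_; _≢_; _≗_)
import Relation.Binary.Reasoning.Setoid as SetoidReasoning
open import Relation.Nullary using (¬_; Dec; yes; no; does; ¬?)
open import Relation.Nullary.Decidable using (dec-true; dec-false)
import Relation.Unary as U

module MonoidAlgebraProperties {c ℓ m ℓm} (K : CommutativeRing c ℓ) (M : Monoid m ℓm)
                               (_≟_ : Decidable (Monoid._≈_ M)) where
  open CommutativeRing K hiding (zero)
  private module M = Monoid M
  open MonoidAlgebra K M _≟_
  open LeftModule leftModule public using () renaming
    (≈ᴹ-refl to ≈ᴬ-refl; ≈ᴹ-sym to ≈ᴬ-sym; ≈ᴹ-trans to ≈ᴬ-trans; ≈ᴹ-reflexive to ≈ᴬ-reflexive;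
     ≈ᴹ-setoid to ≈ᴬ-setoid)

  δ-yes : ∀ a {x y} → x M.≈ y → δ a x y ≈ a
  δ-yes a {x} {y} p with x ≟ y
  ... | yes _ = refl
  ... | no ¬p = ⊥-elim (¬p p)

  δ-no : ∀ a {x y} → ¬ x M.≈ y → δ a x y ≈ 0#
  δ-no a {x} {y} ¬p with x ≟ y
  ... | yes p = ⊥-elim (¬p p)
  ... | no _  = refl

  δ-scale : ∀ a b x y → δ (a * b) x y ≈ a * δ b x y
  δ-scale a b x y with x ≟ y
  ... | yes _ = refl
  ... | no _  = sym (zeroʳ a)

  δ-⇔ : ∀ {a b x y x′ y′} → a ≈ b → (x M.≈ y → x′ M.≈ y′) → (x′ M.≈ y′ → x M.≈ y) → δ a x y ≈ δ b x′ y′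
  δ-⇔ {a} {b} {x} {y} a≈b to from with x ≟ y
  ... | yes p = trans a≈b (sym (δ-yes b (to p)))
  ... | no ¬p = sym (δ-no b (¬p ∘ from))

  δ-cong : ∀ {a b x x′ y y′} → a ≈ b → x M.≈ x′ → y M.≈ y′ → δ a x y ≈ δ b x′ y′
  δ-cong a≈b x≈x′ y≈y′ = δ-⇔ a≈b (λ p → M.trans (M.sym x≈x′) (M.trans p y≈y′))
                                 (λ p → M.trans x≈x′ (M.trans p (M.sym y≈y′)))

  coeff-cong : ∀ f {x y} → x M.≈ y → coeff f x ≈ coeff f y
  coeff-cong []      x≈y = refl
  coeff-cong (_ ∷ f) x≈y = +-cong (δ-cong refl M.refl x≈y) (coeff-cong f x≈y)

  -- ⟪ f , φ ⟫ is the value at f of the linear extension of φ.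
  module Pairing {v ℓv} (V : LeftModule ring v ℓv) where
    open LeftModule V
    open SetoidReasoning ≈ᴹ-setoid
    open CommutativeSemigroupProperties
      (CommutativeMonoid.commutativeSemigroup +ᴹ-commutativeMonoid)
      using (interchange; x∙yz≈y∙xz)

    ⟪_,_⟫ : Element → (M.Carrier → Carrierᴹ) → Carrierᴹ
    ⟪ []          , φ ⟫ = 0ᴹ
    ⟪ (a , x) ∷ f , φ ⟫ = a *ₗ φ x +ᴹ ⟪ f , φ ⟫

    Respectful : (M.Carrier → Carrierᴹ) → Set (m ⊔ ℓm ⊔ ℓv)
    Respectful φ = ∀ {x y} → x M.≈ y → φ x ≈ᴹ φ y

    ⟪⟫-congʳ : ∀ f {φ ψ} → (∀ x → φ x ≈ᴹ ψ x) → ⟪ f , φ ⟫ ≈ᴹ ⟪ f , ψ ⟫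
    ⟪⟫-congʳ []            e = ≈ᴹ-refl
    ⟪⟫-congʳ ((a , x) ∷ f) e = +ᴹ-cong (*ₗ-cong refl (e x)) (⟪⟫-congʳ f e)

    ⟪⟫-+ˡ : ∀ f g φ → ⟪ f +ᴬ g , φ ⟫ ≈ᴹ ⟪ f , φ ⟫ +ᴹ ⟪ g , φ ⟫
    ⟪⟫-+ˡ []            g φ = ≈ᴹ-sym (+ᴹ-identityˡ _)
    ⟪⟫-+ˡ ((a , x) ∷ f) g φ = ≈ᴹ-trans (+ᴹ-congˡ (⟪⟫-+ˡ f g φ)) (≈ᴹ-sym (+ᴹ-assoc _ _ _))

    ⟪⟫-∙ˡ : ∀ a f φ → ⟪ a ∙ᴬ f , φ ⟫ ≈ᴹ a *ₗ ⟪ f , φ ⟫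
    ⟪⟫-∙ˡ a []            φ = ≈ᴹ-sym (*ₗ-zeroʳ a)
    ⟪⟫-∙ˡ a ((b , x) ∷ f) φ = ≈ᴹ-trans (+ᴹ-cong (*ₗ-assoc a b _) (⟪⟫-∙ˡ a f φ))
                                       (≈ᴹ-sym (*ₗ-distribˡ a _ _))

    ⟪⟫-+ʳ : ∀ f φ ψ → ⟪ f , (λ x → φ x +ᴹ ψ x) ⟫ ≈ᴹ ⟪ f , φ ⟫ +ᴹ ⟪ f , ψ ⟫
    ⟪⟫-+ʳ []            φ ψ = ≈ᴹ-sym (+ᴹ-identityˡ _)
    ⟪⟫-+ʳ ((a , x) ∷ f) φ ψ = ≈ᴹ-trans (+ᴹ-cong (*ₗ-distribˡ a _ _) (⟪⟫-+ʳ f φ ψ))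
                                       (interchange _ _ _ _)

    ⟪⟫-zeroʳ : ∀ f → ⟪ f , (λ _ → 0ᴹ) ⟫ ≈ᴹ 0ᴹ
    ⟪⟫-zeroʳ []            = ≈ᴹ-refl
    ⟪⟫-zeroʳ ((a , x) ∷ f) = ≈ᴹ-trans (+ᴹ-cong (*ₗ-zeroʳ a) (⟪⟫-zeroʳ f)) (+ᴹ-identityˡ _)

    ⟪⟫-∙ʳ : ∀ a f φ → ⟪ f , (λ x → a *ₗ φ x) ⟫ ≈ᴹ a *ₗ ⟪ f , φ ⟫
    ⟪⟫-∙ʳ a []            φ = ≈ᴹ-sym (*ₗ-zeroʳ a)
    ⟪⟫-∙ʳ a ((b , x) ∷ f) φ = begin
      b *ₗ a *ₗ φ x +ᴹ ⟪ f , (λ x → a *ₗ φ x) ⟫  ≈⟨ +ᴹ-cong (≈ᴹ-sym (*ₗ-assoc b a _)) (⟪⟫-∙ʳ a f φ) ⟩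
      (b * a) *ₗ φ x +ᴹ a *ₗ ⟪ f , φ ⟫           ≈⟨ +ᴹ-cong (*ₗ-cong (*-comm b a) ≈ᴹ-refl) ≈ᴹ-refl ⟩
      (a * b) *ₗ φ x +ᴹ a *ₗ ⟪ f , φ ⟫           ≈⟨ +ᴹ-cong (*ₗ-assoc a b _) ≈ᴹ-refl ⟩
      a *ₗ b *ₗ φ x +ᴹ a *ₗ ⟪ f , φ ⟫            ≈⟨ *ₗ-distribˡ a _ _ ⟨
      a *ₗ (b *ₗ φ x +ᴹ ⟪ f , φ ⟫)               ∎

    ⟪⟫-single : ∀ x φ → ⟪ single x , φ ⟫ ≈ᴹ φ x
    ⟪⟫-single x φ = ≈ᴹ-trans (+ᴹ-identityʳ _) (*ₗ-identityˡ _)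

    ⟪⟫-*ˡ : ∀ f g φ → ⟪ f *ᴬ g , φ ⟫ ≈ᴹ ⟪ f , (λ x → ⟪ g , (λ y → φ (x M.∙ y)) ⟫) ⟫
    ⟪⟫-*ˡ []            g φ = ≈ᴹ-refl
    ⟪⟫-*ˡ ((a , x) ∷ f) g φ = ≈ᴹ-trans (⟪⟫-+ˡ (map _ g) (f *ᴬ g) φ) (+ᴹ-cong (translate g) (⟪⟫-*ˡ f g φ))
      where
      translate : ∀ g → ⟪ map (λ (b , y) → (a * b , x M.∙ y)) g , φ ⟫ ≈ᴹ a *ₗ ⟪ g , (λ y → φ (x M.∙ y)) ⟫
      translate []            = ≈ᴹ-sym (*ₗ-zeroʳ a)
      translate ((b , y) ∷ g) = ≈ᴹ-trans (+ᴹ-cong (*ₗ-assoc a b _) (translate g)) (≈ᴹ-sym (*ₗ-distribˡ a _ _))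

    private
      others : M.Carrier → Element → Element
      others x = filter (λ (_ , z) → ¬? (x ≟ z))

      coeff-others : ∀ x f {y} → (x M.≈ y → coeff (others x f) y ≈ 0#)
                               × (¬ x M.≈ y → coeff (others x f) y ≈ coeff f y)
      coeff-others x []            = (λ _ → refl) , (λ _ → refl)
      coeff-others x ((b , z) ∷ f) {y} with coeff-others x f {y} | x ≟ z
      ... | same , diff | yes x≈z = same , λ x≉y →
        trans (diff x≉y) (sym (trans (+-congʳ (δ-no b λ z≈y → x≉y (M.trans x≈z z≈y))) (+-identityˡ _)))
      ... | same , diff | no x≉z =
          (λ x≈y → trans (+-cong (δ-no b λ z≈y → x≉z (M.trans x≈y (M.sym z≈y))) (same x≈y)) (+-identityˡ _))
        , (λ x≉y → +-congˡ (diff x≉y))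

      ⟪⟫-others : ∀ {φ} → Respectful φ → ∀ x f →
                  ⟪ f , φ ⟫ ≈ᴹ coeff f x *ₗ φ x +ᴹ ⟪ others x f , φ ⟫
      ⟪⟫-others {φ} resp x [] = ≈ᴹ-sym (≈ᴹ-trans (+ᴹ-identityʳ _) (*ₗ-zeroˡ _))
      ⟪⟫-others {φ} resp x ((b , z) ∷ f) with x ≟ z
      ... | yes x≈z = begin
        b *ₗ φ z +ᴹ ⟪ f , φ ⟫
          ≈⟨ +ᴹ-cong (*ₗ-cong (sym (δ-yes b (M.sym x≈z))) (resp (M.sym x≈z))) (⟪⟫-others resp x f) ⟩
        δ b z x *ₗ φ x +ᴹ (coeff f x *ₗ φ x +ᴹ ⟪ others x f , φ ⟫)
          ≈⟨ +ᴹ-assoc _ _ _ ⟨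
        δ b z x *ₗ φ x +ᴹ coeff f x *ₗ φ x +ᴹ ⟪ others x f , φ ⟫
          ≈⟨ +ᴹ-cong (≈ᴹ-sym (*ₗ-distribʳ _ _ _)) ≈ᴹ-refl ⟩
        (δ b z x + coeff f x) *ₗ φ x +ᴹ ⟪ others x f , φ ⟫ ∎
      ... | no x≉z = begin
        b *ₗ φ z +ᴹ ⟪ f , φ ⟫
          ≈⟨ +ᴹ-cong ≈ᴹ-refl (⟪⟫-others resp x f) ⟩
        b *ₗ φ z +ᴹ (coeff f x *ₗ φ x +ᴹ ⟪ others x f , φ ⟫)
          ≈⟨ x∙yz≈y∙xz _ _ _ ⟩
        coeff f x *ₗ φ x +ᴹ (b *ₗ φ z +ᴹ ⟪ others x f , φ ⟫)
          ≈⟨ +ᴹ-cong (*ₗ-cong (sym (trans (+-congʳ (δ-no b (x≉z ∘ M.sym))) (+-identityˡ _))) ≈ᴹ-refl) ≈ᴹ-refl ⟩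
        (δ b z x + coeff f x) *ₗ φ x +ᴹ (b *ₗ φ z +ᴹ ⟪ others x f , φ ⟫) ∎

      ⟪⟫-vanish : ∀ {φ} → Respectful φ → ∀ n f → length f ≤ n →
                  (∀ y → coeff f y ≈ 0#) → ⟪ f , φ ⟫ ≈ᴹ 0ᴹ
      ⟪⟫-vanish resp n       []            _         f≈0 = ≈ᴹ-refl
      ⟪⟫-vanish {φ} resp (suc n) f@((a , x) ∷ f′) (s≤s len) f≈0 = begin
        a *ₗ φ x +ᴹ ⟪ f′ , φ ⟫
          ≈⟨ +ᴹ-cong ≈ᴹ-refl (⟪⟫-others resp x f′) ⟩
        a *ₗ φ x +ᴹ (coeff f′ x *ₗ φ x +ᴹ ⟪ others x f′ , φ ⟫)
          ≈⟨ +ᴹ-assoc _ _ _ ⟨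
        a *ₗ φ x +ᴹ coeff f′ x *ₗ φ x +ᴹ ⟪ others x f′ , φ ⟫
          ≈⟨ +ᴹ-cong (≈ᴹ-sym (*ₗ-distribʳ _ _ _)) (⟪⟫-vanish resp n (others x f′) (ℕ.≤-trans (List.length-filter _ f′) len) rest) ⟩
        (a + coeff f′ x) *ₗ φ x +ᴹ 0ᴹ
          ≈⟨ +ᴹ-identityʳ _ ⟩
        (a + coeff f′ x) *ₗ φ x
          ≈⟨ *ₗ-cong (trans (+-congʳ (sym (δ-yes a M.refl))) (f≈0 x)) ≈ᴹ-refl ⟩
        0# *ₗ φ x
          ≈⟨ *ₗ-zeroˡ _ ⟩
        0ᴹ ∎
        where
        rest : ∀ y → coeff (others x f′) y ≈ 0#
        rest y with coeff-others x f′ {y} | x ≟ y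
        ... | same , _    | yes x≈y = same x≈y
        ... | _    , diff | no x≉y  =
          trans (diff x≉y) (trans (sym (trans (+-congʳ (δ-no a x≉y)) (+-identityˡ _))) (f≈0 y))

    ⟪⟫-congˡ : ∀ {φ} → Respectful φ → ∀ {f g} → f ≈ᴬ g → ⟪ f , φ ⟫ ≈ᴹ ⟪ g , φ ⟫
    ⟪⟫-congˡ {φ} resp {f} {g} f≈g = begin
      ⟪ f , φ ⟫                       ≈⟨ +ᴹ-identityʳ _ ⟨
      ⟪ f , φ ⟫ +ᴹ 0ᴹ                 ≈⟨ +ᴹ-congˡ (cancel g) ⟨
      ⟪ f , φ ⟫ +ᴹ (⟪ -ᴬ g , φ ⟫ +ᴹ ⟪ g , φ ⟫) ≈⟨ +ᴹ-assoc _ _ _ ⟨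
      ⟪ f , φ ⟫ +ᴹ ⟪ -ᴬ g , φ ⟫ +ᴹ ⟪ g , φ ⟫ ≈⟨ +ᴹ-congʳ (⟪⟫-+ˡ f (-ᴬ g) φ) ⟨
      ⟪ f +ᴬ -ᴬ g , φ ⟫ +ᴹ ⟪ g , φ ⟫  ≈⟨ +ᴹ-congʳ (⟪⟫-vanish resp _ (f +ᴬ -ᴬ g) ℕ.≤-refl zeros) ⟩
      0ᴹ +ᴹ ⟪ g , φ ⟫                 ≈⟨ +ᴹ-identityˡ _ ⟩
      ⟪ g , φ ⟫                       ∎
      where
      zeros : ∀ y → coeff (f +ᴬ -ᴬ g) y ≈ 0#
      zeros y = trans (coeff-+ f (-ᴬ g) y) (trans (+-cong (at f≈g y) (coeff-neg g y)) (-‿inverseʳ _))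
      cancel : ∀ g → ⟪ -ᴬ g , φ ⟫ +ᴹ ⟪ g , φ ⟫ ≈ᴹ 0ᴹ
      cancel []            = +ᴹ-identityˡ _
      cancel ((b , x) ∷ g) = begin
        (- b) *ₗ φ x +ᴹ ⟪ -ᴬ g , φ ⟫ +ᴹ (b *ₗ φ x +ᴹ ⟪ g , φ ⟫)  ≈⟨ interchange _ _ _ _ ⟩
        (- b) *ₗ φ x +ᴹ b *ₗ φ x +ᴹ (⟪ -ᴬ g , φ ⟫ +ᴹ ⟪ g , φ ⟫)  ≈⟨ +ᴹ-cong (≈ᴹ-sym (*ₗ-distribʳ _ _ _)) (cancel g) ⟩
        (- b + b) *ₗ φ x +ᴹ 0ᴹ ≈⟨ +ᴹ-identityʳ _ ⟩
        (- b + b) *ₗ φ x       ≈⟨ *ₗ-cong (-‿inverseˡ b) ≈ᴹ-refl ⟩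
        0# *ₗ φ x              ≈⟨ *ₗ-zeroˡ _ ⟩
        0ᴹ ∎

  open Pairing (TensorUnit.leftModule {R = ring}) public

  coeff≈⟪⟫ : ∀ f y → coeff f y ≈ ⟪ f , (λ x → δ 1# x y) ⟫
  coeff≈⟪⟫ []            y = refl
  coeff≈⟪⟫ ((a , x) ∷ f) y =
    +-cong (trans (δ-cong (sym (*-identityʳ a)) M.refl M.refl) (δ-scale a 1# x y)) (coeff≈⟪⟫ f y)

  coeff-* : ∀ f g y → coeff (f *ᴬ g) y ≈ ⟪ f , (λ x → ⟪ g , (λ z → δ 1# (x M.∙ z) y) ⟫) ⟫
  coeff-* f g y = trans (coeff≈⟪⟫ (f *ᴬ g) y) (⟪⟫-*ˡ f g _)

  coeff-neg-one : ∀ f → -ᴬ f ≈ᴬ (- 1#) ∙ᴬ f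
  coeff-neg-one f = ext λ y → trans (coeff-neg f y) (trans (sym (-1*x≈-x _)) (sym (coeff-∙ (- 1#) f y)))
    where open import Algebra.Properties.Ring ring using (-1*x≈-x)

  +ᴬ-cong : ∀ {f f′ g g′} → f ≈ᴬ f′ → g ≈ᴬ g′ → f +ᴬ g ≈ᴬ f′ +ᴬ g′
  +ᴬ-cong = LeftModule.+ᴹ-cong leftModule

  ∙ᴬ-cong : ∀ {a b f g} → a ≈ b → f ≈ᴬ g → a ∙ᴬ f ≈ᴬ b ∙ᴬ g
  ∙ᴬ-cong = LeftModule.*ₗ-cong leftModule

  *ᴬ-cong : ∀ {f f′ g g′} → f ≈ᴬ f′ → g ≈ᴬ g′ → f *ᴬ g ≈ᴬ f′ *ᴬ g′
  *ᴬ-cong {f} {f′} {g} {g′} f≈f′ g≈g′ = ext λ y → trans (coeff-* f g y) (trans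
    (⟪⟫-congʳ f λ x → ⟪⟫-congˡ (λ p → δ-cong refl (M.∙-congˡ p) M.refl) g≈g′) (trans
    (⟪⟫-congˡ (λ p → ⟪⟫-congʳ g′ λ z → δ-cong refl (M.∙-congʳ p) M.refl) f≈f′)
    (sym (coeff-* f′ g′ y))))

  *ᴬ-assoc : ∀ f g h → (f *ᴬ g) *ᴬ h ≈ᴬ f *ᴬ (g *ᴬ h)
  *ᴬ-assoc f g h = ext λ y → trans (coeff-* (f *ᴬ g) h y) (trans (⟪⟫-*ˡ f g _) (trans
    (⟪⟫-congʳ f λ x → trans
      (⟪⟫-congʳ g λ x′ → ⟪⟫-congʳ h λ z → δ-cong refl (M.assoc x x′ z) M.refl)
      (sym (⟪⟫-*ˡ g h _)))
    (sym (coeff-* f (g *ᴬ h) y))))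

  *ᴬ-distribʳ-+ᴬ : ∀ h f g → (f +ᴬ g) *ᴬ h ≈ᴬ f *ᴬ h +ᴬ g *ᴬ h
  *ᴬ-distribʳ-+ᴬ h f g = ext λ y → trans (coeff-* (f +ᴬ g) h y) (trans (⟪⟫-+ˡ f g _) (trans
    (+-cong (sym (coeff-* f h y)) (sym (coeff-* g h y))) (sym (coeff-+ (f *ᴬ h) (g *ᴬ h) y))))

  *ᴬ-distribˡ-+ᴬ : ∀ h f g → h *ᴬ (f +ᴬ g) ≈ᴬ h *ᴬ f +ᴬ h *ᴬ g
  *ᴬ-distribˡ-+ᴬ h f g = ext λ y → trans (coeff-* h (f +ᴬ g) y) (trans
    (⟪⟫-congʳ h λ x → ⟪⟫-+ˡ f g _) (trans (⟪⟫-+ʳ h _ _) (trans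
    (+-cong (sym (coeff-* h f y)) (sym (coeff-* h g y))) (sym (coeff-+ (h *ᴬ f) (h *ᴬ g) y)))))

  ∙ᴬ-*ᴬ-assoc : ∀ a f g → (a ∙ᴬ f) *ᴬ g ≈ᴬ a ∙ᴬ (f *ᴬ g)
  ∙ᴬ-*ᴬ-assoc a f g = ext λ y → trans (coeff-* (a ∙ᴬ f) g y) (trans (⟪⟫-∙ˡ a f _) (trans
    (*-congˡ (sym (coeff-* f g y))) (sym (coeff-∙ a (f *ᴬ g) y))))

  *ᴬ-∙ᴬ-comm : ∀ a f g → f *ᴬ (a ∙ᴬ g) ≈ᴬ a ∙ᴬ (f *ᴬ g)
  *ᴬ-∙ᴬ-comm a f g = ext λ y → trans (coeff-* f (a ∙ᴬ g) y) (trans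
    (⟪⟫-congʳ f λ x → ⟪⟫-∙ˡ a g _) (trans (⟪⟫-∙ʳ a f _) (trans
    (*-congˡ (sym (coeff-* f g y))) (sym (coeff-∙ a (f *ᴬ g) y)))))

  *ᴬ-zeroʳ : ∀ f → f *ᴬ 0ᴬ ≈ᴬ 0ᴬ
  *ᴬ-zeroʳ f = ext λ y → trans (coeff-* f 0ᴬ y) (⟪⟫-zeroʳ f)

  *ᴬ-identityʳ : ∀ f → f *ᴬ 1ᴬ ≈ᴬ f
  *ᴬ-identityʳ f = ext λ y → trans (coeff-* f 1ᴬ y) (trans
    (⟪⟫-congʳ f λ x → trans (⟪⟫-single M.ε λ z → δ 1# (x M.∙ z) y) (δ-cong refl (M.identityʳ x) M.refl)) (sym (coeff≈⟪⟫ f y)))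

  *ᴬ-identityˡ : ∀ f → 1ᴬ *ᴬ f ≈ᴬ f
  *ᴬ-identityˡ f = ext λ y → trans (coeff-* 1ᴬ f y) (trans
    (⟪⟫-single M.ε λ x → ⟪ f , (λ z → δ 1# (x M.∙ z) y) ⟫) (trans
    (⟪⟫-congʳ f λ x → δ-cong refl (M.identityˡ x) M.refl) (sym (coeff≈⟪⟫ f y))))

  single-* : ∀ x y → single x *ᴬ single y ≈ᴬ single (x M.∙ y)
  single-* x y = ext λ z → +-congʳ (δ-cong (*-identityˡ 1#) M.refl M.refl)

  open CommutativeMonoidSum (LeftModule.+ᴹ-commutativeMonoid leftModule) public
    using () renaming (sum to ∑ᴬ; sum-cong-≋ to ∑ᴬ-cong)
  private module ∑ = CommutativeMonoidSum +-commutativeMonoid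

  coeff-∑ : ∀ {n} (F : Fin n → Element) y → coeff (∑ᴬ F) y ≈ ∑.sum (λ i → coeff (F i) y)
  coeff-∑ {zero}  F y = refl
  coeff-∑ {suc n} F y = trans (coeff-+ (F zero) _ y) (+-congˡ (coeff-∑ (F ∘ suc) y))

  sumᴬ-tabulate : ∀ {a} {A : Set a} {n} (F : A → Element) (g : Fin n → A) →
                  sumᴬ (map F (tabulate g)) ≡ ∑ᴬ (F ∘ g)
  sumᴬ-tabulate {n = zero}  F g = ≡.refl
  sumᴬ-tabulate {n = suc n} F g = ≡.cong (F (g zero) +ᴬ_) (sumᴬ-tabulate F (g ∘ suc))

  *ᴬ-∑ : ∀ f {n} (F : Fin n → Element) → f *ᴬ ∑ᴬ F ≈ᴬ ∑ᴬ (λ i → f *ᴬ F i)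
  *ᴬ-∑ f {zero}  F = *ᴬ-zeroʳ f
  *ᴬ-∑ f {suc n} F = ≈ᴬ-trans (*ᴬ-distribˡ-+ᴬ f (F zero) _) (+ᴬ-cong ≈ᴬ-refl (*ᴬ-∑ f (F ∘ suc)))

module FieldProperties {c ℓ₁ ℓ₂} (F : HeytingField c ℓ₁ ℓ₂) where
  open Scalars F
  open HeytingField F using (_#_; tight; #-sym; #-cotrans; #⇒invertible; heytingCommutativeRing)
  open HeytingCommutativeRingProperties heytingCommutativeRing public
    using (x-0≈x; 1#0; x#0y#0→xy#0; #-congʳ; invertibleˡ⇒#)
  open SetoidReasoning setoid

  ≈-stable : ∀ {x y} → ¬ ¬ (x ≈ y) → x ≈ y
  ≈-stable {x} {y} ¬¬x≈y = proj₁ (tight x y) λ x#y → ¬¬x≈y λ x≈y → proj₂ (tight x y) x≈y x#y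

  #⇒≉ : ∀ {x y} → x # y → ¬ (x ≈ y)
  #⇒≉ {x} {y} x#y x≈y = proj₂ (tight x y) x≈y x#y

  1≉0 : ¬ (1# ≈ 0#)
  1≉0 = #⇒≉ 1#0

  inverse : ∀ {x} → x # 0# → ∃[ y ] y * x ≈ 1#
  inverse {x} x#0 with #⇒invertible x#0
  ... | y , y*[x-0]≈1 , _ = y , trans (*-congˡ (sym (x-0≈x x))) y*[x-0]≈1

  x#y⇒x-y#0 : ∀ {x y} → x # y → x - y # 0#
  x#y⇒x-y#0 {x} {y} x#y with #⇒invertible x#y
  ... | z , z*[x-y]≈1 , _ = invertibleˡ⇒# (z , trans (*-congˡ (x-0≈x _)) z*[x-y]≈1)

  x+y#y⇒x#0 : ∀ {x y} → x + y # y → x # 0#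
  x+y#y⇒x#0 {x} {y} x+y#y = #-congʳ (begin
    x + y - y     ≈⟨ +-assoc _ _ _ ⟩
    x + (y - y)   ≈⟨ +-congˡ (-‿inverseʳ y) ⟩
    x + 0#        ≈⟨ +-identityʳ x ⟩
    x             ∎) (x#y⇒x-y#0 x+y#y)

  x+y#0⇒x#0⊎y#0 : ∀ {x y} → x + y # 0# → x # 0# ⊎ y # 0#
  x+y#0⇒x#0⊎y#0 {x} {y} x+y#0 with #-cotrans x+y#0 y
  ... | inj₁ x+y#y = inj₁ (x+y#y⇒x#0 x+y#y)
  ... | inj₂ y#0   = inj₂ y#0

  *-cancel-0 : ∀ {x y} → x # 0# → x * y ≈ 0# → y ≈ 0#
  *-cancel-0 {x} {y} x#0 xy≈0 with inverse x#0
  ... | z , zx≈1 = begin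
    y             ≈⟨ *-identityˡ y ⟨
    1# * y        ≈⟨ *-congʳ zx≈1 ⟨
    z * x * y     ≈⟨ *-assoc z x y ⟩
    z * (x * y)   ≈⟨ *-congˡ xy≈0 ⟩
    z * 0#        ≈⟨ zeroʳ z ⟩
    0#            ∎

  unit⇒#0 : ∀ {x y} → x * y ≈ 1# → x # 0#
  unit⇒#0 {x} {y} xy≈1 = invertibleˡ⇒# (y , trans (*-congˡ (x-0≈x x)) (trans (*-comm y x) xy≈1))

  module _ (char0 : CharacteristicZero F) where

    fromℕ-homo-+ : ∀ m n → fromℕ (m ℕ.+ n) ≈ fromℕ m + fromℕ n
    fromℕ-homo-+ = MonoidMult.×-homo-+ +-monoid 1#

    fromℕ-#-< : ∀ {m n} → m < n → fromℕ n # fromℕ m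
    fromℕ-#-< {m} {n} m<n with ℕ.m≤n⇒∃[o]m+o≡n m<n
    ... | o , ≡.refl = invertibleˡ⇒# (z , trans (*-congˡ difference) z*k≈1)
      where
      z = proj₁ (inverse (char0 o))
      z*k≈1 = proj₂ (inverse (char0 o))
      difference : fromℕ (suc m ℕ.+ o) - fromℕ m ≈ fromℕ (suc o)
      difference = begin
        fromℕ (suc m ℕ.+ o) - fromℕ m         ≡⟨ ≡.cong (λ k → fromℕ k - fromℕ m) (≡.cong suc (ℕ.+-comm m o)) ⟩
        fromℕ (suc o ℕ.+ m) - fromℕ m         ≈⟨ +-congʳ (fromℕ-homo-+ (suc o) m) ⟩
        fromℕ (suc o) + fromℕ m - fromℕ m     ≈⟨ +-assoc _ _ _ ⟩
        fromℕ (suc o) + (fromℕ m - fromℕ m)   ≈⟨ +-congˡ (-‿inverseʳ _) ⟩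
        fromℕ (suc o) + 0#                    ≈⟨ +-identityʳ _ ⟩
        fromℕ (suc o)                         ∎

    fromℕ-# : ∀ {m n} → m ≢ n → fromℕ m # fromℕ n
    fromℕ-# {m} {n} m≢n with ℕ.<-cmp m n
    ... | tri< m<n _ _ = #-sym (fromℕ-#-< m<n)
    ... | tri≈ _ m≡n _ = ⊥-elim (m≢n m≡n)
    ... | tri> _ _ n<m = fromℕ-#-< n<m

module Diagonalization {k ℓ₁ ℓ₂ m ℓm} (F : HeytingField k ℓ₁ ℓ₂)
                       (V : LeftModule (CommutativeRing.ring (Scalars.commutativeRing F)) m ℓm) where
  open Scalars F hiding (zero)
  open HeytingField F using (_#_; #-sym; #-cotrans)
  open FieldProperties F
  open LeftModule V
  open LinearAlgebra commutativeRing V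
  open RingProperties ring using (-1*x≈-x)
  open CommutativeMonoidSum +ᴹ-commutativeMonoid using (sum; sum-cong-≋; ∑-distrib-+)
  open SetoidReasoning ≈ᴹ-setoid
  private module K = SetoidReasoning setoid
  open CommutativeSemigroupProperties
    (CommutativeMonoid.commutativeSemigroup +ᴹ-commutativeMonoid)
    using (interchange)

  *ₗ-cancel-0 : ∀ {a v} → a # 0# → a *ₗ v ≈ᴹ 0ᴹ → v ≈ᴹ 0ᴹ
  *ₗ-cancel-0 {a} {v} a#0 av≈0 with inverse a#0
  ... | z , za≈1 = begin
    v              ≈⟨ *ₗ-identityˡ v ⟨
    1# *ₗ v        ≈⟨ *ₗ-cong za≈1 ≈ᴹ-refl ⟨
    (z * a) *ₗ v   ≈⟨ *ₗ-assoc z a v ⟩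
    z *ₗ a *ₗ v    ≈⟨ *ₗ-cong refl av≈0 ⟩
    z *ₗ 0ᴹ        ≈⟨ *ₗ-zeroʳ z ⟩
    0ᴹ             ∎

  neg*ₗ-inverse : ∀ a v → a *ₗ v +ᴹ (- a) *ₗ v ≈ᴹ 0ᴹ
  neg*ₗ-inverse a v = begin
    a *ₗ v +ᴹ (- a) *ₗ v  ≈⟨ *ₗ-distribʳ v a (- a) ⟨
    (a - a) *ₗ v          ≈⟨ *ₗ-cong (-‿inverseʳ a) ≈ᴹ-refl ⟩
    0# *ₗ v               ≈⟨ *ₗ-zeroˡ v ⟩
    0ᴹ                    ∎

  u+[-a]v≈0⇒u≈av : ∀ {u a v} → u +ᴹ (- a) *ₗ v ≈ᴹ 0ᴹ → u ≈ᴹ a *ₗ v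
  u+[-a]v≈0⇒u≈av {u} {a} {v} eq = begin
    u                                     ≈⟨ +ᴹ-identityʳ u ⟨
    u +ᴹ 0ᴹ                               ≈⟨ +ᴹ-congˡ (≈ᴹ-trans (+ᴹ-comm _ _) (neg*ₗ-inverse a v)) ⟨
    u +ᴹ ((- a) *ₗ v +ᴹ a *ₗ v)           ≈⟨ +ᴹ-assoc _ _ _ ⟨
    u +ᴹ (- a) *ₗ v +ᴹ a *ₗ v             ≈⟨ +ᴹ-congʳ eq ⟩
    0ᴹ +ᴹ a *ₗ v                          ≈⟨ +ᴹ-identityˡ _ ⟩
    a *ₗ v                                ∎

  lincomb : ∀ {N} → (Fin N → Carrierᴹ) → (Fin N → Carrier) → Carrierᴹ
  lincomb b a = sum (λ i → a i *ₗ b i)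

  lincomb-cong : ∀ {N} (b : Fin N → Carrierᴹ) {a a′} → (∀ i → a i ≈ a′ i) → lincomb b a ≈ᴹ lincomb b a′
  lincomb-cong b a≈a′ = sum-cong-≋ λ i → *ₗ-cong (a≈a′ i) ≈ᴹ-refl

  lincomb-+ : ∀ {N} (b : Fin N → Carrierᴹ) a a′ →
              lincomb b (λ i → a i + a′ i) ≈ᴹ lincomb b a +ᴹ lincomb b a′
  lincomb-+ b a a′ = ≈ᴹ-trans (sum-cong-≋ λ i → *ₗ-distribʳ (b i) (a i) (a′ i)) (∑-distrib-+ (λ i → a i *ₗ b i) (λ i → a′ i *ₗ b i))

  lincomb-∙ : ∀ {N} (b : Fin N → Carrierᴹ) x a → lincomb b (λ i → x * a i) ≈ᴹ x *ₗ lincomb b a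
  lincomb-∙ {zero}  b x a = ≈ᴹ-sym (*ₗ-zeroʳ x)
  lincomb-∙ {suc N} b x a = ≈ᴹ-trans (+ᴹ-cong (*ₗ-assoc x _ _) (lincomb-∙ (b ∘ suc) x (a ∘ suc)))
                                     (≈ᴹ-sym (*ₗ-distribˡ x _ _))

  kronecker : ∀ {N} → Fin N → Fin N → Carrier
  kronecker zero    zero    = 1#
  kronecker zero    (suc j) = 0#
  kronecker (suc i) zero    = 0#
  kronecker (suc i) (suc j) = kronecker i j

  kronecker-diagonal : ∀ {N} (i : Fin N) → kronecker i i ≈ 1#
  kronecker-diagonal zero    = refl
  kronecker-diagonal (suc i) = kronecker-diagonal i

  sum-zero : ∀ {N} {f : Fin N → Carrierᴹ} → (∀ i → f i ≈ᴹ 0ᴹ) → sum f ≈ᴹ 0ᴹ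
  sum-zero {zero}  f≈0 = ≈ᴹ-refl
  sum-zero {suc N} f≈0 = ≈ᴹ-trans (+ᴹ-cong (f≈0 zero) (sum-zero (f≈0 ∘ suc))) (+ᴹ-identityˡ _)

  sum-kronecker : ∀ {N} (i : Fin N) (f : Fin N → Carrierᴹ) → sum (λ j → kronecker i j *ₗ f j) ≈ᴹ f i
  sum-kronecker zero    f =
    ≈ᴹ-trans (+ᴹ-cong (*ₗ-identityˡ _) (sum-zero {f = λ j → 0# *ₗ f (suc j)} λ j → *ₗ-zeroˡ _)) (+ᴹ-identityʳ _)
  sum-kronecker (suc i) f =
    ≈ᴹ-trans (+ᴹ-cong (*ₗ-zeroˡ _) (sum-kronecker i (f ∘ suc))) (+ᴹ-identityˡ _)

  module Coordinates {N} {b : Fin N → Carrierᴹ} (basis : IsBasis b) where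
    open IsBasis basis

    coord : Carrierᴹ → Fin N → Carrier
    coord v = proj₁ (spanning v)

    lincomb-injective : ∀ {a a′} → lincomb b a ≈ᴹ lincomb b a′ → ∀ i → a i ≈ a′ i
    lincomb-injective {a} {a′} eq i =  K.begin
        a i                            K.≈⟨ +-identityʳ _ ⟨
        a i + 0#                        K.≈⟨ +-congˡ (-‿inverseˡ _) ⟨
        a i + (- a′ i + a′ i)           K.≈⟨ +-assoc _ _ _ ⟨
        a i - a′ i + a′ i               K.≈⟨ +-congʳ (+-congˡ (-1*x≈-x _)) ⟨
        a i + (- 1#) * a′ i + a′ i      K.≈⟨ +-congʳ (independent _ difference i) ⟩
        0# + a′ i                       K.≈⟨ +-identityˡ _ ⟩
        a′ i                            K.∎
      where
      difference : lincomb b (λ i → a i + (- 1#) * a′ i) ≈ᴹ 0ᴹ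
      difference = begin
        lincomb b (λ i → a i + (- 1#) * a′ i)           ≈⟨ lincomb-+ b a _ ⟩
        lincomb b a +ᴹ lincomb b (λ i → (- 1#) * a′ i)  ≈⟨ +ᴹ-cong eq (lincomb-∙ b (- 1#) a′) ⟩
        lincomb b a′ +ᴹ (- 1#) *ₗ lincomb b a′          ≈⟨ +ᴹ-congʳ (*ₗ-identityˡ _) ⟨
        1# *ₗ lincomb b a′ +ᴹ (- 1#) *ₗ lincomb b a′    ≈⟨ neg*ₗ-inverse 1# _ ⟩
        0ᴹ                                              ∎

    coord-unique : ∀ {v a} → v ≈ᴹ lincomb b a → ∀ i → coord v i ≈ a i
    coord-unique {v} v≈ = lincomb-injective (≈ᴹ-trans (≈ᴹ-sym (proj₂ (spanning v))) v≈)

    coord-+ : ∀ u v i → coord (u +ᴹ v) i ≈ coord u i + coord v i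
    coord-+ u v = coord-unique (≈ᴹ-trans (+ᴹ-cong (proj₂ (spanning u)) (proj₂ (spanning v)))
                                         (≈ᴹ-sym (lincomb-+ b _ _)))

    coord-cong : ∀ {u v} → u ≈ᴹ v → ∀ i → coord u i ≈ coord v i
    coord-cong u≈v = coord-unique (≈ᴹ-trans u≈v (proj₂ (spanning _)))

    coord-zero : ∀ i → coord 0ᴹ i ≈ 0#
    coord-zero = coord-unique {a = λ _ → 0#} (≈ᴹ-sym (sum-zero {f = λ i → 0# *ₗ b i} λ i → *ₗ-zeroˡ _))

    coord-basis : ∀ i → coord (b i) i ≈ 1#
    coord-basis i = trans (coord-unique (≈ᴹ-sym (sum-kronecker i b)) i) (kronecker-diagonal i)

    basis≉0 : ∀ i → ¬ b i ≈ᴹ 0ᴹ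
    basis≉0 i bᵢ≈0 = 1≉0 (trans (sym (coord-basis i)) (trans (coord-cong bᵢ≈0 i) (coord-zero i)))

    -- Replacing bᵢ by w changes Σ cⱼ bⱼ by cᵢ (w - bᵢ).
    lincomb-updateAt : ∀ i w c → lincomb (updateAt b i λ _ → w) c
                       ≈ᴹ lincomb b (λ j → c j + c i * (coord w j - kronecker i j))
    lincomb-updateAt i w c = begin
      lincomb (updateAt b i λ _ → w) c
        ≈⟨ expand i b c ⟩
      lincomb b c +ᴹ c i *ₗ (w +ᴹ (- 1#) *ₗ b i)
        ≈⟨ +ᴹ-congˡ (*ₗ-cong refl (+ᴹ-cong (proj₂ (spanning w)) (*ₗ-cong refl (≈ᴹ-sym (sum-kronecker i b))))) ⟩
      lincomb b c +ᴹ c i *ₗ (lincomb b (coord w) +ᴹ (- 1#) *ₗ lincomb b (kronecker i))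
        ≈⟨ +ᴹ-congˡ (*ₗ-cong refl (+ᴹ-congˡ (lincomb-∙ b (- 1#) _))) ⟨
      lincomb b c +ᴹ c i *ₗ (lincomb b (coord w) +ᴹ lincomb b (λ j → (- 1#) * kronecker i j))
        ≈⟨ +ᴹ-congˡ (*ₗ-cong refl (lincomb-+ b _ _)) ⟨
      lincomb b c +ᴹ c i *ₗ lincomb b (λ j → coord w j + (- 1#) * kronecker i j)
        ≈⟨ +ᴹ-congˡ (lincomb-∙ b (c i) _) ⟨
      lincomb b c +ᴹ lincomb b (λ j → c i * (coord w j + (- 1#) * kronecker i j))
        ≈⟨ lincomb-+ b _ _ ⟨
      lincomb b (λ j → c j + c i * (coord w j + (- 1#) * kronecker i j))
        ≈⟨ lincomb-cong b (λ j → +-congˡ (*-congˡ (+-congˡ (-1*x≈-x _)))) ⟩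
      lincomb b (λ j → c j + c i * (coord w j - kronecker i j)) ∎
      where
      expand : ∀ {N} i (b : Fin N → Carrierᴹ) c →
               lincomb (updateAt b i λ _ → w) c ≈ᴹ lincomb b c +ᴹ c i *ₗ (w +ᴹ (- 1#) *ₗ b i)
      expand {suc N} zero b c = begin
        c₀ *ₗ w +ᴹ r                                         ≈⟨ +ᴹ-congʳ (*ₗ-cong refl w≈) ⟩
        c₀ *ₗ (b zero +ᴹ (w +ᴹ (- 1#) *ₗ b zero)) +ᴹ r       ≈⟨ +ᴹ-congʳ (*ₗ-distribˡ c₀ _ _) ⟩
        c₀ *ₗ b zero +ᴹ c₀ *ₗ (w +ᴹ (- 1#) *ₗ b zero) +ᴹ r   ≈⟨ +ᴹ-assoc _ _ _ ⟩
        c₀ *ₗ b zero +ᴹ (c₀ *ₗ (w +ᴹ (- 1#) *ₗ b zero) +ᴹ r) ≈⟨ +ᴹ-congˡ (+ᴹ-comm _ _) ⟩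
        c₀ *ₗ b zero +ᴹ (r +ᴹ c₀ *ₗ (w +ᴹ (- 1#) *ₗ b zero)) ≈⟨ +ᴹ-assoc _ _ _ ⟨
        c₀ *ₗ b zero +ᴹ r +ᴹ c₀ *ₗ (w +ᴹ (- 1#) *ₗ b zero)   ∎
        where
        c₀ = c zero
        r  = lincomb (b ∘ suc) (c ∘ suc)
        w≈ : w ≈ᴹ b zero +ᴹ (w +ᴹ (- 1#) *ₗ b zero)
        w≈ = begin
          w                                        ≈⟨ +ᴹ-identityʳ w ⟨
          w +ᴹ 0ᴹ                                  ≈⟨ +ᴹ-congˡ (neg*ₗ-inverse 1# (b zero)) ⟨
          w +ᴹ (1# *ₗ b zero +ᴹ (- 1#) *ₗ b zero)  ≈⟨ +ᴹ-congˡ (+ᴹ-congʳ (*ₗ-identityˡ _)) ⟩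
          w +ᴹ (b zero +ᴹ (- 1#) *ₗ b zero)        ≈⟨ +ᴹ-assoc _ _ _ ⟨
          w +ᴹ b zero +ᴹ (- 1#) *ₗ b zero          ≈⟨ +ᴹ-congʳ (+ᴹ-comm _ _) ⟩
          b zero +ᴹ w +ᴹ (- 1#) *ₗ b zero          ≈⟨ +ᴹ-assoc _ _ _ ⟩
          b zero +ᴹ (w +ᴹ (- 1#) *ₗ b zero)        ∎
      expand {suc N} (suc i) b c =
        ≈ᴹ-trans (+ᴹ-congˡ (expand i (b ∘ suc) (c ∘ suc))) (≈ᴹ-sym (+ᴹ-assoc _ _ _))

    exchange : ∀ i w → coord w i # 0# → IsBasis (updateAt b i λ _ → w)
    exchange i w wᵢ#0 = record { independent = independent′ ; spanning = spanning′ }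
      where
      at-i : ∀ x → x + x * (coord w i - kronecker i i) ≈ coord w i * x
      at-i x = K.begin
        x + x * (coord w i - kronecker i i)    K.≈⟨ +-congˡ (*-congˡ (+-congˡ (-‿cong (kronecker-diagonal i)))) ⟩
        x + x * (coord w i - 1#)               K.≈⟨ +-congʳ (*-identityʳ x) ⟨
        x * 1# + x * (coord w i - 1#)          K.≈⟨ distribˡ x _ _ ⟨
        x * (1# + (coord w i - 1#))            K.≈⟨ *-congˡ (+-comm _ _) ⟩
        x * (coord w i - 1# + 1#)              K.≈⟨ *-congˡ (trans (+-assoc _ _ _) (+-congˡ (-‿inverseˡ 1#))) ⟩
        x * (coord w i + 0#)                   K.≈⟨ *-congˡ (+-identityʳ _) ⟩
        x * coord w i                          K.≈⟨ *-comm _ _ ⟩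
        coord w i * x                          K.∎

      independent′ : ∀ c → lincomb (updateAt b i λ _ → w) c ≈ᴹ 0ᴹ → ∀ j → c j ≈ 0#
      independent′ c eq j = K.begin
        c j                                             K.≈⟨ +-identityʳ _ ⟨
        c j + 0#                                        K.≈⟨ +-congˡ (trans (*-congʳ cᵢ≈0) (zeroˡ _)) ⟨
        c j + c i * (coord w j - kronecker i j)         K.≈⟨ zeros j ⟩
        0#                                              K.∎
        where
        zeros : ∀ j → c j + c i * (coord w j - kronecker i j) ≈ 0#
        zeros = independent _ (≈ᴹ-trans (≈ᴹ-sym (lincomb-updateAt i w c)) eq)
        cᵢ≈0 : c i ≈ 0#
        cᵢ≈0 = *-cancel-0 wᵢ#0 (trans (sym (at-i (c i))) (zeros i))

      spanning′ : ∀ v → Σ (Fin N → Carrier) λ c → v ≈ᴹ lincomb (updateAt b i λ _ → w) c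
      spanning′ v with inverse wᵢ#0
      ... | z , zwᵢ≈1 = c , ≈ᴹ-trans (proj₂ (spanning v)) (≈ᴹ-trans (lincomb-cong b coefficients)
                                     (≈ᴹ-sym (lincomb-updateAt i w c)))
        where
        x = z * coord v i
        c : Fin N → Carrier
        c j = coord v j - x * (coord w j - kronecker i j)
        c+ : ∀ j → c j + x * (coord w j - kronecker i j) ≈ coord v j
        c+ j = trans (+-assoc _ _ _) (trans (+-congˡ (-‿inverseˡ _)) (+-identityʳ _))
        wx≈vᵢ : coord w i * x ≈ coord v i
        wx≈vᵢ = trans (sym (*-assoc _ _ _)) (trans (*-congʳ (trans (*-comm _ _) zwᵢ≈1)) (*-identityˡ _))
        cᵢ≈x : c i ≈ x
        cᵢ≈x = K.begin
          coord v i - y       K.≈⟨ +-congʳ (trans (sym wx≈vᵢ) (sym (at-i x))) ⟩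
          x + y - y           K.≈⟨ +-assoc _ _ _ ⟩
          x + (y - y)         K.≈⟨ +-congˡ (-‿inverseʳ y) ⟩
          x + 0#              K.≈⟨ +-identityʳ x ⟩
          x                   K.∎
          where y = x * (coord w i - kronecker i i)
        coefficients : ∀ j → coord v j ≈ c j + c i * (coord w j - kronecker i j)
        coefficients j = trans (sym (c+ j)) (+-congˡ (*-congʳ (sym cᵢ≈x)))

  module Operators {t : Operator} (t-linear : IsLinear t) where
    open LeftModuleMorphisms.IsLeftModuleHomomorphism t-linear public
      using () renaming (⟦⟧-cong to t-cong; +ᴹ-homo to t-+; *ₗ-homo to t-*ₗ; 0ᴹ-homo to t-0)

    shift : Carrier → Carrierᴹ → Carrierᴹ
    shift a v = t v +ᴹ (- a) *ₗ v

    shifts : List Carrier → Carrierᴹ → Carrierᴹ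
    shifts L v = foldr shift v L

    shift-cong : ∀ a {u v} → u ≈ᴹ v → shift a u ≈ᴹ shift a v
    shift-cong a u≈v = +ᴹ-cong (t-cong u≈v) (*ₗ-cong refl u≈v)

    shift-+ : ∀ a u v → shift a (u +ᴹ v) ≈ᴹ shift a u +ᴹ shift a v
    shift-+ a u v = ≈ᴹ-trans (+ᴹ-cong (t-+ u v) (*ₗ-distribˡ (- a) u v)) (interchange _ _ _ _)

    shift-*ₗ : ∀ a x v → shift a (x *ₗ v) ≈ᴹ x *ₗ shift a v
    shift-*ₗ a x v = begin
      t (x *ₗ v) +ᴹ (- a) *ₗ x *ₗ v   ≈⟨ +ᴹ-cong (t-*ₗ x v) (≈ᴹ-sym (*ₗ-assoc _ x v)) ⟩
      x *ₗ t v +ᴹ ((- a) * x) *ₗ v    ≈⟨ +ᴹ-congˡ (*ₗ-cong (*-comm _ x) ≈ᴹ-refl) ⟩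
      x *ₗ t v +ᴹ (x * (- a)) *ₗ v    ≈⟨ +ᴹ-congˡ (*ₗ-assoc x _ v) ⟩
      x *ₗ t v +ᴹ x *ₗ (- a) *ₗ v     ≈⟨ *ₗ-distribˡ x _ _ ⟨
      x *ₗ shift a v                  ∎

    shift-0 : ∀ a → shift a 0ᴹ ≈ᴹ 0ᴹ
    shift-0 a = ≈ᴹ-trans (+ᴹ-cong t-0 (*ₗ-zeroʳ _)) (+ᴹ-identityˡ _)

    shift-comm : ∀ a b v → shift a (shift b v) ≈ᴹ shift b (shift a v)
    shift-comm a b v = begin
      t (shift b v) +ᴹ (- a) *ₗ shift b v     ≈⟨ +ᴹ-cong t-shift (≈ᴹ-sym (shift-*ₗ b (- a) v)) ⟩
      shift b (t v) +ᴹ shift b ((- a) *ₗ v)   ≈⟨ shift-+ b _ _ ⟨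
      shift b (shift a v)                     ∎
      where
      t-shift : t (shift b v) ≈ᴹ shift b (t v)
      t-shift = ≈ᴹ-trans (t-+ _ _) (+ᴹ-congˡ (t-*ₗ (- b) v))

    shifts-cong : ∀ L {u v} → u ≈ᴹ v → shifts L u ≈ᴹ shifts L v
    shifts-cong []      u≈v = u≈v
    shifts-cong (a ∷ L) u≈v = shift-cong a (shifts-cong L u≈v)

    shift-shifts : ∀ a L v → shift a (shifts L v) ≈ᴹ shifts L (shift a v)
    shift-shifts a []      v = ≈ᴹ-refl
    shift-shifts a (b ∷ L) v = ≈ᴹ-trans (shift-comm a b _) (shift-cong b (shift-shifts a L v))

    shift-eigen : ∀ {x v} a → t v ≈ᴹ x *ₗ v → shift a v ≈ᴹ (x - a) *ₗ v
    shift-eigen {x} {v} a tv≈xv = ≈ᴹ-trans (+ᴹ-congʳ tv≈xv) (≈ᴹ-sym (*ₗ-distribʳ v x (- a)))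

    shifts-*ₗ : ∀ L x v → shifts L (x *ₗ v) ≈ᴹ x *ₗ shifts L v
    shifts-*ₗ []      x v = ≈ᴹ-refl
    shifts-*ₗ (a ∷ L) x v = ≈ᴹ-trans (shift-cong a (shifts-*ₗ L x v)) (shift-*ₗ a x _)

    shifts-eigen-∷ : ∀ {x v} a L → t v ≈ᴹ x *ₗ v → shifts (a ∷ L) v ≈ᴹ (x - a) *ₗ shifts L v
    shifts-eigen-∷ {x} {v} a L tv≈xv = begin
      shift a (shifts L v)      ≈⟨ shift-shifts a L v ⟩
      shifts L (shift a v)      ≈⟨ shifts-cong L (shift-eigen a tv≈xv) ⟩
      shifts L ((x - a) *ₗ v)   ≈⟨ shifts-*ₗ L _ v ⟩
      (x - a) *ₗ shifts L v     ∎

    shifts-eigen-cancel : ∀ {x v} L → All (x #_) L → t v ≈ᴹ x *ₗ v → shifts L v ≈ᴹ 0ᴹ → v ≈ᴹ 0ᴹ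
    shifts-eigen-cancel []      []            tv≈xv eq = eq
    shifts-eigen-cancel (a ∷ L) (x#a ∷ x#L) tv≈xv eq = shifts-eigen-cancel L x#L tv≈xv
      (*ₗ-cancel-0 (x#y⇒x-y#0 x#a) (≈ᴹ-trans (≈ᴹ-sym (shifts-eigen-∷ a L tv≈xv)) eq))

    apart-from-head-or-tail : ∀ x a L → All (a #_) L → x # a ⊎ All (x #_) L
    apart-from-head-or-tail x a []      []          = inj₂ []
    apart-from-head-or-tail x a (b ∷ L) (a#b ∷ a#L) with #-cotrans a#b x
    ... | inj₁ a#x = inj₁ (#-sym a#x)
    ... | inj₂ x#b with apart-from-head-or-tail x a L a#L
    ...   | inj₁ x#a = inj₁ x#a
    ...   | inj₂ x#L = inj₂ (x#b ∷ x#L)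

    -- Equality of scalars is not decidable: the root equal to x is found by cotransitivity.
    eigenvalue-root : ∀ L → AllPairs _#_ L → ∀ {x v} → IsEigenvector t x v → shifts L v ≈ᴹ 0ᴹ → Any (x ≈_) L
    eigenvalue-root []      []            (v≉0 , _) eq = ⊥-elim (v≉0 eq)
    eigenvalue-root (a ∷ L) (a#L ∷ L#L) {x} {v} (v≉0 , tv≈xv) eq with apart-from-head-or-tail x a L a#L
    ... | inj₁ x#a = there (eigenvalue-root L L#L (v≉0 , tv≈xv)
      (*ₗ-cancel-0 (x#y⇒x-y#0 x#a) (≈ᴹ-trans (≈ᴹ-sym (shifts-eigen-∷ a L tv≈xv)) eq)))
    ... | inj₂ x#L = here (proj₁ (HeytingField.tight F x a)
      λ x#a → v≉0 (shifts-eigen-cancel (a ∷ L) (x#a ∷ x#L) tv≈xv eq))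

    sumᴸ : List Carrierᴹ → Carrierᴹ
    sumᴸ = foldr _+ᴹ_ 0ᴹ

    EigenIn : List Carrier → Carrierᴹ → Set (k ⊔ ℓm ⊔ ℓ₂)
    EigenIn L u = ∃[ a ] (∀ k → All (k #_) L → k # a) × t u ≈ᴹ a *ₗ u

    divide-eigenvectors : ∀ k L → All (k #_) L → ∀ us → All (EigenIn L) us →
                          ∃[ us′ ] All (EigenIn L) us′ × shift k (sumᴸ us′) ≈ᴹ sumᴸ us
    divide-eigenvectors k L k#L []       []                       = [] , [] , shift-0 k
    divide-eigenvectors k L k#L (u ∷ us) ((a , a∈L , tu≈au) ∷ es)
      with divide-eigenvectors k L k#L us es | inverse (x#y⇒x-y#0 (#-sym (a∈L k k#L)))
    ... | us′ , es′ , eq | z , z[a-k]≈1 =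
      z *ₗ u ∷ us′ , (a , a∈L , tu′≈au′) ∷ es′ , ≈ᴹ-trans (shift-+ k _ _) (+ᴹ-cong shift-u′ eq)
      where
      tu′≈au′ : t (z *ₗ u) ≈ᴹ a *ₗ z *ₗ u
      tu′≈au′ = begin
        t (z *ₗ u)    ≈⟨ t-*ₗ z u ⟩
        z *ₗ t u      ≈⟨ *ₗ-cong refl tu≈au ⟩
        z *ₗ a *ₗ u   ≈⟨ *ₗ-assoc z a u ⟨
        (z * a) *ₗ u  ≈⟨ *ₗ-cong (*-comm z a) ≈ᴹ-refl ⟩
        (a * z) *ₗ u  ≈⟨ *ₗ-assoc a z u ⟩
        a *ₗ z *ₗ u   ∎
      shift-u′ : shift k (z *ₗ u) ≈ᴹ u
      shift-u′ = begin
        shift k (z *ₗ u)      ≈⟨ shift-*ₗ k z u ⟩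
        z *ₗ shift k u        ≈⟨ *ₗ-cong refl (shift-eigen k tu≈au) ⟩
        z *ₗ (a - k) *ₗ u     ≈⟨ *ₗ-assoc z _ u ⟨
        (z * (a - k)) *ₗ u    ≈⟨ *ₗ-cong z[a-k]≈1 ≈ᴹ-refl ⟩
        1# *ₗ u               ≈⟨ *ₗ-identityˡ u ⟩
        u                     ∎

    decompose : ∀ L → AllPairs _#_ L → ∀ v → shifts L v ≈ᴹ 0ᴹ →
                ∃[ us ] All (EigenIn L) us × v ≈ᴹ sumᴸ us
    decompose []      []          v v≈0 = [] , [] , v≈0
    decompose (k ∷ L) (k#L ∷ L#L) v eq
      with decompose L L#L (shift k v) (≈ᴹ-trans (≈ᴹ-sym (shift-shifts k L v)) eq)
    ... | us , es , eq₁ with divide-eigenvectors k L k#L us es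
    ...   | us′ , es′ , eq₂ =
      r ∷ us′ , (k , (λ _ → All.head) , u+[-a]v≈0⇒u≈av shift-r) ∷ All.map (λ (a , a∈L , e) → a , (λ k → a∈L k ∘ All.tail) , e) es′ , v≈
      where
      s = sumᴸ us′
      r = v +ᴹ (- 1#) *ₗ s
      shift-r : shift k r ≈ᴹ 0ᴹ
      shift-r = begin
        shift k r                                ≈⟨ shift-+ k _ _ ⟩
        shift k v +ᴹ shift k ((- 1#) *ₗ s)       ≈⟨ +ᴹ-congˡ (shift-*ₗ k _ s) ⟩
        shift k v +ᴹ (- 1#) *ₗ shift k s         ≈⟨ +ᴹ-cong (≈ᴹ-trans eq₁ (≈ᴹ-sym eq₂)) ≈ᴹ-refl ⟩
        shift k s +ᴹ (- 1#) *ₗ shift k s         ≈⟨ +ᴹ-congʳ (*ₗ-identityˡ _) ⟨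
        1# *ₗ shift k s +ᴹ (- 1#) *ₗ shift k s   ≈⟨ neg*ₗ-inverse 1# _ ⟩
        0ᴹ                                       ∎
      v≈ : v ≈ᴹ r +ᴹ s
      v≈ = begin
        v                                  ≈⟨ +ᴹ-identityʳ v ⟨
        v +ᴹ 0ᴹ                            ≈⟨ +ᴹ-congˡ (neg*ₗ-inverse 1# s) ⟨
        v +ᴹ (1# *ₗ s +ᴹ (- 1#) *ₗ s)      ≈⟨ +ᴹ-congˡ (+ᴹ-comm _ _) ⟩
        v +ᴹ ((- 1#) *ₗ s +ᴹ 1# *ₗ s)      ≈⟨ +ᴹ-assoc _ _ _ ⟨
        r +ᴹ 1# *ₗ s                       ≈⟨ +ᴹ-congˡ (*ₗ-identityˡ s) ⟩
        r +ᴹ s                             ∎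

    module _ {L} (L#L : AllPairs _#_ L) (annihilated : ∀ v → shifts L v ≈ᴹ 0ᴹ) where

      eigenvector-with-coordinate : ∀ {N} {b : Fin N → Carrierᴹ} (basis : IsBasis b) i →
        let open Coordinates basis in ∃[ u ] coord u i # 0# × (∃[ a ] t u ≈ᴹ a *ₗ u)
      eigenvector-with-coordinate {b = b} basis i with decompose L L#L (b i) (annihilated (b i))
      ... | us , es , bᵢ≈ = search us es
              (#-congʳ (trans (sym (coord-basis i)) (coord-cong bᵢ≈ i)) 1#0)
        where
        open Coordinates basis
        search : ∀ us → All (EigenIn L) us → coord (sumᴸ us) i # 0# →
                 ∃[ u ] coord u i # 0# × (∃[ a ] t u ≈ᴹ a *ₗ u)
        search []       []       0#0 = ⊥-elim (#⇒≉ 0#0 (coord-zero i))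
        search (u ∷ us) ((a , _ , tu≈au) ∷ es) s#0
          with x+y#0⇒x#0⊎y#0 (#-congʳ (coord-+ u (sumᴸ us) i) s#0)
        ... | inj₁ u#0 = u , u#0 , a , tu≈au
        ... | inj₂ r#0 = search us es r#0

      diagonalize-prefix : ∀ {N} {b : Fin N → Carrierᴹ} → IsBasis b → ∀ k → k ≤ N →
        Σ (Fin N → Carrierᴹ) λ b′ → IsBasis b′ × (∀ j → toℕ j < k → ∃[ a ] t (b′ j) ≈ᴹ a *ₗ b′ j)
      diagonalize-prefix {b = b} basis zero    k≤N = b , basis , λ j ()
      diagonalize-prefix basis (suc k) k<N
        with diagonalize-prefix basis k (ℕ.<⇒≤ k<N)
      ... | b′ , basis′ , eigen with eigenvector-with-coordinate basis′ (fromℕ< k<N)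
      ...   | u , u#0 , a , tu≈au =
        updateAt b′ i (λ _ → u) , Coordinates.exchange basis′ i u u#0 , eigen′
        where
        i = fromℕ< k<N
        eigen′ : ∀ j → toℕ j < suc k →
                 ∃[ a ] t (updateAt b′ i (λ _ → u) j) ≈ᴹ a *ₗ updateAt b′ i (λ _ → u) j
        eigen′ j j<1+k with j Fin.≟ i
        ... | yes ≡.refl rewrite Vector.updateAt-updates i {λ _ → u} b′ = a , tu≈au
        ... | no j≢i rewrite Vector.updateAt-minimal j i {λ _ → u} b′ j≢i = eigen j
          (ℕ.≤∧≢⇒< (ℕ.≤-pred j<1+k) λ j≡k → j≢i (Fin.toℕ-injective (≡.trans j≡k (≡.sym (Fin.toℕ-fromℕ< k<N)))))

      diagonalizable : ∀ {N} {b : Fin N → Carrierᴹ} → IsBasis b → IsDiagonalizable t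
      diagonalizable {N} basis with diagonalize-prefix basis N ℕ.≤-refl
      ... | b′ , basis′ , eigen = N , b′ , basis′ , λ i →
        let (a , eq) = eigen i (Fin.toℕ<n i) in a , Coordinates.basis≉0 basis′ i , eq

module Evaluation {k ℓ₁ ℓ₂ m ℓm} (F : HeytingField k ℓ₁ ℓ₂)
                  (V : LeftModule (CommutativeRing.ring (Scalars.commutativeRing F)) m ℓm)
                  {t : LeftModule.Carrierᴹ V → LeftModule.Carrierᴹ V}
                  (t-linear : LinearAlgebra.IsLinear (Scalars.commutativeRing F) V t) where
  open Scalars F hiding (zero)
  open LeftModule V
  open LinearAlgebra commutativeRing V
  open Polynomial commutativeRing
  private module Poly = MonoidAlgebraProperties commutativeRing ℕ.+-0-monoid ℕ._≟_
  open Poly.Pairing V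
  open Diagonalization F V
  open Operators t-linear
  open SetoidReasoning ≈ᴹ-setoid

  evalAt≈⟪⟫ : ∀ p v → evalAt p t v ≈ᴹ ⟪ p , fold v t ⟫
  evalAt≈⟪⟫ []            v = ≈ᴹ-refl
  evalAt≈⟪⟫ ((a , i) ∷ p) v = +ᴹ-congˡ (evalAt≈⟪⟫ p v)

  evalAt-congˡ : ∀ {p q} v → p ≈ᴬ q → evalAt p t v ≈ᴹ evalAt q t v
  evalAt-congˡ {p} {q} v p≈q = begin
    evalAt p t v      ≈⟨ evalAt≈⟪⟫ p v ⟩
    ⟪ p , fold v t ⟫  ≈⟨ ⟪⟫-congˡ (λ i≡j → ≈ᴹ-reflexive (≡.cong (fold v t) i≡j)) p≈q ⟩
    ⟪ q , fold v t ⟫  ≈⟨ evalAt≈⟪⟫ q v ⟨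
    evalAt q t v      ∎

  fold-cong : ∀ {u v} → u ≈ᴹ v → ∀ i → fold u t i ≈ᴹ fold v t i
  fold-cong u≈v zero    = u≈v
  fold-cong u≈v (suc i) = t-cong (fold-cong u≈v i)

  fold-+ : ∀ v i j → fold v t (i ℕ.+ j) ≡ fold (fold v t j) t i
  fold-+ v zero    j = ≡.refl
  fold-+ v (suc i) j = ≡.cong t (fold-+ v i j)

  fold-⟪⟫ : ∀ i q φ → fold ⟪ q , φ ⟫ t i ≈ᴹ ⟪ q , (λ j → fold (φ j) t i) ⟫
  fold-⟪⟫ zero    q φ = ≈ᴹ-refl
  fold-⟪⟫ (suc i) q φ = ≈ᴹ-trans (t-cong (fold-⟪⟫ i q φ)) (t-⟪⟫ q)
    where
    t-⟪⟫ : ∀ {φ} q → t ⟪ q , φ ⟫ ≈ᴹ ⟪ q , t ∘ φ ⟫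
    t-⟪⟫ []            = t-0
    t-⟪⟫ ((a , i) ∷ q) = ≈ᴹ-trans (t-+ _ _) (+ᴹ-cong (t-*ₗ a _) (t-⟪⟫ q))

  evalAt-* : ∀ p q v → evalAt (p *ᴬ q) t v ≈ᴹ evalAt p t (evalAt q t v)
  evalAt-* p q v = begin
    evalAt (p *ᴬ q) t v                               ≈⟨ evalAt≈⟪⟫ (p *ᴬ q) v ⟩
    ⟪ p *ᴬ q , fold v t ⟫                             ≈⟨ ⟪⟫-*ˡ p q (fold v t) ⟩
    ⟪ p , (λ i → ⟪ q , (λ j → fold v t (i ℕ.+ j)) ⟫) ⟫  ≈⟨ ⟪⟫-congʳ p inner ⟩
    ⟪ p , fold (evalAt q t v) t ⟫                     ≈⟨ evalAt≈⟪⟫ p _ ⟨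
    evalAt p t (evalAt q t v)                         ∎
    where
    inner : ∀ i → ⟪ q , (λ j → fold v t (i ℕ.+ j)) ⟫ ≈ᴹ fold (evalAt q t v) t i
    inner i = begin
      ⟪ q , (λ j → fold v t (i ℕ.+ j)) ⟫      ≈⟨ ⟪⟫-congʳ q (λ j → ≈ᴹ-reflexive (fold-+ v i j)) ⟩
      ⟪ q , (λ j → fold (fold v t j) t i) ⟫   ≈⟨ fold-⟪⟫ i q (fold v t) ⟨
      fold ⟪ q , fold v t ⟫ t i               ≈⟨ fold-cong (evalAt≈⟪⟫ q v) i ⟨
      fold (evalAt q t v) t i                 ∎

  evalAt-X- : ∀ a v → evalAt (X- a) t v ≈ᴹ shift a v
  evalAt-X- a v = +ᴹ-cong (*ₗ-identityˡ _)
    (≈ᴹ-trans (+ᴹ-identityʳ _) (*ₗ-cong (-‿cong (*-identityʳ a)) ≈ᴹ-refl))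

  evalAt-product : ∀ L v → evalAt (productᴬ (map X-_ L)) t v ≈ᴹ shifts L v
  evalAt-product []      v = ≈ᴹ-trans (+ᴹ-identityʳ _) (*ₗ-identityˡ v)
  evalAt-product (a ∷ L) v = begin
    evalAt ((X- a) *ᴬ productᴬ (map X-_ L)) t v         ≈⟨ evalAt-* (X- a) (productᴬ (map X-_ L)) v ⟩
    evalAt (X- a) t (evalAt (productᴬ (map X-_ L)) t v) ≈⟨ evalAt-X- a _ ⟩
    shift a (evalAt (productᴬ (map X-_ L)) t v)         ≈⟨ shift-cong a (evalAt-product L v) ⟩
    shift a (shifts L v)                                ∎

module Roots {k ℓ₁ ℓ₂} (F : HeytingField k ℓ₁ ℓ₂) where
  open Scalars F hiding (zero)
  open HeytingField F using (_#_; #-sym)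
  open FieldProperties F
  open Polynomial commutativeRing
  open MonoidAlgebraProperties commutativeRing ℕ.+-0-monoid ℕ._≟_
  open RingProperties ring using (-‿distribʳ-*; -‿distribˡ-*)
  open CommutativeSemigroupProperties *-commutativeSemigroup using (x∙yz≈y∙xz)
  private module L = LinearAlgebra commutativeRing (TensorUnit.leftModule {R = ring})

  scaling-linear : ∀ x → L.IsLinear (x *_)
  scaling-linear x = record
    { +ᴹ-isGroupHomomorphism = record
      { isMonoidHomomorphism = record
        { isMagmaHomomorphism = record
          { isRelHomomorphism = record { cong = *-congˡ }
          ; homo = distribˡ x
          }
        ; ε-homo = zeroʳ x
        }
      ; ⁻¹-homo = λ y → sym (-‿distribʳ-* x y)
      }
    ; *ₗ-homo = λ a y → x∙yz≈y∙xz x a y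
    }

  value : Element → Carrier → Carrier
  value p x = L.evalAt p (x *_) 1#

  value-factor : ∀ x a p → value ((X- a) *ᴬ p) x ≈ (x - a) * value p x
  value-factor x a p = trans (E.evalAt-* (X- a) p 1#) (trans (E.evalAt-X- a _) (sym (distribʳ _ x (- a))))
    where module E = Evaluation F TensorUnit.leftModule (scaling-linear x)

  value-cong : ∀ x {p q} → p ≈ᴬ q → value p x ≈ value q x
  value-cong x = Evaluation.evalAt-congˡ F TensorUnit.leftModule (scaling-linear x) 1#

  X-*ᴬ : ∀ a p → (X- a) *ᴬ p ≈ᴬ single 1 *ᴬ p +ᴬ (- a) ∙ᴬ p
  X-*ᴬ a p = ≈ᴬ-trans (*ᴬ-distribʳ-+ᴬ p (single 1) (-ᴬ (a ∙ᴬ 1ᴬ))) (+ᴬ-cong ≈ᴬ-refl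
    (≈ᴬ-trans (*ᴬ-cong {g = p} -[a1]≈[-a]1 ≈ᴬ-refl) (≈ᴬ-trans (∙ᴬ-*ᴬ-assoc (- a) 1ᴬ p) (∙ᴬ-cong refl (*ᴬ-identityˡ p)))))
    where
    -[a1]≈[-a]1 : -ᴬ (a ∙ᴬ 1ᴬ) ≈ᴬ (- a) ∙ᴬ 1ᴬ
    -[a1]≈[-a]1 = ext λ y → +-congʳ (δ-cong {y = y} (-‿distribˡ-* a 1#) (≡.refl {x = 0}) ≡.refl)

  divideX- : ∀ a q → ∃[ r ] q ≈ᴬ (X- a) *ᴬ r +ᴬ value q a ∙ᴬ 1ᴬ
  divideX- a []            = [] , ≈ᴬ-sym (≈ᴬ-trans (+ᴬ-cong (*ᴬ-zeroʳ (X- a)) (≈ᴬ-refl {x = 0# ∙ᴬ 1ᴬ})) (ext λ y → trans (coeff-∙ 0# 1ᴬ y) (zeroˡ _)))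
  divideX- a ((b , i) ∷ q) with divideX- a q | monomial i
    where
    monomial : ∀ i → ∃[ r ] single i ≈ᴬ (X- a) *ᴬ r +ᴬ fold 1# (a *_) i ∙ᴬ 1ᴬ
    monomial zero    = [] , ≈ᴬ-sym (≈ᴬ-trans (+ᴬ-cong (*ᴬ-zeroʳ (X- a)) (≈ᴬ-refl {x = 1# ∙ᴬ 1ᴬ})) (ext λ y → trans (coeff-∙ 1# 1ᴬ y) (*-identityˡ _)))
    monomial (suc i) with monomial i
    ... | r , eq = single i +ᴬ a ∙ᴬ r , ext λ y → trans (coeff-suc y) (sym (rhs y))
      where
      c = fold 1# (a *_) i
      open SetoidReasoning setoid
      X = coeff (single 1 *ᴬ single i)
      R = coeff ((X- a) *ᴬ r)
      I = coeff (single i)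
      coeff-suc : ∀ y → coeff (single (suc i)) y ≈ X y
      coeff-suc y = sym (at (single-* 1 i) y)
      rhs : ∀ y → coeff ((X- a) *ᴬ (single i +ᴬ a ∙ᴬ r) +ᴬ (a * c) ∙ᴬ 1ᴬ) y ≈ X y
      rhs y = begin
        coeff ((X- a) *ᴬ (single i +ᴬ a ∙ᴬ r) +ᴬ (a * c) ∙ᴬ 1ᴬ) y
          ≈⟨ coeff-+ ((X- a) *ᴬ (single i +ᴬ a ∙ᴬ r)) _ y ⟩
        coeff ((X- a) *ᴬ (single i +ᴬ a ∙ᴬ r)) y + coeff ((a * c) ∙ᴬ 1ᴬ) y
          ≈⟨ +-cong (at (*ᴬ-distribˡ-+ᴬ (X- a) (single i) (a ∙ᴬ r)) y) (coeff-∙ (a * c) 1ᴬ y) ⟩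
        coeff ((X- a) *ᴬ single i +ᴬ (X- a) *ᴬ (a ∙ᴬ r)) y + a * c * coeff 1ᴬ y
          ≈⟨ +-cong (trans (coeff-+ ((X- a) *ᴬ single i) ((X- a) *ᴬ (a ∙ᴬ r)) y) (+-cong (at (X-*ᴬ a (single i)) y) (trans (at (*ᴬ-∙ᴬ-comm a (X- a) r) y) (coeff-∙ a ((X- a) *ᴬ r) y)))) (trans (*-assoc _ _ _) (*-congˡ (sym (coeff-∙ c 1ᴬ y)))) ⟩
        coeff (single 1 *ᴬ single i +ᴬ (- a) ∙ᴬ single i) y + a * R y + a * coeff (c ∙ᴬ 1ᴬ) y
          ≈⟨ +-assoc _ _ _ ⟩
        coeff (single 1 *ᴬ single i +ᴬ (- a) ∙ᴬ single i) y + (a * R y + a * coeff (c ∙ᴬ 1ᴬ) y)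
          ≈⟨ +-cong (trans (coeff-+ (single 1 *ᴬ single i) ((- a) ∙ᴬ single i) y) (+-congˡ (coeff-∙ (- a) (single i) y))) (sym (distribˡ a _ _)) ⟩
        X y + (- a) * I y + a * (R y + coeff (c ∙ᴬ 1ᴬ) y)
          ≈⟨ +-congˡ (*-congˡ (trans (sym (coeff-+ ((X- a) *ᴬ r) _ y)) (sym (at eq y)))) ⟩
        X y + (- a) * I y + a * I y
          ≈⟨ +-assoc _ _ _ ⟩
        X y + ((- a) * I y + a * I y)
          ≈⟨ +-congˡ (distribʳ (I y) (- a) a) ⟨
        X y + (- a + a) * I y
          ≈⟨ +-congˡ (trans (*-congʳ (-‿inverseˡ a)) (zeroˡ _)) ⟩
        X y + 0#
          ≈⟨ +-identityʳ _ ⟩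
        X y ∎
  ... | r , eq | s , eq′ = b ∙ᴬ s +ᴬ r , ext λ y → begin
    δ b i y + coeff q y
      ≈⟨ +-cong (trans (δ-cong (sym (*-identityʳ b)) (≡.refl {x = i}) ≡.refl) (trans (δ-scale b 1# i y) (*-congˡ (sym (+-identityʳ _))))) (trans (at eq y) (coeff-+ ((X- a) *ᴬ r) _ y)) ⟩
    b * coeff (single i) y + (coeff ((X- a) *ᴬ r) y + coeff (value q a ∙ᴬ 1ᴬ) y)
      ≈⟨ +-congʳ (trans (*-congˡ (trans (at eq′ y) (coeff-+ ((X- a) *ᴬ s) _ y))) (distribˡ b _ _)) ⟩
    b * coeff ((X- a) *ᴬ s) y + b * coeff (fold 1# (a *_) i ∙ᴬ 1ᴬ) y + (coeff ((X- a) *ᴬ r) y + coeff (value q a ∙ᴬ 1ᴬ) y)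
      ≈⟨ interchange _ _ _ _ ⟩
    b * coeff ((X- a) *ᴬ s) y + coeff ((X- a) *ᴬ r) y + (b * coeff (fold 1# (a *_) i ∙ᴬ 1ᴬ) y + coeff (value q a ∙ᴬ 1ᴬ) y)
      ≈⟨ +-cong (+-congʳ (trans (sym (coeff-∙ b ((X- a) *ᴬ s) y)) (sym (at (*ᴬ-∙ᴬ-comm b (X- a) s) y)))) (+-cong (trans (*-congˡ (coeff-∙ (fold 1# (a *_) i) 1ᴬ y)) (sym (*-assoc _ _ _))) (coeff-∙ (value q a) 1ᴬ y)) ⟩
    coeff ((X- a) *ᴬ (b ∙ᴬ s)) y + coeff ((X- a) *ᴬ r) y + (b * fold 1# (a *_) i * coeff 1ᴬ y + value q a * coeff 1ᴬ y)
      ≈⟨ +-cong (trans (sym (coeff-+ ((X- a) *ᴬ (b ∙ᴬ s)) _ y)) (sym (at (*ᴬ-distribˡ-+ᴬ (X- a) (b ∙ᴬ s) r) y))) (trans (sym (distribʳ _ _ _)) (sym (coeff-∙ _ 1ᴬ y))) ⟩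
    coeff ((X- a) *ᴬ (b ∙ᴬ s +ᴬ r)) y + coeff ((b * fold 1# (a *_) i + value q a) ∙ᴬ 1ᴬ) y
      ≈⟨ coeff-+ ((X- a) *ᴬ (b ∙ᴬ s +ᴬ r)) _ y ⟨
    coeff ((X- a) *ᴬ (b ∙ᴬ s +ᴬ r) +ᴬ (b * fold 1# (a *_) i + value q a) ∙ᴬ 1ᴬ) y ∎
    where
    open SetoidReasoning setoid
    open CommutativeSemigroupProperties +-commutativeSemigroup using (interchange)

  factor : ∀ a q → value q a ≈ 0# → ∃[ r ] q ≈ᴬ (X- a) *ᴬ r
  factor a q q[a]≈0 with divideX- a q
  ... | r , eq = r , ≈ᴬ-trans eq (ext λ y → trans (coeff-+ ((X- a) *ᴬ r) _ y)
    (trans (+-congˡ (trans (coeff-∙ _ 1ᴬ y) (trans (*-congʳ q[a]≈0) (zeroˡ _)))) (+-identityʳ _)))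

  product-∣ : ∀ L → AllPairs _#_ L → ∀ q → All (λ a → value q a ≈ 0#) L → productᴬ (map X-_ L) ∣ᴬ q
  product-∣ []      []          q []                = q , ≈ᴬ-sym (*ᴬ-identityˡ q)
  product-∣ (a ∷ L) (a#L ∷ L#L) q (q[a]≈0 ∷ q[L]≈0) with factor a q q[a]≈0
  ... | r , q≈ with product-∣ L L#L r (All.zipWith root (a#L , q[L]≈0))
    where
    root : ∀ {b} → a # b × value q b ≈ 0# → value r b ≈ 0#
    root {b} (a#b , q[b]≈0) = *-cancel-0 (x#y⇒x-y#0 (#-sym a#b))
      (trans (sym (value-factor b a r)) (trans (sym (value-cong b q≈)) q[b]≈0))
  ...   | s , r≈ = s , ≈ᴬ-trans q≈ (≈ᴬ-trans (*ᴬ-cong (≈ᴬ-refl {x = X- a}) r≈) (≈ᴬ-sym (*ᴬ-assoc (X- a) (productᴬ (map X-_ L)) s)))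

  coeff-X-*-suc : ∀ a p i → coeff ((X- a) *ᴬ p) (suc i) ≈ coeff p i + (- a) * coeff p (suc i)
  coeff-X-*-suc a p i = trans (at (X-*ᴬ a p) (suc i)) (trans (coeff-+ (single 1 *ᴬ p) ((- a) ∙ᴬ p) (suc i))
    (+-cong (trans (coeff-* (single 1) p (suc i)) (trans (⟪⟫-single 1 λ x → ⟪ p , (λ z → δ 1# (x ℕ.+ z) (suc i)) ⟫) (sym (coeff≈⟪⟫ p i))))
            (coeff-∙ (- a) p (suc i))))

  product-degree : ∀ L → coeff (productᴬ (map X-_ L)) (length L) ≈ 1#
                       × (∀ i → length L < i → coeff (productᴬ (map X-_ L)) i ≈ 0#)
  product-degree []      = +-identityʳ 1# , λ { (suc i) _ → +-identityʳ 0# }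
  product-degree (a ∷ L) with product-degree L
  ... | top , above =
      trans (coeff-X-*-suc a (productᴬ (map X-_ L)) (length L)) (trans (+-cong top (trans (*-congˡ (above _ ℕ.≤-refl)) (zeroʳ _))) (+-identityʳ _))
    , λ { (suc i) (s≤s L<i) → trans (coeff-X-*-suc a (productᴬ (map X-_ L)) i)
            (trans (+-cong (above i L<i) (trans (*-congˡ (above (suc i) (ℕ.m≤n⇒m≤1+n L<i))) (zeroʳ _))) (+-identityʳ _)) }

module MinimalPolynomial {k ℓ₁ ℓ₂ m ℓm} (F : HeytingField k ℓ₁ ℓ₂)
                  (V : LeftModule (CommutativeRing.ring (Scalars.commutativeRing F)) m ℓm)
                  {t : LeftModule.Carrierᴹ V → LeftModule.Carrierᴹ V}
                  (t-linear : LinearAlgebra.IsLinear (Scalars.commutativeRing F) V t) where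
  open Scalars F hiding (zero)
  open HeytingField F using (_#_; tight)
  open LeftModule V
  open LinearAlgebra commutativeRing V
  open Polynomial commutativeRing
  open Diagonalization F V
  open Operators t-linear
  open Evaluation F V t-linear
  open Roots F

  evalAt-eigenvector : ∀ {x v} → t v ≈ᴹ x *ₗ v → ∀ p → evalAt p t v ≈ᴹ value p x *ₗ v
  evalAt-eigenvector {x} {v} tv≈xv []            = ≈ᴹ-sym (*ₗ-zeroˡ v)
  evalAt-eigenvector {x} {v} tv≈xv ((a , i) ∷ p) = begin
    a *ₗ fold v t i +ᴹ evalAt p t v                    ≈⟨ +ᴹ-cong (*ₗ-cong refl (power i)) (evalAt-eigenvector tv≈xv p) ⟩
    a *ₗ fold 1# (x *_) i *ₗ v +ᴹ value p x *ₗ v       ≈⟨ +ᴹ-congʳ (*ₗ-assoc a _ v) ⟨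
    (a * fold 1# (x *_) i) *ₗ v +ᴹ value p x *ₗ v      ≈⟨ *ₗ-distribʳ v _ _ ⟨
    (a * fold 1# (x *_) i + value p x) *ₗ v            ∎
    where
    open SetoidReasoning ≈ᴹ-setoid
    power : ∀ i → fold v t i ≈ᴹ fold 1# (x *_) i *ₗ v
    power zero    = ≈ᴹ-sym (*ₗ-identityˡ v)
    power (suc i) = begin
      t (fold v t i)                  ≈⟨ t-cong (power i) ⟩
      t (fold 1# (x *_) i *ₗ v)       ≈⟨ t-*ₗ _ v ⟩
      fold 1# (x *_) i *ₗ t v         ≈⟨ *ₗ-cong refl tv≈xv ⟩
      fold 1# (x *_) i *ₗ x *ₗ v      ≈⟨ *ₗ-assoc _ x v ⟨
      (fold 1# (x *_) i * x) *ₗ v     ≈⟨ *ₗ-cong (*-comm _ x) ≈ᴹ-refl ⟩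
      (x * fold 1# (x *_) i) *ₗ v     ∎

  annihilator-value : ∀ q → Annihilates q t → ∀ {x} → IsEigenvalue t x → value q x ≈ 0#
  annihilator-value q q[t]≈0 {x} (v , v≉0 , tv≈xv) = proj₁ (tight _ _) λ q[x]#0 →
    v≉0 (*ₗ-cancel-0 q[x]#0 (≈ᴹ-trans (≈ᴹ-sym (evalAt-eigenvector tv≈xv q)) (q[t]≈0 v)))

  product-isMinimal : ∀ L → AllPairs _#_ L → (∀ v → shifts L v ≈ᴹ 0ᴹ) → All (IsEigenvalue t) L →
                      IsMinimalPolynomial t (productᴬ (map X-_ L))
  product-isMinimal L L#L annihilated eigenvalues = record
    { monic       = length L , product-degree L
    ; annihilates = λ v → ≈ᴹ-trans (evalAt-product L v) (annihilated v)
    ; minimal     = λ q q[t]≈0 → product-∣ L L#L q (All.map (annihilator-value q q[t]≈0) eigenvalues)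
    }

module Enumerations {c ℓ m ℓm} (K : CommutativeRing c ℓ) (M : Monoid m ℓm)
                    (_≟_ : Decidable (Monoid._≈_ M)) where
  open CommutativeRing K hiding (zero) renaming (_+_ to _⊕_; _*_ to _⊛_)
  private module M = Monoid M
  open MonoidAlgebra K M _≟_
  open MonoidAlgebraProperties K M _≟_
  open Membership M.setoid using () renaming (_∈_ to _∈ᴹ_; _∉_ to _∉ᴹ_)
  open Unique M.setoid using (Unique)
  open LinearAlgebra K leftModule using (IsBasis)

  coeff-sum-∉ : ∀ xs {y} → y ∉ᴹ xs → coeff (sumᴬ (map single xs)) y ≈ 0#
  coeff-sum-∉ []       y∉ = refl
  coeff-sum-∉ (x ∷ xs) y∉ = trans (+-cong (δ-no 1# (y∉ ∘ here ∘ M.sym)) (coeff-sum-∉ xs (y∉ ∘ there))) (+-identityˡ _)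

  coeff-sum-∈ : ∀ {xs y} → Unique xs → y ∈ᴹ xs → coeff (sumᴬ (map single xs)) y ≈ 1#
  coeff-sum-∈ {x ∷ xs} (x∉ ∷ xs!) (here y≈x) = trans
    (+-cong (δ-yes 1# (M.sym y≈x))
            (coeff-sum-∉ xs λ y∈xs → All.All¬⇒¬Any x∉ (Any.map (M.trans (M.sym y≈x)) y∈xs)))
    (+-identityʳ _)
  coeff-sum-∈ {x ∷ xs} (x∉ ∷ xs!) (there y∈xs) = trans
    (+-cong (δ-no 1# λ x≈y → All.All¬⇒¬Any x∉ (Any.map (M.trans x≈y) y∈xs)) (coeff-sum-∈ xs! y∈xs))
    (+-identityˡ _)

  module _ {xs} (unique : Unique xs) (complete : ∀ y → y ∈ᴹ xs) where

    coeff-sum-filter : ∀ {p} {P : U.Pred M.Carrier p} (P? : U.Decidable P) → P Respects M._≈_ →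
                       ∀ y → coeff (sumᴬ (map single (filter P? xs))) y ≈ (if does (P? y) then 1# else 0#)
    coeff-sum-filter P? resp y with P? y
    ... | yes Py = coeff-sum-∈ (Uniqueₚ.filter⁺ M.setoid P? unique)
                               (Membershipₚ.∈-filter⁺ M.setoid P? resp (complete y) Py)
    ... | no ¬Py = coeff-sum-∉ _ λ y∈ → ¬Py (proj₂ (Membershipₚ.∈-filter⁻ M.setoid P? resp {xs = xs} y∈))

    combination : ∀ xs → (Fin (length xs) → Carrier) → Element
    combination xs a = ∑ᴬ (λ i → a i ∙ᴬ single (lookup xs i))

    coeff-combination-∷ : ∀ x xs a y → coeff (combination (x ∷ xs) a) y
                                     ≈ a zero ⊛ δ 1# x y ⊕ coeff (combination xs (a ∘ suc)) y
    coeff-combination-∷ x xs a y = +-congʳ (δ-scale (a zero) 1# x y)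

    coeff-combination-∉ : ∀ xs a {y} → y ∉ᴹ xs → coeff (combination xs a) y ≈ 0#
    coeff-combination-∉ []       a y∉ = refl
    coeff-combination-∉ (x ∷ xs) a {y} y∉ = trans (coeff-combination-∷ x xs a y) (trans
      (+-cong (trans (*-congˡ (δ-no 1# (y∉ ∘ here ∘ M.sym))) (zeroʳ _)) (coeff-combination-∉ xs (a ∘ suc) (y∉ ∘ there)))
      (+-identityˡ _))

    coeff-combination-lookup : ∀ {xs} → Unique xs → ∀ a k → coeff (combination xs a) (lookup xs k) ≈ a k
    coeff-combination-lookup {x ∷ xs} (x∉ ∷ xs!) a zero = trans (coeff-combination-∷ x xs a x) (trans
      (+-cong (trans (*-congˡ (δ-yes 1# M.refl)) (*-identityʳ _)) (coeff-combination-∉ xs (a ∘ suc) (All.All¬⇒¬Any x∉)))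
      (+-identityʳ _))
    coeff-combination-lookup {x ∷ xs} (x∉ ∷ xs!) a (suc k) = trans (coeff-combination-∷ x xs a (lookup xs k)) (trans
      (+-cong (trans (*-congˡ (δ-no 1# (All.lookup x∉ (∈ₚ.∈-lookup k)))) (zeroʳ _))
              (coeff-combination-lookup xs! (a ∘ suc) k))
      (+-identityˡ _))

    singles-basis : IsBasis (λ i → single (lookup xs i))
    singles-basis = record
      { independent = λ a eq k → trans (sym (coeff-combination-lookup unique a k)) (at eq (lookup xs k))
      ; spanning    = λ v → (λ i → coeff v (lookup xs i)) , ext λ y → sym (spans v y)
      }
      where
      spans : ∀ v y → coeff (combination xs (λ i → coeff v (lookup xs i))) y ≈ coeff v y
      spans v y = trans (coeff-cong (combination xs _) y≈) (trans (coeff-combination-lookup unique _ k)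
                        (coeff-cong v (M.sym y≈)))
        where
        k = Any.index (complete y)
        y≈ : y M.≈ lookup xs k
        y≈ = Any.lookup-index (complete y)

module Permutations where
  open import Data.Nat.Base using (_+_; _*_)

  𝔖-setoid : ∀ n → _
  𝔖-setoid n = Group.setoid (𝔖 n)

  insert-injective : ∀ {n} {i j : Fin (suc n)} {π ρ : Permutation′ n} →
                     insert 0F i π Perm.≈ insert 0F j ρ → i ≡ j × π Perm.≈ ρ
  insert-injective {i = i} {π = π} {ρ} eq with eq 0F
  ... | ≡.refl = ≡.refl , λ k → Fin.punchIn-injective i (π ⟨$⟩ʳ k) (ρ ⟨$⟩ʳ k) (eq (suc k))

  private
    concatMap≡cartesianProductWith : ∀ {a b c} {A : Set a} {B : Set b} {C : Set c} (f : A → B → C) xs ys →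
      concatMap (λ x → map (f x) ys) xs ≡ cartesianProductWith f xs ys
    concatMap≡cartesianProductWith f []       ys = ≡.refl
    concatMap≡cartesianProductWith f (x ∷ xs) ys =
      ≡.cong (map (f x) ys ++_) (concatMap≡cartesianProductWith f xs ys)

  allPermutations-unique : ∀ n → Unique.Unique (𝔖-setoid n) (allPermutations n)
  allPermutations-unique zero    = [] ∷ []
  allPermutations-unique (suc n)
    rewrite concatMap≡cartesianProductWith (insert 0F) (allFin (suc n)) (allPermutations n) =
    Uniqueₚ.cartesianProductWith⁺ (≡.setoid (Fin (suc n))) (𝔖-setoid n) (𝔖-setoid (suc n)) (insert 0F)
      (λ {i} {j} {π} {ρ} → insert-injective {π = π} {ρ})
      (UniquePropositional.allFin⁺ (suc n)) (allPermutations-unique n)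

  allPermutations-complete : ∀ n σ → Membership._∈_ (𝔖-setoid n) σ (allPermutations n)
  allPermutations-complete zero    σ = here λ ()
  allPermutations-complete (suc n) σ
    rewrite concatMap≡cartesianProductWith (insert 0F) (allFin (suc n)) (allPermutations n) =
    Any.map (λ {π} π≈ k → ≡.trans (≡.sym (Perm.insert-remove 0F σ k)) (π≈ k))
      (Membershipₚ.∈-cartesianProductWith⁺ (≡.setoid (Fin (suc n))) (𝔖-setoid n) (𝔖-setoid (suc n))
        (λ { {i} ≡.refl π≈ρ → insert-cong i π≈ρ })
        (∈ₚ.∈-allFin (σ ⟨$⟩ʳ 0F)) (allPermutations-complete n (remove 0F σ)))
    where
    insert-cong : ∀ i {π ρ : Permutation′ n} → π Perm.≈ ρ → insert 0F i π Perm.≈ insert 0F i ρ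
    insert-cong i π≈ρ zero    = ≡.refl
    insert-cong i π≈ρ (suc k) = ≡.cong (punchIn i) (π≈ρ k)

  open SemiringSum ℕ.+-*-semiring using (sum; sum-cong-≗; *-distribˡ-sum)

  lt : ℕ → ℕ → ℕ
  lt x y = if does (x ℕ.<? y) then 1 else 0

  above : ∀ {n} → ℕ → Vector ℕ n → ℕ
  above {zero}  x s = 1
  above {suc n} x s = lt x (head s) * above x (tail s)

  sorted : ∀ {n} → Vector ℕ n → ℕ
  sorted {zero}  s = 1
  sorted {suc n} s = above (head s) (tail s) * sorted (tail s)

  sortedFrom : ∀ {n} → ℕ → Vector ℕ n → ℕ
  sortedFrom         zero    s = sorted s
  sortedFrom {zero}  (suc j) s = 1
  sortedFrom {suc n} (suc j) s = sortedFrom j (tail s)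

  above-cong : ∀ {n} x {s s′ : Vector ℕ n} → s ≗ s′ → above x s ≡ above x s′
  above-cong {zero}  x e = ≡.refl
  above-cong {suc n} x e = ≡.cong₂ (λ y z → lt x y * z) (e zero) (above-cong x (e ∘ suc))

  sorted-cong : ∀ {n} {s s′ : Vector ℕ n} → s ≗ s′ → sorted s ≡ sorted s′
  sorted-cong {zero}  e = ≡.refl
  sorted-cong {suc n} {s} {s′} e = ≡.cong₂ _*_
    (≡.trans (≡.cong (λ x → above x (tail s)) (e zero)) (above-cong (head s′) (e ∘ suc))) (sorted-cong (e ∘ suc))

  sortedFrom-cong : ∀ {n} j {s s′ : Vector ℕ n} → s ≗ s′ → sortedFrom j s ≡ sortedFrom j s′
  sortedFrom-cong         zero    e = sorted-cong e
  sortedFrom-cong {zero}  (suc j) e = ≡.refl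
  sortedFrom-cong {suc n} (suc j) e = sortedFrom-cong j (e ∘ suc)

  lt-yes : ∀ {x y} → x < y → lt x y ≡ 1
  lt-yes {x} {y} x<y = ≡.cong (if_then 1 else 0) (dec-true (x ℕ.<? y) x<y)

  lt-no : ∀ {x y} → ¬ x < y → lt x y ≡ 0
  lt-no {x} {y} x≮y = ≡.cong (if_then 1 else 0) (dec-false (x ℕ.<? y) x≮y)

  lt-total : ∀ {x y} → x ≢ y → lt x y + lt y x ≡ 1
  lt-total {x} {y} x≢y with ℕ.<-cmp x y
  ... | tri< x<y _ y≮x rewrite lt-yes x<y | lt-no y≮x = ≡.refl
  ... | tri≈ _ x≡y _   = ⊥-elim (x≢y x≡y)
  ... | tri> x≮y _ y<x rewrite lt-no x≮y | lt-yes y<x = ≡.refl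

  lt-trans : ∀ x y z → lt x y * (lt x z * lt y z) ≡ lt x y * lt y z
  lt-trans x y z = cases (x ℕ.<? y) (y ℕ.<? z)
    where
    cases : Dec (x < y) → Dec (y < z) → lt x y * (lt x z * lt y z) ≡ lt x y * lt y z
    cases (no x≮y)  _         rewrite lt-no x≮y = ≡.refl
    cases (yes _)   (no y≮z)  rewrite lt-no y≮z = ≡.cong (lt x y *_) (ℕ.*-zeroʳ (lt x z))
    cases (yes x<y) (yes y<z) rewrite lt-yes (ℕ.<-trans x<y y<z) | lt-yes y<z = ≡.refl

  above-trans : ∀ {n} x y (s : Vector ℕ n) → lt x y * (above x s * above y s) ≡ lt x y * above y s
  above-trans {zero}  x y s = ≡.refl
  above-trans {suc n} x y s = begin
    lt x y * (lt x z * A * (lt y z * B))      ≡⟨ rearrange (lt x y) (lt x z) A (lt y z) B ⟩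
    lt x y * (lt x z * lt y z) * (A * B)      ≡⟨ ≡.cong (_* (A * B)) (lt-trans x y z) ⟩
    lt x y * lt y z * (A * B)                 ≡⟨ rearrange′ (lt x y) (lt y z) A B ⟩
    lt y z * (lt x y * (A * B))               ≡⟨ ≡.cong (lt y z *_) (above-trans x y (tail s)) ⟩
    lt y z * (lt x y * B)                     ≡⟨ rearrange″ (lt x y) (lt y z) B ⟩
    lt x y * (lt y z * B)                     ∎
    where
    open ≡.≡-Reasoning
    z = head s
    A = above x (tail s)
    B = above y (tail s)
    rearrange : ∀ a b c d e → a * (b * c * (d * e)) ≡ a * (b * d) * (c * e)
    rearrange = solve-∀
    rearrange′ : ∀ a b c d → a * b * (c * d) ≡ b * (a * (c * d))
    rearrange′ = solve-∀
    rearrange″ : ∀ a b c → b * (a * c) ≡ a * (b * c)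
    rearrange″ = solve-∀

  above-insertAt : ∀ {n} y (r : Vector ℕ n) p x → above y (insertAt r p x) ≡ lt y x * above y r
  above-insertAt {n}     y r zero    x = ≡.refl
  above-insertAt {suc n} y r (suc p) x =
    ≡.trans (≡.cong (lt y (head r) *_) (above-insertAt y (tail r) p x)) (swap (lt y (head r)) (lt y x) _)
    where
    swap : ∀ a b c → a * (b * c) ≡ b * (a * c)
    swap = solve-∀

  -- A letter fits into exactly one place of an increasing word.
  sum-sorted-insertAt : ∀ {n} (r : Vector ℕ n) x → (∀ i → r i ≢ x) →
                        sum (λ p → sorted (insertAt r p x)) ≡ sorted r
  sum-sorted-insertAt {zero}  r x x∉r = ≡.refl
  sum-sorted-insertAt {suc n} r x x∉r = begin
    lt x y * A * (B * C) + sum (λ p → above y (insertAt q p x) * sorted (insertAt q p x))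
      ≡⟨ ≡.cong₂ _+_ first (sum-cong-≗ λ p → ≡.cong (_* sorted (insertAt q p x)) (above-insertAt y q p x)) ⟩
    lt x y * (B * C) + sum (λ p → lt y x * B * sorted (insertAt q p x))
      ≡⟨ ≡.cong (lt x y * (B * C) +_) (*-distribˡ-sum (lt y x * B) (λ p → sorted (insertAt q p x))) ⟨
    lt x y * (B * C) + lt y x * B * sum (λ p → sorted (insertAt q p x))
      ≡⟨ ≡.cong (λ z → lt x y * (B * C) + lt y x * B * z) (sum-sorted-insertAt q x (x∉r ∘ suc)) ⟩
    lt x y * (B * C) + lt y x * B * C
      ≡⟨ factor (lt x y) (lt y x) B C ⟩
    (lt x y + lt y x) * (B * C)
      ≡⟨ ≡.cong (_* (B * C)) (lt-total (x∉r zero ∘ ≡.sym)) ⟩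
    1 * (B * C)
      ≡⟨ ℕ.*-identityˡ _ ⟩
    B * C ∎
    where
    open ≡.≡-Reasoning
    y = head r
    q = tail r
    A = above x q
    B = above y q
    C = sorted q
    assoc′ : ∀ a b c d → a * b * (c * d) ≡ a * (b * c) * d
    assoc′ = solve-∀
    factor : ∀ a b c d → a * (c * d) + b * c * d ≡ (a + b) * (c * d)
    factor = solve-∀
    first : lt x y * A * (B * C) ≡ lt x y * (B * C)
    first = ≡.trans (assoc′ (lt x y) A B C) (≡.trans (≡.cong (_* C) (above-trans x y q)) (ℕ.*-assoc (lt x y) B C))

  -- Moving the first letter to any of the first j places does not change the
  -- remaining letters; the other places are governed by sum-sorted-insertAt.
  sum-sortedFrom-insertAt : ∀ {n} j (s : Vector ℕ (suc n)) → j ≤ n → (∀ i → tail s i ≢ head s) →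
    sum (λ p → sortedFrom j (insertAt (tail s) p (head s))) ≡ j * sortedFrom j s + sortedFrom (suc j) s
  sum-sortedFrom-insertAt         zero    s _         x∉ = sum-sorted-insertAt (tail s) (head s) x∉
  sum-sortedFrom-insertAt {suc n} (suc j) s (s≤s j≤n) x∉ = begin
    sortedFrom j r + sum (λ p → sortedFrom j (insertAt (tail r) p x))
      ≡⟨ ≡.cong (sortedFrom j r +_) (sum-sortedFrom-insertAt j (insertAt (tail r) zero x) j≤n (x∉ ∘ suc)) ⟩
    sortedFrom j r + (j * sortedFrom j (insertAt (tail r) zero x) + sortedFrom (suc j) r)
      ≡⟨ ≡.cong (λ z → sortedFrom j r + (z + sortedFrom (suc j) r)) (first-irrelevant j) ⟩
    sortedFrom j r + (j * sortedFrom j r + sortedFrom (suc j) r)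
      ≡⟨ ℕ.+-assoc (sortedFrom j r) _ _ ⟨
    suc j * sortedFrom j r + sortedFrom (suc j) r ∎
    where
    open ≡.≡-Reasoning
    x = head s
    r = tail s
    first-irrelevant : ∀ j → j * sortedFrom j (insertAt (tail r) zero x) ≡ j * sortedFrom j r
    first-irrelevant zero    = ≡.refl
    first-irrelevant (suc j) = ≡.refl

  AscendingFrom : ∀ {n} → ℕ → Vector ℕ n → Set
  AscendingFrom j s = ∀ i k → toℕ k ≡ suc (toℕ i) → j ≤ toℕ i → s i < s k

  ascending-tail : ∀ {n j} {s : Vector ℕ (suc n)} → AscendingFrom (suc j) s → AscendingFrom j (tail s)
  ascending-tail asc i k k≡1+i j≤i = asc (suc i) (suc k) (≡.cong suc k≡1+i) (s≤s j≤i)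

  ascending-zero : ∀ {n} {s : Vector ℕ (suc n)} → AscendingFrom 0 s → AscendingFrom 0 (tail s)
  ascending-zero asc = ascending-tail λ i k k≡1+i _ → asc i k k≡1+i z≤n

  head<tail : ∀ {n} {s : Vector ℕ (suc n)} → AscendingFrom 0 s → ∀ i → head s < tail s i
  head<tail asc zero    = asc zero (suc zero) ≡.refl z≤n
  head<tail asc (suc i) = ℕ.<-trans (asc zero (suc zero) ≡.refl z≤n) (head<tail (ascending-zero asc) i)

  above-ascending : ∀ {n} {x} {s : Vector ℕ n} → (∀ i → x < s i) → above x s ≡ 1
  above-ascending {zero}  x<s = ≡.refl
  above-ascending {suc n} x<s rewrite lt-yes (x<s zero) | above-ascending (x<s ∘ suc) = ≡.refl

  sortedFrom-ascending : ∀ {n} j {s : Vector ℕ n} → AscendingFrom j s → sortedFrom j s ≡ 1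
  sortedFrom-ascending {zero}  zero    asc = ≡.refl
  sortedFrom-ascending {suc n} zero    asc
    rewrite above-ascending (head<tail asc) | sortedFrom-ascending 0 (ascending-zero asc) = ≡.refl
  sortedFrom-ascending {zero}  (suc j) asc = ≡.refl
  sortedFrom-ascending {suc n} (suc j) asc = sortedFrom-ascending j (ascending-tail asc)

  sortedFrom-descent : ∀ {n} j {s : Vector ℕ n} i k → toℕ k ≡ suc (toℕ i) → j ≤ toℕ i → s k < s i → sortedFrom j s ≡ 0
  sortedFrom-descent zero    zero    (suc zero) _ _ sₖ<sᵢ rewrite lt-no (ℕ.<⇒≯ sₖ<sᵢ) = ≡.refl
  sortedFrom-descent zero    {s} (suc i) (suc k) k≡1+i _ sₖ<sᵢ
    rewrite sortedFrom-descent zero {tail s} i k (ℕ.suc-injective k≡1+i) z≤n sₖ<sᵢ = ℕ.*-zeroʳ (above (head s) (tail s))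
  sortedFrom-descent (suc j) {s} (suc i) (suc k) k≡1+i (s≤s j≤i) sₖ<sᵢ =
    sortedFrom-descent j {tail s} i k (ℕ.suc-injective k≡1+i) j≤i sₖ<sᵢ

  ascending-monotone : ∀ {n} {s : Vector ℕ n} → AscendingFrom 0 s → ∀ i k → toℕ i < toℕ k → s i < s k
  ascending-monotone asc zero    (suc k) _         = head<tail asc k
  ascending-monotone asc (suc i) (suc k) (s≤s i<k) = ascending-monotone (ascending-zero asc) i k i<k

  ascending-lowerBound : ∀ {n} {s : Vector ℕ n} → AscendingFrom 0 s → ∀ i → toℕ i ≤ s i
  ascending-lowerBound asc zero = z≤n
  ascending-lowerBound {s = s} asc (suc i) = ℕ.≤-<-trans (ascending-lowerBound {s = s ∘ Fin.inject₁} asc′ i)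
    (≡.subst (λ k → s (Fin.inject₁ i) < s k) ≡.refl (asc (Fin.inject₁ i) (suc i) (≡.cong suc (≡.sym (Fin.toℕ-inject₁ i))) z≤n))
    where
    asc′ : AscendingFrom 0 (s ∘ Fin.inject₁)
    asc′ i k k≡1+i _ = asc (Fin.inject₁ i) (Fin.inject₁ k)
      (≡.trans (Fin.toℕ-inject₁ k) (≡.trans k≡1+i (≡.cong suc (≡.sym (Fin.toℕ-inject₁ i))))) z≤n

  word : ∀ {n} → Permutation′ n → Vector ℕ n
  word σ i = toℕ (σ ⟨$⟩ʳ i)

  permutation-injective : ∀ {n} (σ : Permutation′ n) {i k} → σ ⟨$⟩ʳ i ≡ σ ⟨$⟩ʳ k → i ≡ k
  permutation-injective σ eq = ≡.trans (≡.sym (Perm.inverseˡ σ)) (≡.trans (≡.cong (σ ⟨$⟩ˡ_) eq) (Perm.inverseˡ σ))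

  ascending-identity : ∀ {n} (σ : Permutation′ n) → AscendingFrom 0 (word σ) → Perm.id Perm.≈ σ
  ascending-identity σ asc i = Fin.toℕ-injective (ℕ.≤-antisym (ascending-lowerBound asc i)
    (≡.subst (λ k → word σ i ≤ toℕ k) (Perm.inverseˡ σ) (ascending-lowerBound {s = word (flip σ)} asc⁻¹ (σ ⟨$⟩ʳ i))))
    where
    asc⁻¹ : AscendingFrom 0 (word (flip σ))
    asc⁻¹ i k k≡1+i _ with ℕ.<-cmp (toℕ (σ ⟨$⟩ˡ i)) (toℕ (σ ⟨$⟩ˡ k))
    ... | tri< lt′ _ _ = lt′
    ... | tri≈ _ eq _ = ⊥-elim (ℕ.1+n≢n (≡.trans (≡.sym k≡1+i)
            (≡.cong toℕ (≡.sym (permutation-injective (flip σ) (Fin.toℕ-injective eq))))))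
    ... | tri> _ _ gt = ⊥-elim (ℕ.<-asym (ℕ.≤-reflexive (≡.sym k≡1+i))
            (≡.subst₂ (λ x y → toℕ x < toℕ y) (Perm.inverseʳ σ) (Perm.inverseʳ σ) (ascending-monotone asc _ _ gt)))

  word-toFront : ∀ {n} (σ : Permutation′ (suc n)) p k →
    toℕ (σ ⟨$⟩ʳ (toFront p ⟨$⟩ˡ k)) ≡ insertAt (tail (word σ)) p (head (word σ)) k
  word-toFront σ p k with p Fin.≟ k
  ... | yes ≡.refl = ≡.sym (Vector.insertAt-lookup (tail (word σ)) p _)
  ... | no p≢k     = ≡.trans (≡.sym (Vector.insertAt-punchIn (tail (word σ)) p _ (punchOut p≢k)))
                             (≡.cong (insertAt (tail (word σ)) p _) (Fin.punchIn-punchOut p≢k))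

  -- The composition (1ʲ, m), without its last part if m = 0.
  hook : ℕ → ℕ → Composition
  hook zero    zero    = []
  hook zero    (suc m) = m ∷ []
  hook (suc j) m       = 0 ∷ hook j m

  ∣hook∣ : ∀ j m → ∣ hook j m ∣ᶜ ≡ j + m
  ∣hook∣ zero    zero    = ≡.refl
  ∣hook∣ zero    (suc m) = ℕ.+-identityʳ (suc m)
  ∣hook∣ (suc j) m       = ≡.cong suc (∣hook∣ j m)

  hookSums : ℕ → ℕ → List ℕ
  hookSums j m = partialSums (parts (hook j m))

  hookSums-suc : ∀ j m → j + m ≢ 0 → hookSums (suc j) m ≡ 1 ∷ map suc (hookSums j m)
  hookSums-suc zero    zero    0≢0 = ⊥-elim (0≢0 ≡.refl)
  hookSums-suc zero    (suc m) _   = ≡.refl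
  hookSums-suc (suc j) m       _   = ≡.refl

  ∈-hookSums⁻ : ∀ j m {x} → x ∈ hookSums j m → ∃[ i ] x ≡ suc i × i < j
  ∈-hookSums⁻ zero          (suc m) ()
  ∈-hookSums⁻ (suc zero)    (suc m) (here ≡.refl) = 0 , ≡.refl , s≤s z≤n
  ∈-hookSums⁻ (suc (suc j)) m       (here ≡.refl) = 0 , ≡.refl , s≤s z≤n
  ∈-hookSums⁻ (suc (suc j)) m       (there x∈) with ∈ₚ.∈-map⁻ suc x∈
  ... | y , y∈ , ≡.refl with ∈-hookSums⁻ (suc j) m y∈
  ...   | i , ≡.refl , i<j = suc i , ≡.refl , s≤s i<j

  ∈-hookSums⁺ : ∀ j m {i} → i < j → suc i < j + m → suc i ∈ hookSums j m
  ∈-hookSums⁺ (suc j) m {i} i<1+j (s≤s i<j+m) rewrite hookSums-suc j m (λ eq → ℕ.n≮0 (≡.subst (i <_) eq i<j+m)) with i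
  ... | zero   = here ≡.refl
  ... | suc i′ = there (∈ₚ.∈-map⁺ suc (∈-hookSums⁺ j m (ℕ.≤-pred i<1+j) i<j+m))

  ¬descent-ascending : ∀ {n} j (σ : Permutation′ n) →
    (∀ i k → toℕ k ≡ suc (toℕ i) → j ≤ toℕ i → ¬ word σ k < word σ i) → AscendingFrom j (word σ)
  ¬descent-ascending j σ ¬desc i k k≡1+i j≤i = ℕ.≤∧≢⇒< (ℕ.≮⇒≥ (¬desc i k k≡1+i j≤i)) λ eq →
    ℕ.1+n≢n (≡.trans (≡.sym k≡1+i) (≡.cong toℕ (≡.sym (permutation-injective σ (Fin.toℕ-injective eq)))))

  DescentsIn-hook⇒sortedFrom≡1 : ∀ {n} j m (σ : Permutation′ n) →
    DescentsIn (hookSums j m) σ → sortedFrom j (word σ) ≡ 1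
  DescentsIn-hook⇒sortedFrom≡1 j m σ d = sortedFrom-ascending j (¬descent-ascending j σ λ i k k≡1+i j≤i desc →
    let (i′ , 1+i≡1+i′ , i′<j) = ∈-hookSums⁻ j m (d i k k≡1+i desc)
    in ℕ.<⇒≱ (≡.subst (_< j) (≡.sym (ℕ.suc-injective 1+i≡1+i′)) i′<j) j≤i)

  ¬DescentsIn-hook⇒sortedFrom≡0 : ∀ {n} j m → j + m ≡ n → (σ : Permutation′ n) →
    ¬ DescentsIn (hookSums j m) σ → sortedFrom j (word σ) ≡ 0
  ¬DescentsIn-hook⇒sortedFrom≡0 j m ≡.refl σ ¬d with sortedFrom j (word σ) ℕ.≟ 0
  ... | yes eq = eq
  ... | no neq = ⊥-elim (¬d λ i k k≡1+i desc → descentIn i k k≡1+i desc (toℕ i ℕ.<? j))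
    where
    descentIn : ∀ i k → toℕ k ≡ suc (toℕ i) → (σ ⟨$⟩ʳ k) Fin.< (σ ⟨$⟩ʳ i) → Dec (toℕ i < j) →
                suc (toℕ i) ∈ hookSums j m
    descentIn i k k≡1+i desc (yes i<j) = ∈-hookSums⁺ j m i<j (≡.subst (_< j + m) k≡1+i (Fin.toℕ<n k))
    descentIn i k k≡1+i desc (no i≮j)  = ⊥-elim (neq (sortedFrom-descent j i k k≡1+i (ℕ.≮⇒≥ i≮j) desc))

  sorted-id : ∀ {n} (σ : Permutation′ n) → Perm.id Perm.≈ σ → sorted (word σ) ≡ 1
  sorted-id σ id≈σ = sortedFrom-ascending 0 λ i k k≡1+i _ →
    ≡.subst₂ (λ x y → toℕ x < toℕ y) (id≈σ i) (id≈σ k) (ℕ.≤-reflexive (≡.sym k≡1+i))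

  sorted-≉id : ∀ {n} (σ : Permutation′ n) → ¬ Perm.id Perm.≈ σ → sorted (word σ) ≡ 0
  sorted-≉id σ id≉σ with sorted (word σ) ℕ.≟ 0
  ... | yes eq = eq
  ... | no neq = ⊥-elim (id≉σ (ascending-identity σ (¬descent-ascending 0 σ λ i k k≡1+i _ desc →
    neq (sortedFrom-descent 0 i k k≡1+i z≤n desc))))

  sortedFrom-last : ∀ {n} (s : Vector ℕ (suc n)) → sortedFrom n s ≡ 1
  sortedFrom-last {zero}  s = ≡.refl
  sortedFrom-last {suc n} s = sortedFrom-last (tail s)

  sortedFrom-all : ∀ {n} (s : Vector ℕ n) → sortedFrom n s ≡ 1
  sortedFrom-all {zero}  s = ≡.refl
  sortedFrom-all {suc n} s = sortedFrom-all (tail s)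

  sortedFrom-reverse : ∀ {n j} → j ≤ n → sortedFrom j (word (Perm.reverse {suc (suc n)})) ≡ 0
  sortedFrom-reverse {n} {j} j≤n = sortedFrom-descent j (Fin.inject₁ (Fin.fromℕ n)) (Fin.fromℕ (suc n))
    (≡.cong suc (≡.sym (Fin.toℕ-inject₁ (Fin.fromℕ n))))
    (ℕ.≤-trans j≤n (ℕ.≤-reflexive (≡.sym (≡.trans (Fin.toℕ-inject₁ _) (Fin.toℕ-fromℕ n)))))
    (≡.subst₂ _<_ (≡.sym (Fin.opposite-prop (Fin.fromℕ (suc n)))) (≡.sym (Fin.opposite-prop (Fin.inject₁ (Fin.fromℕ n))))
      (ℕ.∸-monoʳ-< {o = suc (toℕ (Fin.inject₁ (Fin.fromℕ n)))}
        (s≤s (ℕ.≤-reflexive (≡.cong suc (Fin.toℕ-inject₁ (Fin.fromℕ n)))))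
        (s≤s (Fin.toℕ≤pred[n] (Fin.fromℕ (suc n))))))

module Factorials {c ℓ₁ ℓ₂} (F : HeytingField c ℓ₁ ℓ₂) (char0 : CharacteristicZero F) where
  open Scalars F hiding (zero)
  open HeytingField F using (_#_; #⇒invertible)
  open FieldProperties F
  open Tsetlin F char0 using (1/!)
  open RingProperties ring using (-‿distribˡ-*; -‿distribʳ-*; -‿involutive)
  open SetoidReasoning setoid

  1/!-suc : ∀ m → fromℕ (suc m) * 1/! (suc m) ≈ 1/! m
  1/!-suc m with #⇒invertible (char0 m)
  ... | z , _ , [m-0]z≈1 = begin
    fromℕ (suc m) * (z * 1/! m)         ≈⟨ *-assoc _ _ _ ⟨
    fromℕ (suc m) * z * 1/! m           ≈⟨ *-congʳ (*-congʳ (x-0≈x _)) ⟨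
    (fromℕ (suc m) - 0#) * z * 1/! m    ≈⟨ *-congʳ [m-0]z≈1 ⟩
    1# * 1/! m                          ≈⟨ *-identityˡ _ ⟩
    1/! m                               ∎

  1/!#0 : ∀ m → 1/! m # 0#
  1/!#0 zero    = 1#0
  1/!#0 (suc m) with inverse (1/!#0 m)
  ... | z , z*1/!m≈1 = unit⇒#0 {y = z * fromℕ (suc m)} (begin
    1/! (suc m) * (z * fromℕ (suc m))     ≈⟨ *-comm _ _ ⟩
    z * fromℕ (suc m) * 1/! (suc m)       ≈⟨ *-assoc _ _ _ ⟩
    z * (fromℕ (suc m) * 1/! (suc m))     ≈⟨ *-congˡ (1/!-suc m) ⟩
    z * 1/! m                             ≈⟨ z*1/!m≈1 ⟩
    1#                                    ∎)

  -- (- 1)ⁱ / (i! k!)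
  coefficient : ℕ → ℕ → Carrier
  coefficient zero    k = 1/! k
  coefficient (suc i) k = - (proj₁ (#⇒invertible (char0 i)) * coefficient i k)

  coefficient-suc : ∀ i k → coefficient (suc i) k * fromℕ (suc i) ≈ - coefficient i k
  coefficient-suc i k with #⇒invertible (char0 i)
  ... | z , _ , [i-0]z≈1 = begin
    - (z * coefficient i k) * fromℕ (suc i)          ≈⟨ -‿distribˡ-* _ _ ⟨
    - (z * coefficient i k * fromℕ (suc i))          ≈⟨ -‿cong (*-comm _ _) ⟩
    - (fromℕ (suc i) * (z * coefficient i k))        ≈⟨ -‿cong (*-assoc _ _ _) ⟨
    - (fromℕ (suc i) * z * coefficient i k)          ≈⟨ -‿cong (*-congʳ (trans (*-congʳ (sym (x-0≈x _))) [i-0]z≈1)) ⟩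
    - (1# * coefficient i k)                         ≈⟨ -‿cong (*-identityˡ _) ⟩
    - coefficient i k                                ∎

  -‿#0 : ∀ {x} → x # 0# → - x # 0#
  -‿#0 {x} x#0 with inverse x#0
  ... | z , zx≈1 = unit⇒#0 {y = - z} (begin
    - x * - z       ≈⟨ -‿distribˡ-* x (- z) ⟨
    - (x * - z)     ≈⟨ -‿cong (-‿distribʳ-* x z) ⟨
    - - (x * z)     ≈⟨ -‿involutive _ ⟩
    x * z           ≈⟨ *-comm x z ⟩
    z * x           ≈⟨ zx≈1 ⟩
    1#              ∎)

  coefficient#0 : ∀ i k → coefficient i k # 0#
  coefficient#0 zero    k = 1/!#0 k
  coefficient#0 (suc i) k with #⇒invertible (char0 i)
  ... | z , z[i-0]≈1 , _ = -‿#0 (x#0y#0→xy#0 (unit⇒#0 z[i-0]≈1) (coefficient#0 i k))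

  falling : Carrier → ℕ → Carrier
  falling x zero    = 1#
  falling x (suc j) = (x - fromℕ j) * falling x j

  fromℕ-+-cancel : ∀ m n → fromℕ (m ℕ.+ n) - fromℕ n ≈ fromℕ m
  fromℕ-+-cancel m n = begin
    fromℕ (m ℕ.+ n) - fromℕ n          ≈⟨ +-congʳ (fromℕ-homo-+ char0 m n) ⟩
    fromℕ m + fromℕ n - fromℕ n        ≈⟨ +-assoc _ _ _ ⟩
    fromℕ m + (fromℕ n - fromℕ n)      ≈⟨ +-congˡ (-‿inverseʳ _) ⟩
    fromℕ m + 0#                       ≈⟨ +-identityʳ _ ⟩
    fromℕ m                            ∎

  1/!-falling : ∀ i j → 1/! (i ℕ.+ j) * falling (fromℕ (i ℕ.+ j)) j ≈ 1/! i
  1/!-falling i zero    = trans (*-identityʳ _) (reflexive (≡.cong 1/! (ℕ.+-identityʳ i)))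
  1/!-falling i (suc j) rewrite ℕ.+-suc i j = begin
    1/! n * ((fromℕ n - fromℕ j) * falling (fromℕ n) j)      ≈⟨ *-congˡ (*-congʳ (fromℕ-+-cancel (suc i) j)) ⟩
    1/! n * (fromℕ (suc i) * falling (fromℕ n) j)            ≈⟨ x∙yz≈y∙xz _ _ _ ⟩
    fromℕ (suc i) * (1/! n * falling (fromℕ n) j)            ≈⟨ *-congˡ (1/!-falling (suc i) j) ⟩
    fromℕ (suc i) * 1/! (suc i)                              ≈⟨ 1/!-suc i ⟩
    1/! i                                                    ∎
    where
    n = suc i ℕ.+ j
    open CommutativeSemigroupProperties *-commutativeSemigroup using (x∙yz≈y∙xz)

  falling-vanishes : ∀ k i → falling (fromℕ k) (suc (k ℕ.+ i)) ≈ 0#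
  falling-vanishes k zero    rewrite ℕ.+-identityʳ k = trans (*-congʳ (-‿inverseʳ _)) (zeroˡ _)
  falling-vanishes k (suc i) rewrite ℕ.+-suc k i     = trans (*-congˡ (falling-vanishes k i)) (zeroʳ _)

module Shuffles {c ℓ₁ ℓ₂} (F : HeytingField c ℓ₁ ℓ₂) (char0 : CharacteristicZero F) (n′ : ℕ) where
  private
    n : ℕ
    n = suc n′
  open Scalars F hiding (zero)
  open HeytingField F using (_#_; tight)
  open FieldProperties F
  open Factorials F char0
  open Tsetlin F char0 hiding (commutativeRing; fromℕ; _≈_; 0#)
  open MonoidAlgebra commutativeRing (Group.monoid (𝔖 n)) _≟ₚ_
  open MonoidAlgebraProperties commutativeRing (Group.monoid (𝔖 n)) _≟ₚ_
  open Enumerations commutativeRing (Group.monoid (𝔖 n)) _≟ₚ_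
  open Permutations
  open LinearAlgebra commutativeRing leftModule
  open LeftModule leftModule using (+ᴹ-assoc; +ᴹ-identityʳ; *ₗ-distribʳ; *ₗ-assoc; *ₗ-zeroˡ; *ₗ-identityˡ)
  private
    module 𝔖ₙ = Group (𝔖 n)
    module K = SetoidReasoning setoid
    module V = SetoidReasoning ≈ᴬ-setoid
    module ∑ℕ = SemiringSum ℕ.+-*-semiring
    module ∑ = CommutativeMonoidSum +-commutativeMonoid

  rightMul-linear : ∀ x → IsLinear (rightMul x)
  rightMul-linear x = record
    { +ᴹ-isGroupHomomorphism = record
      { isMonoidHomomorphism = record
        { isMagmaHomomorphism = record
          { isRelHomomorphism = record { cong = λ f≈g → *ᴬ-cong f≈g ≈ᴬ-refl }
          ; homo = *ᴬ-distribʳ-+ᴬ x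
          }
        ; ε-homo = ≈ᴬ-refl
        }
      ; ⁻¹-homo = λ f → ≈ᴬ-trans (*ᴬ-cong (coeff-neg-one f) ≈ᴬ-refl)
                         (≈ᴬ-trans (∙ᴬ-*ᴬ-assoc (- 1#) f x) (≈ᴬ-sym (coeff-neg-one (f *ᴬ x))))
      }
    ; *ₗ-homo = λ a f → ∙ᴬ-*ᴬ-assoc a f x
    }

  open Diagonalization F leftModule
  open Operators (rightMul-linear (τ n)) using (shift; shifts; shift-cong; shift-shifts; shift-eigen; shift-*ₗ; diagonalizable; eigenvalue-root)

  coeff-*-single : ∀ f g σ → coeff (f *ᴬ single g) σ ≈ coeff f (σ 𝔖ₙ.∙ g 𝔖ₙ.⁻¹)
  coeff-*-single f g σ = K.begin
    coeff (f *ᴬ single g) σ                                    K.≈⟨ coeff-* f (single g) σ ⟩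
    ⟪ f , (λ x → ⟪ single g , (λ z → δ 1# (x 𝔖ₙ.∙ z) σ) ⟫) ⟫   K.≈⟨ ⟪⟫-congʳ f (λ x → trans (⟪⟫-single g λ z → δ 1# (x 𝔖ₙ.∙ z) σ) (move x)) ⟩
    ⟪ f , (λ x → δ 1# x (σ 𝔖ₙ.∙ g 𝔖ₙ.⁻¹)) ⟫                    K.≈⟨ coeff≈⟪⟫ f _ ⟨
    coeff f (σ 𝔖ₙ.∙ g 𝔖ₙ.⁻¹)                                   K.∎
    where
    move : ∀ x → δ 1# (x 𝔖ₙ.∙ g) σ ≈ δ 1# x (σ 𝔖ₙ.∙ g 𝔖ₙ.⁻¹)
    move x = δ-⇔ {x = x 𝔖ₙ.∙ g} {y = σ} {x′ = x} {y′ = σ 𝔖ₙ.∙ g 𝔖ₙ.⁻¹} refl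
      (λ p i → ≡.trans (≡.cong (x ⟨$⟩ʳ_) (≡.sym (Perm.inverseʳ g))) (p (g ⟨$⟩ˡ i)))
      (λ q i → ≡.trans (q (g ⟨$⟩ʳ i)) (≡.cong (σ ⟨$⟩ʳ_) (Perm.inverseˡ g)))

  coeff-*-τ : ∀ f σ → coeff (f *ᴬ τ n) σ ≈ ∑.sum (λ p → coeff f (σ 𝔖ₙ.∙ toFront p 𝔖ₙ.⁻¹))
  coeff-*-τ f σ = K.begin
    coeff (f *ᴬ τ n) σ                                K.≡⟨ ≡.cong (λ g → coeff (f *ᴬ g) σ) (sumᴬ-tabulate (λ j → single (toFront j)) (λ i → i)) ⟩
    coeff (f *ᴬ ∑ᴬ (λ p → single (toFront p))) σ      K.≈⟨ at (*ᴬ-∑ f (λ p → single (toFront p))) σ ⟩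
    coeff (∑ᴬ (λ p → f *ᴬ single (toFront p))) σ      K.≈⟨ coeff-∑ (λ p → f *ᴬ single (toFront p)) σ ⟩
    ∑.sum (λ p → coeff (f *ᴬ single (toFront p)) σ)   K.≈⟨ ∑.sum-cong-≋ (λ p → coeff-*-single f (toFront p) σ) ⟩
    ∑.sum (λ p → coeff f (σ 𝔖ₙ.∙ toFront p 𝔖ₙ.⁻¹))    K.∎

  -- The image of S₁ʲ Sₙ₋ⱼ: the shuffles moving j letters to the front.
  B : ℕ → Element
  B j = descentSum n (hook j (n ∸ j))

  DescentsIn-respects : ∀ {D} {σ ρ : Permutation′ n} → σ Perm.≈ ρ → DescentsIn D σ → DescentsIn D ρ
  DescentsIn-respects σ≈ρ d i k k≡1+i ρₖ<ρᵢ =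
    d i k k≡1+i (≡.subst₂ Fin._<_ (≡.sym (σ≈ρ k)) (≡.sym (σ≈ρ i)) ρₖ<ρᵢ)

  coeff-B : ∀ {j} → j ≤ n → ∀ σ → coeff (B j) σ ≈ fromℕ (sortedFrom j (word σ))
  coeff-B {j} j≤n σ = trans
    (coeff-sum-filter (allPermutations-unique n) (allPermutations-complete n)
      (descentsIn? sums) (λ {ρ} {ρ′} → DescentsIn-respects {sums} {ρ} {ρ′}) σ)
    (indicator (descentsIn? sums σ))
    where
    sums = hookSums j (n ∸ j)
    indicator : (d : Dec (DescentsIn sums σ)) → (if does d then 1# else 0#) ≈ fromℕ (sortedFrom j (word σ))
    indicator (yes d) rewrite DescentsIn-hook⇒sortedFrom≡1 j (n ∸ j) σ d = sym (+-identityʳ 1#)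
    indicator (no ¬d) rewrite ¬DescentsIn-hook⇒sortedFrom≡0 j (n ∸ j) (ℕ.m+[n∸m]≡n j≤n) σ ¬d = refl

  fromℕ-sum : ∀ {m} (f : Fin m → ℕ) → ∑.sum (fromℕ ∘ f) ≈ fromℕ (∑ℕ.sum f)
  fromℕ-sum {zero}  f = refl
  fromℕ-sum {suc m} f = trans (+-congˡ (fromℕ-sum (f ∘ suc))) (sym (fromℕ-homo-+ char0 (f zero) _))

  B-τ : ∀ {j} → j < n → B j *ᴬ τ n ≈ᴬ fromℕ j ∙ᴬ B j +ᴬ B (suc j)
  B-τ {j} j<n = ext λ σ → K.begin
    coeff (B j *ᴬ τ n) σ
      K.≈⟨ coeff-*-τ (B j) σ ⟩
    ∑.sum (λ p → coeff (B j) (σ 𝔖ₙ.∙ toFront p 𝔖ₙ.⁻¹))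
      K.≈⟨ ∑.sum-cong-≋ (λ p → trans (coeff-B (ℕ.<⇒≤ j<n) (σ 𝔖ₙ.∙ toFront p 𝔖ₙ.⁻¹))
             (reflexive (≡.cong fromℕ (sortedFrom-cong j (word-toFront σ p))))) ⟩
    ∑.sum (λ p → fromℕ (sortedFrom j (insertAt (tail (word σ)) p (head (word σ)))))
      K.≈⟨ fromℕ-sum (λ p → sortedFrom j (insertAt (tail (word σ)) p (head (word σ)))) ⟩
    fromℕ (∑ℕ.sum (λ p → sortedFrom j (insertAt (tail (word σ)) p (head (word σ)))))
      K.≡⟨ ≡.cong fromℕ (sum-sortedFrom-insertAt j (word σ) (ℕ.≤-pred j<n) (head∉tail σ)) ⟩
    fromℕ (j ℕ.* sortedFrom j (word σ) ℕ.+ sortedFrom (suc j) (word σ))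
      K.≈⟨ fromℕ-homo-+ char0 (j ℕ.* sortedFrom j (word σ)) _ ⟩
    fromℕ (j ℕ.* sortedFrom j (word σ)) + fromℕ (sortedFrom (suc j) (word σ))
      K.≈⟨ +-cong (SemiringMult.×1-homo-* semiring j _) (sym (coeff-B j<n σ)) ⟩
    fromℕ j * fromℕ (sortedFrom j (word σ)) + coeff (B (suc j)) σ
      K.≈⟨ +-congʳ (*-congˡ (sym (coeff-B (ℕ.<⇒≤ j<n) σ))) ⟩
    fromℕ j * coeff (B j) σ + coeff (B (suc j)) σ
      K.≈⟨ +-congʳ (coeff-∙ (fromℕ j) (B j) σ) ⟨
    coeff (fromℕ j ∙ᴬ B j) σ + coeff (B (suc j)) σ
      K.≈⟨ coeff-+ (fromℕ j ∙ᴬ B j) _ σ ⟨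
    coeff (fromℕ j ∙ᴬ B j +ᴬ B (suc j)) σ K.∎
    where
    head∉tail : ∀ σ i → tail (word σ) i ≢ head (word σ)
    head∉tail σ i eq = Fin.0≢1+n (≡.sym (permutation-injective σ (Fin.toℕ-injective eq)))

  B-zero : B 0 ≈ᴬ 1ᴬ
  B-zero = ext λ σ → trans (coeff-B z≤n σ) (identity σ (Perm.id ≟ₚ σ))
    where
    identity : ∀ σ → Dec (Perm.id Perm.≈ σ) → fromℕ (sorted (word σ)) ≈ coeff 1ᴬ σ
    identity σ (yes id≈σ) rewrite sorted-id σ id≈σ = +-congʳ (sym (δ-yes 1# {Perm.id} {σ} id≈σ))
    identity σ (no id≉σ)  rewrite sorted-≉id σ id≉σ =
      sym (trans (+-identityʳ _) (δ-no 1# {Perm.id} {σ} id≉σ))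

  B-last : B n′ ≈ᴬ B n
  B-last = ext λ σ → trans (coeff-B (ℕ.n≤1+n n′) σ) (trans
    (reflexive (≡.cong fromℕ (≡.trans (sortedFrom-last (word σ)) (≡.sym (sortedFrom-all (word σ))))))
    (sym (coeff-B ℕ.≤-refl σ)))

  B-n-τ : B n *ᴬ τ n ≈ᴬ fromℕ n ∙ᴬ B n
  B-n-τ = V.begin
    B n *ᴬ τ n                           V.≈⟨ *ᴬ-cong B-last (≈ᴬ-refl {x = τ n}) ⟨
    B n′ *ᴬ τ n                          V.≈⟨ B-τ ℕ.≤-refl ⟩
    fromℕ n′ ∙ᴬ B n′ +ᴬ B n              V.≈⟨ +ᴬ-cong (∙ᴬ-cong refl B-last) (≈ᴬ-sym (*ₗ-identityˡ (B n))) ⟩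
    fromℕ n′ ∙ᴬ B n +ᴬ 1# ∙ᴬ B n         V.≈⟨ *ₗ-distribʳ (B n) (fromℕ n′) 1# ⟨
    (fromℕ n′ + 1#) ∙ᴬ B n               V.≈⟨ ∙ᴬ-cong (+-comm _ _) ≈ᴬ-refl ⟩
    fromℕ n ∙ᴬ B n                       V.∎

  *-B-suc : ∀ v {j} → j < n → v *ᴬ B (suc j) ≈ᴬ shift (fromℕ j) (v *ᴬ B j)
  *-B-suc v {j} j<n = ≈ᴬ-sym (V.begin
    (v *ᴬ B j) *ᴬ τ n +ᴬ (- fromℕ j) ∙ᴬ (v *ᴬ B j)
      V.≈⟨ +ᴬ-cong (≈ᴬ-trans (*ᴬ-assoc v (B j) (τ n)) (*ᴬ-cong (≈ᴬ-refl {x = v}) (B-τ j<n))) ≈ᴬ-refl ⟩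
    v *ᴬ (fromℕ j ∙ᴬ B j +ᴬ B (suc j)) +ᴬ (- fromℕ j) ∙ᴬ (v *ᴬ B j)
      V.≈⟨ +ᴬ-cong (≈ᴬ-trans (*ᴬ-distribˡ-+ᴬ v (fromℕ j ∙ᴬ B j) (B (suc j))) (LeftModule.+ᴹ-comm leftModule (v *ᴬ (fromℕ j ∙ᴬ B j)) _)) ≈ᴬ-refl ⟩
    v *ᴬ B (suc j) +ᴬ v *ᴬ (fromℕ j ∙ᴬ B j) +ᴬ (- fromℕ j) ∙ᴬ (v *ᴬ B j)
      V.≈⟨ +ᴹ-assoc (v *ᴬ B (suc j)) _ _ ⟩
    v *ᴬ B (suc j) +ᴬ (v *ᴬ (fromℕ j ∙ᴬ B j) +ᴬ (- fromℕ j) ∙ᴬ (v *ᴬ B j))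
      V.≈⟨ +ᴬ-cong (≈ᴬ-refl {x = v *ᴬ B (suc j)}) (+ᴬ-cong (*ᴬ-∙ᴬ-comm (fromℕ j) v (B j)) (≈ᴬ-refl {x = (- fromℕ j) ∙ᴬ (v *ᴬ B j)})) ⟩
    v *ᴬ B (suc j) +ᴬ (fromℕ j ∙ᴬ (v *ᴬ B j) +ᴬ (- fromℕ j) ∙ᴬ (v *ᴬ B j))
      V.≈⟨ +ᴬ-cong (≈ᴬ-refl {x = v *ᴬ B (suc j)}) (neg*ₗ-inverse (fromℕ j) (v *ᴬ B j)) ⟩
    v *ᴬ B (suc j) +ᴬ 0ᴬ
      V.≈⟨ +ᴹ-identityʳ _ ⟩
    v *ᴬ B (suc j) V.∎)

  *-B-zero : ∀ v → v *ᴬ B 0 ≈ᴬ v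
  *-B-zero v = ≈ᴬ-trans (*ᴬ-cong (≈ᴬ-refl {x = v}) B-zero) (*ᴬ-identityʳ v)

  *-B : ∀ v {j} → j ≤ n → v *ᴬ B j ≈ᴬ shifts (map fromℕ (upTo j)) v
  *-B v {zero}  _   = *-B-zero v
  *-B v {suc j} j<n = V.begin
    v *ᴬ B (suc j)                                   V.≈⟨ *-B-suc v j<n ⟩
    shift (fromℕ j) (v *ᴬ B j)                       V.≈⟨ shift-cong (fromℕ j) (*-B v (ℕ.<⇒≤ j<n)) ⟩
    shift (fromℕ j) (shifts (map fromℕ (upTo j)) v)  V.≈⟨ shift-shifts (fromℕ j) (map fromℕ (upTo j)) v ⟩
    shifts (map fromℕ (upTo j)) (shift (fromℕ j) v)  V.≡⟨ List.foldr-++ shift v (map fromℕ (upTo j)) (fromℕ j ∷ []) ⟨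
    shifts (map fromℕ (upTo j) ++ fromℕ j ∷ []) v    V.≡⟨ ≡.cong (λ L → shifts L v) (List.map-++ fromℕ (upTo j) (j ∷ [])) ⟨
    shifts (map fromℕ (upTo j ++ j ∷ [])) v          V.≡⟨ ≡.cong (λ L → shifts (map fromℕ L) v) (List.upTo-∷ʳ j) ⟩
    shifts (map fromℕ (upTo (suc j))) v              V.∎

  spectrum : List Carrier
  spectrum = fromℕ n ∷ map fromℕ (upTo n′)

  spectrum-annihilates : ∀ v → shifts spectrum v ≈ᴬ 0ᴬ
  spectrum-annihilates v = V.begin
    shift (fromℕ n) (shifts (map fromℕ (upTo n′)) v)
      V.≈⟨ shift-cong (fromℕ n) (≈ᴬ-trans (≈ᴬ-sym (*-B v (ℕ.n≤1+n n′))) (*ᴬ-cong (≈ᴬ-refl {x = v}) B-last)) ⟩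
    (v *ᴬ B n) *ᴬ τ n +ᴬ (- fromℕ n) ∙ᴬ (v *ᴬ B n)
      V.≈⟨ +ᴬ-cong (≈ᴬ-trans (*ᴬ-assoc v (B n) (τ n)) (≈ᴬ-trans (*ᴬ-cong (≈ᴬ-refl {x = v}) B-n-τ) (*ᴬ-∙ᴬ-comm (fromℕ n) v (B n)))) ≈ᴬ-refl ⟩
    fromℕ n ∙ᴬ (v *ᴬ B n) +ᴬ (- fromℕ n) ∙ᴬ (v *ᴬ B n)
      V.≈⟨ neg*ₗ-inverse (fromℕ n) (v *ᴬ B n) ⟩
    0ᴬ V.∎

  spectrum-apart : AllPairs _#_ spectrum
  spectrum-apart =
      All.map⁺ (All.map (λ k<n′ → fromℕ-#-< char0 (ℕ.m<n⇒m<1+n k<n′)) (All.all-upTo n′))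
    ∷ AllPairs.map⁺ (AllPairs.map (fromℕ-# char0) (UniquePropositional.upTo⁺ n′))

  *-B-eigen : ∀ {x v} → v *ᴬ τ n ≈ᴬ x ∙ᴬ v → ∀ {j} → j ≤ n → v *ᴬ B j ≈ᴬ falling x j ∙ᴬ v
  *-B-eigen {x} {v} vτ≈xv {zero}  _   = ≈ᴬ-trans (*-B-zero v) (≈ᴬ-sym (*ₗ-identityˡ v))
  *-B-eigen {x} {v} vτ≈xv {suc j} j<n = V.begin
    v *ᴬ B (suc j)                            V.≈⟨ *-B-suc v j<n ⟩
    shift (fromℕ j) (v *ᴬ B j)                V.≈⟨ shift-cong (fromℕ j) (*-B-eigen vτ≈xv (ℕ.<⇒≤ j<n)) ⟩
    shift (fromℕ j) (falling x j ∙ᴬ v)        V.≈⟨ shift-*ₗ (fromℕ j) (falling x j) v ⟩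
    falling x j ∙ᴬ shift (fromℕ j) v          V.≈⟨ ∙ᴬ-cong refl (shift-eigen (fromℕ j) vτ≈xv) ⟩
    falling x j ∙ᴬ (x - fromℕ j) ∙ᴬ v         V.≈⟨ *ₗ-assoc _ _ v ⟨
    (falling x j * (x - fromℕ j)) ∙ᴬ v        V.≈⟨ ∙ᴬ-cong (*-comm _ _) ≈ᴬ-refl ⟩
    falling x (suc j) ∙ᴬ v                    V.∎

  -- Σ_{i ≤ N} (- 1)ⁱ / (i! k!) B (k + i)
  partialProjector : ℕ → ℕ → Element
  partialProjector k zero    = coefficient 0 k ∙ᴬ B (k ℕ.+ 0)
  partialProjector k (suc N) = partialProjector k N +ᴬ coefficient (suc N) k ∙ᴬ B (k ℕ.+ suc N)

  projector : ℕ → Element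
  projector k = partialProjector k (n ∸ k)

  partialProjector-τ : ∀ k N {R} → k ℕ.+ N ≤ n →
    B (k ℕ.+ N) *ᴬ τ n ≈ᴬ fromℕ (k ℕ.+ N) ∙ᴬ B (k ℕ.+ N) +ᴬ R →
    partialProjector k N *ᴬ τ n ≈ᴬ fromℕ k ∙ᴬ partialProjector k N +ᴬ coefficient N k ∙ᴬ R
  partialProjector-τ k zero {R} _ Bτ = ext λ σ → K.begin
    coeff ((d ∙ᴬ B k₀) *ᴬ τ n) σ                   K.≈⟨ at (∙ᴬ-*ᴬ-assoc d (B k₀) (τ n)) σ ⟩
    coeff (d ∙ᴬ (B k₀ *ᴬ τ n)) σ                   K.≈⟨ coeff-∙ d (B k₀ *ᴬ τ n) σ ⟩
    d * coeff (B k₀ *ᴬ τ n) σ                      K.≈⟨ *-congˡ (trans (at Bτ σ) (coeff-+ (fromℕ k₀ ∙ᴬ B k₀) R σ)) ⟩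
    d * (coeff (fromℕ k₀ ∙ᴬ B k₀) σ + coeff R σ)   K.≈⟨ *-congˡ (+-congʳ (coeff-∙ (fromℕ k₀) (B k₀) σ)) ⟩
    d * (fromℕ k₀ * b σ + coeff R σ)               K.≈⟨ distribˡ d _ _ ⟩
    d * (fromℕ k₀ * b σ) + d * coeff R σ           K.≈⟨ +-congʳ (x∙yz≈y∙xz d _ _) ⟩
    fromℕ k₀ * (d * b σ) + d * coeff R σ           K.≈⟨ +-cong (*-cong (reflexive (≡.cong fromℕ (ℕ.+-identityʳ k))) (sym (coeff-∙ d (B k₀) σ))) (sym (coeff-∙ d R σ)) ⟩
    fromℕ k * coeff (d ∙ᴬ B k₀) σ + coeff (d ∙ᴬ R) σ  K.≈⟨ +-congʳ (coeff-∙ (fromℕ k) (d ∙ᴬ B k₀) σ) ⟨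
    coeff (fromℕ k ∙ᴬ (d ∙ᴬ B k₀)) σ + coeff (d ∙ᴬ R) σ  K.≈⟨ coeff-+ (fromℕ k ∙ᴬ (d ∙ᴬ B k₀)) (d ∙ᴬ R) σ ⟨
    coeff (fromℕ k ∙ᴬ (d ∙ᴬ B k₀) +ᴬ d ∙ᴬ R) σ     K.∎
    where
    d = coefficient 0 k
    k₀ = k ℕ.+ 0
    b = coeff (B k₀)
    open CommutativeSemigroupProperties *-commutativeSemigroup using (x∙yz≈y∙xz)
  partialProjector-τ k (suc N) {R} k+1+N≤n Bτ = ext λ σ → K.begin
    coeff ((E +ᴬ d ∙ᴬ B₁) *ᴬ τ n) σ
      K.≈⟨ at (*ᴬ-distribʳ-+ᴬ (τ n) E (d ∙ᴬ B₁)) σ ⟩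
    coeff (E *ᴬ τ n +ᴬ (d ∙ᴬ B₁) *ᴬ τ n) σ
      K.≈⟨ coeff-+ (E *ᴬ τ n) _ σ ⟩
    coeff (E *ᴬ τ n) σ + coeff ((d ∙ᴬ B₁) *ᴬ τ n) σ
      K.≈⟨ +-cong (trans (at (partialProjector-τ k N {B₁} (ℕ.<⇒≤ k+N<n) Bτ′) σ) (coeff-+ (fromℕ k ∙ᴬ E) (d′ ∙ᴬ B₁) σ))
                  (trans (at (∙ᴬ-*ᴬ-assoc d B₁ (τ n)) σ) (trans (coeff-∙ d (B₁ *ᴬ τ n) σ)
                    (*-congˡ (trans (at Bτ σ) (trans (coeff-+ (fromℕ (k ℕ.+ suc N) ∙ᴬ B₁) R σ) (+-congʳ (coeff-∙ _ B₁ σ))))))) ⟩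
    coeff (fromℕ k ∙ᴬ E) σ + coeff (d′ ∙ᴬ B₁) σ + d * (fromℕ (k ℕ.+ suc N) * b σ + coeff R σ)
      K.≈⟨ +-cong (+-cong (coeff-∙ (fromℕ k) E σ) (coeff-∙ d′ B₁ σ)) (distribˡ d _ _) ⟩
    fromℕ k * e σ + d′ * b σ + (d * (fromℕ (k ℕ.+ suc N) * b σ) + d * coeff R σ)
      K.≈⟨ trans (+-assoc _ _ _) (trans (+-congˡ (sym (+-assoc _ _ _))) (sym (+-assoc _ _ _))) ⟩
    fromℕ k * e σ + (d′ * b σ + d * (fromℕ (k ℕ.+ suc N) * b σ)) + d * coeff R σ
      K.≈⟨ +-congʳ (+-congˡ (middle (b σ))) ⟩
    fromℕ k * e σ + fromℕ k * (d * b σ) + d * coeff R σ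
      K.≈⟨ +-cong (trans (sym (distribˡ (fromℕ k) _ _)) (*-congˡ (trans (+-congˡ (sym (coeff-∙ d B₁ σ))) (sym (coeff-+ E (d ∙ᴬ B₁) σ))))) (sym (coeff-∙ d R σ)) ⟩
    fromℕ k * coeff (E +ᴬ d ∙ᴬ B₁) σ + coeff (d ∙ᴬ R) σ
      K.≈⟨ +-congʳ (coeff-∙ (fromℕ k) (E +ᴬ d ∙ᴬ B₁) σ) ⟨
    coeff (fromℕ k ∙ᴬ (E +ᴬ d ∙ᴬ B₁)) σ + coeff (d ∙ᴬ R) σ
      K.≈⟨ coeff-+ (fromℕ k ∙ᴬ (E +ᴬ d ∙ᴬ B₁)) (d ∙ᴬ R) σ ⟨
    coeff (fromℕ k ∙ᴬ (E +ᴬ d ∙ᴬ B₁) +ᴬ d ∙ᴬ R) σ K.∎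
    where
    d  = coefficient (suc N) k
    d′ = coefficient N k
    E  = partialProjector k N
    B₁ = B (k ℕ.+ suc N)
    e = coeff E
    b = coeff B₁
    k+N<n : k ℕ.+ N < n
    k+N<n = ≡.subst (_≤ n) (ℕ.+-suc k N) k+1+N≤n
    Bτ′ : B (k ℕ.+ N) *ᴬ τ n ≈ᴬ fromℕ (k ℕ.+ N) ∙ᴬ B (k ℕ.+ N) +ᴬ B₁
    Bτ′ = ≡.subst (λ j → B (k ℕ.+ N) *ᴬ τ n ≈ᴬ fromℕ (k ℕ.+ N) ∙ᴬ B (k ℕ.+ N) +ᴬ B j) (≡.sym (ℕ.+-suc k N)) (B-τ k+N<n)
    middle : ∀ y → d′ * y + d * (fromℕ (k ℕ.+ suc N) * y) ≈ fromℕ k * (d * y)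
    middle y = K.begin
      d′ * y + d * (fromℕ (k ℕ.+ suc N) * y)               K.≈⟨ +-congˡ (*-assoc _ _ _) ⟨
      d′ * y + d * fromℕ (k ℕ.+ suc N) * y                 K.≈⟨ distribʳ y _ _ ⟨
      (d′ + d * fromℕ (k ℕ.+ suc N)) * y                   K.≈⟨ *-congʳ (+-congˡ (*-congˡ (fromℕ-homo-+ char0 k (suc N)))) ⟩
      (d′ + d * (fromℕ k + fromℕ (suc N))) * y             K.≈⟨ *-congʳ (+-congˡ (trans (distribˡ d _ _) (+-congˡ (coefficient-suc N k)))) ⟩
      (d′ + (d * fromℕ k - d′)) * y                        K.≈⟨ *-congʳ (trans (+-comm _ _) (trans (+-assoc _ _ _) (trans (+-congˡ (-‿inverseˡ d′)) (+-identityʳ _)))) ⟩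
      d * fromℕ k * y                                      K.≈⟨ *-congʳ (*-comm _ _) ⟩
      fromℕ k * d * y                                      K.≈⟨ *-assoc _ _ _ ⟩
      fromℕ k * (d * y)                                    K.∎

  projector-τ : ∀ {k} → k ≤ n → projector k *ᴬ τ n ≈ᴬ fromℕ k ∙ᴬ projector k
  projector-τ {k} k≤n = ≈ᴬ-trans
    (partialProjector-τ k (n ∸ k) {0ᴬ} (ℕ.≤-reflexive k+[n∸k]≡n)
      (≡.subst (λ j → B j *ᴬ τ n ≈ᴬ fromℕ j ∙ᴬ B j +ᴬ 0ᴬ) (≡.sym k+[n∸k]≡n) (≈ᴬ-trans B-n-τ (≈ᴬ-sym (+ᴹ-identityʳ _)))))
    (+ᴹ-identityʳ _)
    where
    k+[n∸k]≡n : k ℕ.+ (n ∸ k) ≡ n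
    k+[n∸k]≡n = ℕ.m+[n∸m]≡n k≤n

  *-∙-B : ∀ {x v} → v *ᴬ τ n ≈ᴬ x ∙ᴬ v → ∀ a {j} → j ≤ n → v *ᴬ (a ∙ᴬ B j) ≈ᴬ (a * falling x j) ∙ᴬ v
  *-∙-B {x} {v} vτ≈xv a {j} j≤n = ≈ᴬ-trans (*ᴬ-∙ᴬ-comm a v (B j))
    (≈ᴬ-trans (∙ᴬ-cong refl (*-B-eigen vτ≈xv j≤n)) (≈ᴬ-sym (*ₗ-assoc a _ v)))

  *-partialProjector : ∀ {x v} → v *ᴬ τ n ≈ᴬ x ∙ᴬ v → ∀ k N → k ℕ.+ N ≤ n →
                       ∃[ y ] v *ᴬ partialProjector k N ≈ᴬ y ∙ᴬ v
  *-partialProjector {x} {v} vτ≈xv k zero    k≤n = _ , *-∙-B vτ≈xv (coefficient 0 k) k≤n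
  *-partialProjector {x} {v} vτ≈xv k (suc N) k+1+N≤n
    with *-partialProjector vτ≈xv k N (ℕ.≤-trans (ℕ.+-monoʳ-≤ k (ℕ.n≤1+n N)) k+1+N≤n)
  ... | y , eq = _ , ≈ᴬ-trans (*ᴬ-distribˡ-+ᴬ v (partialProjector k N) _)
    (≈ᴬ-trans (+ᴬ-cong eq (*-∙-B vτ≈xv (coefficient (suc N) k) k+1+N≤n)) (≈ᴬ-sym (*ₗ-distribʳ v _ _)))

  *-partialProjector-fixes : ∀ k {v} → v *ᴬ τ n ≈ᴬ fromℕ k ∙ᴬ v → ∀ N → k ℕ.+ N ≤ n → v *ᴬ partialProjector k N ≈ᴬ v
  *-partialProjector-fixes k {v} vτ≈kv zero k≤n = V.begin
    v *ᴬ (1/! k ∙ᴬ B (k ℕ.+ 0))                  V.≈⟨ *-∙-B vτ≈kv (1/! k) k≤n ⟩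
    (1/! k * falling (fromℕ k) (k ℕ.+ 0)) ∙ᴬ v   V.≈⟨ ∙ᴬ-cong (trans (*-congˡ (reflexive (≡.cong (falling (fromℕ k)) (ℕ.+-identityʳ k)))) (1/!-falling 0 k)) ≈ᴬ-refl ⟩
    1# ∙ᴬ v                                      V.≈⟨ *ₗ-identityˡ v ⟩
    v                                            V.∎
  *-partialProjector-fixes k {v} vτ≈kv (suc N) k+1+N≤n = V.begin
    v *ᴬ (partialProjector k N +ᴬ d ∙ᴬ B (k ℕ.+ suc N))
      V.≈⟨ *ᴬ-distribˡ-+ᴬ v (partialProjector k N) _ ⟩
    v *ᴬ partialProjector k N +ᴬ v *ᴬ (d ∙ᴬ B (k ℕ.+ suc N))
      V.≈⟨ +ᴬ-cong (*-partialProjector-fixes k vτ≈kv N (ℕ.≤-trans (ℕ.+-monoʳ-≤ k (ℕ.n≤1+n N)) k+1+N≤n))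
                   (*-∙-B vτ≈kv d k+1+N≤n) ⟩
    v +ᴬ (d * falling (fromℕ k) (k ℕ.+ suc N)) ∙ᴬ v
      V.≈⟨ +ᴬ-cong (≈ᴬ-refl {x = v}) (∙ᴬ-cong (trans (*-congˡ (trans (reflexive (≡.cong (falling (fromℕ k)) (ℕ.+-suc k N))) (falling-vanishes k N))) (zeroʳ d)) (≈ᴬ-refl {x = v})) ⟩
    v +ᴬ 0# ∙ᴬ v
      V.≈⟨ +ᴬ-cong (≈ᴬ-refl {x = v}) (*ₗ-zeroˡ v) ⟩
    v +ᴬ 0ᴬ
      V.≈⟨ +ᴹ-identityʳ v ⟩
    v V.∎
    where d = coefficient (suc N) k

  ≈ᴬ-stable : ∀ {f g} → ¬ ¬ f ≈ᴬ g → f ≈ᴬ g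
  ≈ᴬ-stable ¬¬f≈g = ext λ σ → ≈-stable λ ¬eq → ¬¬f≈g λ f≈g → ¬eq (at f≈g σ)

  *-projector-τ : ∀ {k} → k ≤ n → ∀ v → (v *ᴬ projector k) *ᴬ τ n ≈ᴬ fromℕ k ∙ᴬ (v *ᴬ projector k)
  *-projector-τ {k} k≤n v = ≈ᴬ-trans (*ᴬ-assoc v (projector k) (τ n))
    (≈ᴬ-trans (*ᴬ-cong (≈ᴬ-refl {x = v}) (projector-τ k≤n)) (*ᴬ-∙ᴬ-comm (fromℕ k) v (projector k)))

  projector-kills : ∀ {k} → k ≤ n → ∀ x v → ¬ x ≈ fromℕ k → v *ᴬ τ n ≈ᴬ x ∙ᴬ v → v *ᴬ projector k ≈ᴬ 0ᴬ
  projector-kills {k} k≤n x v x≉k vτ≈xv with *-partialProjector vτ≈xv k (n ∸ k) (ℕ.≤-reflexive (ℕ.m+[n∸m]≡n k≤n))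
  ... | y , w≈yv = ≈ᴬ-stable λ w≉0 → x≉k (proj₁ (tight x (fromℕ k)) λ x#k →
    w≉0 (*ₗ-cancel-0 (x#y⇒x-y#0 x#k) (V.begin
      (x - fromℕ k) ∙ᴬ w                    V.≈⟨ *ₗ-distribʳ w x (- fromℕ k) ⟩
      x ∙ᴬ w +ᴬ (- fromℕ k) ∙ᴬ w            V.≈⟨ +ᴬ-cong (≈ᴬ-trans (≈ᴬ-sym wτ≈xw) (*-projector-τ k≤n v)) ≈ᴬ-refl ⟩
      fromℕ k ∙ᴬ w +ᴬ (- fromℕ k) ∙ᴬ w      V.≈⟨ neg*ₗ-inverse (fromℕ k) w ⟩
      0ᴬ                                    V.∎)))
    where
    w = v *ᴬ projector k
    wτ≈xw : w *ᴬ τ n ≈ᴬ x ∙ᴬ w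
    wτ≈xw = V.begin
      w *ᴬ τ n             V.≈⟨ *ᴬ-cong w≈yv (≈ᴬ-refl {x = τ n}) ⟩
      (y ∙ᴬ v) *ᴬ τ n      V.≈⟨ ∙ᴬ-*ᴬ-assoc y v (τ n) ⟩
      y ∙ᴬ (v *ᴬ τ n)      V.≈⟨ ∙ᴬ-cong refl vτ≈xv ⟩
      y ∙ᴬ x ∙ᴬ v          V.≈⟨ *ₗ-assoc y x v ⟨
      (y * x) ∙ᴬ v         V.≈⟨ ∙ᴬ-cong (*-comm y x) ≈ᴬ-refl ⟩
      (x * y) ∙ᴬ v         V.≈⟨ *ₗ-assoc x y v ⟩
      x ∙ᴬ y ∙ᴬ v          V.≈⟨ ∙ᴬ-cong refl w≈yv ⟨
      x ∙ᴬ w               V.∎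

  projector-isSpectral : ∀ {k} → k ≤ n → ∀ {p} → p ≈ᴬ projector k → IsSpectralProjector (t n) (fromℕ k) (rightMul p)
  projector-isSpectral {k} k≤n {p} p≈ = record
    { linear = rightMul-linear p
    ; range  = λ v → ≈ᴬ-trans (*ᴬ-cong (*p v) (≈ᴬ-refl {x = τ n})) (≈ᴬ-trans (*-projector-τ k≤n v) (∙ᴬ-cong refl (≈ᴬ-sym (*p v))))
    ; fixes  = λ v vτ≈kv → ≈ᴬ-trans (*p v) (*-partialProjector-fixes k vτ≈kv (n ∸ k) (ℕ.≤-reflexive (ℕ.m+[n∸m]≡n k≤n)))
    ; kills  = λ x v x≉k vτ≈xv → ≈ᴬ-trans (*p v) (projector-kills k≤n x v x≉k vτ≈xv)
    }
    where
    *p : ∀ v → v *ᴬ p ≈ᴬ v *ᴬ projector k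
    *p v = *ᴬ-cong (≈ᴬ-refl {x = v}) p≈

  projector-zero : ∀ {k p} → IsSpectralProjector (t n) (fromℕ k) (rightMul p) →
                   ¬ IsEigenvalue (t n) (fromℕ k) → ∀ f → rightMul p f ≈ᴬ 0ᴬ
  projector-zero spectral ¬eigen f = ≈ᴬ-stable λ w≉0 → ¬eigen (_ , w≉0 , IsSpectralProjector.range spectral f)

  coeff-∙B : ∀ a {j} → j ≤ n → ∀ σ → coeff (a ∙ᴬ B j) σ ≈ a * fromℕ (sortedFrom j (word σ))
  coeff-∙B a {j} j≤n σ = trans (coeff-∙ a (B j) σ) (*-congˡ (coeff-B j≤n σ))

  -- All but the last two terms vanish at the permutation n ⋯ 2 1.
  projector≉0 : ∀ {k} → k ℕ.+ 2 ≤ n ⊎ k ≡ n → ¬ projector k ≈ᴬ 0ᴬ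
  projector≉0 {k} (inj₂ ≡.refl) eq rewrite ℕ.n∸n≡0 n′ = #⇒≉ (1/!#0 n) (K.begin
    1/! n                                                   K.≈⟨ *-identityʳ _ ⟨
    1/! n * 1#                                              K.≈⟨ *-congˡ (+-identityʳ 1#) ⟨
    1/! n * fromℕ 1                                         K.≡⟨ ≡.cong (λ x → 1/! n * fromℕ x) (sortedFrom-all (word {n} Perm.id)) ⟨
    1/! n * fromℕ (sortedFrom n (word {n} Perm.id))         K.≈⟨ coeff-∙B (1/! n) ℕ.≤-refl Perm.id ⟨
    coeff (1/! n ∙ᴬ B n) Perm.id                            K.≡⟨ ≡.cong (λ j → coeff (1/! n ∙ᴬ B j) Perm.id) (ℕ.+-identityʳ n) ⟨
    coeff (1/! n ∙ᴬ B (n ℕ.+ 0)) Perm.id                    K.≈⟨ at eq Perm.id ⟩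
    0#                                                      K.∎)
  projector≉0 {k} (inj₁ k+2≤n) eq with ℕ.m≤n⇒∃[o]m+o≡n k+2≤n
  ... | m , k+2+m≡n = #⇒≉ (x#0y#0→xy#0 (-‿#0 (coefficient#0 (suc (suc m)) k)) (char0 m)) (K.begin
    - d₂ * fromℕ (suc m)                                    K.≈⟨ trans (+-identityˡ _) (-‿distribˡ-* d₂ _) ⟨
    0# - d₂ * fromℕ (suc m)                                 K.≈⟨ +-congˡ (-‿cong d₂-relation) ⟩
    0# - - (d₁ + d₂)                                        K.≈⟨ trans (+-identityˡ _) (-‿involutive _) ⟩
    d₁ + d₂                                                 K.≈⟨ at-reverse ⟨
    coeff (partialProjector k (suc (suc m))) ρ              K.≡⟨ ≡.cong (λ N → coeff (partialProjector k N) ρ) n∸k≡2+m ⟨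
    coeff (projector k) ρ                                   K.≈⟨ at eq ρ ⟩
    0#                                                      K.∎)
    where
    open RingProperties ring using (-‿distribˡ-*; -‿involutive; -‿+-comm)
    d₁ = coefficient (suc m) k
    d₂ = coefficient (suc (suc m)) k
    ρ : Permutation′ n
    ρ = Perm.reverse
    k+[2+m]≡n : k ℕ.+ suc (suc m) ≡ n
    k+[2+m]≡n = ≡.trans (≡.sym (ℕ.+-assoc k 2 m)) k+2+m≡n
    n∸k≡2+m : n ∸ k ≡ suc (suc m)
    n∸k≡2+m = ≡.trans (≡.cong (_∸ k) (≡.sym k+[2+m]≡n)) (ℕ.m+n∸m≡n k (suc (suc m)))
    1+k+m≡n′ : suc (k ℕ.+ m) ≡ n′
    1+k+m≡n′ = ℕ.suc-injective (≡.trans (≡.sym (≡.trans (ℕ.+-suc k (suc m)) (≡.cong suc (ℕ.+-suc k m)))) k+[2+m]≡n)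
    d₂-relation : d₂ * fromℕ (suc m) ≈ - (d₁ + d₂)
    d₂-relation = K.begin
      d₂ * fromℕ (suc m)                            K.≈⟨ *-congˡ (trans (sym (fromℕ-+-cancel (suc m) 1)) (+-congʳ (reflexive (≡.cong fromℕ (ℕ.+-comm (suc m) 1))))) ⟩
      d₂ * (fromℕ (suc (suc m)) - fromℕ 1)          K.≈⟨ distribˡ d₂ _ _ ⟩
      d₂ * fromℕ (suc (suc m)) + d₂ * - fromℕ 1     K.≈⟨ +-cong (coefficient-suc (suc m) k) (trans (sym (-‿distribʳ-* d₂ _)) (-‿cong (trans (*-congˡ (+-identityʳ 1#)) (*-identityʳ d₂)))) ⟩
      - d₁ - d₂                                     K.≈⟨ -‿+-comm d₁ d₂ ⟩
      - (d₁ + d₂)                                   K.∎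
      where open RingProperties ring using (-‿distribʳ-*)
    vanishes : ∀ {j} → j < n′ → sortedFrom j (word ρ) ≡ 0
    vanishes {j} j<n′ = go n′ j<n′
      where
      go : ∀ n′ → j < n′ → sortedFrom j (word (Perm.reverse {suc n′})) ≡ 0
      go (suc n″) (s≤s j≤n″) = sortedFrom-reverse j≤n″
    early : ∀ N → N ≤ m → coeff (partialProjector k N) ρ ≈ 0#
    early-term : ∀ N a → N ≤ m → coeff (a ∙ᴬ B (k ℕ.+ N)) ρ ≈ 0#
    early-term N a N≤m = trans (coeff-∙B a (ℕ.<⇒≤ (ℕ.m<n⇒m<1+n k+N<n′)) ρ)
      (trans (*-congˡ (reflexive (≡.cong fromℕ (vanishes k+N<n′)))) (zeroʳ a))
      where
      k+N<n′ : k ℕ.+ N < n′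
      k+N<n′ = ≡.subst (k ℕ.+ N <_) 1+k+m≡n′ (s≤s (ℕ.+-monoʳ-≤ k N≤m))
    early zero    N≤m = early-term 0 _ N≤m
    early (suc N) N<m = trans (coeff-+ (partialProjector k N) _ ρ)
      (trans (+-cong (early N (ℕ.<⇒≤ N<m)) (early-term (suc N) _ N<m)) (+-identityˡ _))
    late-term : ∀ a {j} → j ≤ n → sortedFrom j (word ρ) ≡ 1 → coeff (a ∙ᴬ B j) ρ ≈ a
    late-term a j≤n eq = trans (coeff-∙B a j≤n ρ)
      (trans (*-congˡ (trans (reflexive (≡.cong fromℕ eq)) (+-identityʳ 1#))) (*-identityʳ a))
    k+1+m≡n′ : k ℕ.+ suc m ≡ n′
    k+1+m≡n′ = ≡.trans (ℕ.+-suc k m) 1+k+m≡n′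
    at-reverse : coeff (partialProjector k (suc (suc m))) ρ ≈ d₁ + d₂
    at-reverse = K.begin
      coeff (partialProjector k (suc (suc m))) ρ
        K.≈⟨ coeff-+ (partialProjector k (suc m)) _ ρ ⟩
      coeff (partialProjector k (suc m)) ρ + coeff (d₂ ∙ᴬ B (k ℕ.+ suc (suc m))) ρ
        K.≈⟨ +-cong (coeff-+ (partialProjector k m) _ ρ) (late-term d₂ (ℕ.≤-reflexive k+[2+m]≡n)
              (≡.trans (≡.cong (λ j → sortedFrom j (word ρ)) k+[2+m]≡n) (sortedFrom-all (word ρ)))) ⟩
      coeff (partialProjector k m) ρ + coeff (d₁ ∙ᴬ B (k ℕ.+ suc m)) ρ + d₂
        K.≈⟨ +-congʳ (+-cong (early m ℕ.≤-refl) (late-term d₁ (ℕ.≤-trans (ℕ.≤-reflexive k+1+m≡n′) (ℕ.n≤1+n n′))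
              (≡.trans (≡.cong (λ j → sortedFrom j (word ρ)) k+1+m≡n′) (sortedFrom-last (word ρ))))) ⟩
      0# + d₁ + d₂
        K.≈⟨ +-congʳ (+-identityˡ d₁) ⟩
      d₁ + d₂ K.∎

  k≤n : ∀ {k} → k ℕ.+ 2 ≤ n ⊎ k ≡ n → k ≤ n
  k≤n (inj₁ k+2≤n) = ℕ.≤-trans (ℕ.m≤m+n _ 2) k+2≤n
  k≤n (inj₂ k≡n)   = ℕ.≤-reflexive k≡n

  isEigenvalue : ∀ {k} → k ℕ.+ 2 ≤ n ⊎ k ≡ n → ∀ {x} → x ≈ fromℕ k → IsEigenvalue (t n) x
  isEigenvalue {k} k∈ x≈k = projector k , projector≉0 k∈ ,
    ≈ᴬ-trans (projector-τ (k≤n k∈)) (∙ᴬ-cong (sym x≈k) ≈ᴬ-refl)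

  k<n′⇒k+2≤n : ∀ {k} → k < n′ → k ℕ.+ 2 ≤ n
  k<n′⇒k+2≤n {k} k<n′ = ≡.subst (_≤ n) (ℕ.+-comm 2 k) (s≤s k<n′)

  eigenvalues : ∀ x → IsEigenvalue (t n) x ⇔ (∃[ k ] (k ℕ.+ 2 ≤ n ⊎ k ≡ n) × x ≈ fromℕ k)
  eigenvalues x = mk⇔
    (λ (v , v-eigen) → index (eigenvalue-root spectrum spectrum-apart v-eigen (spectrum-annihilates v)))
    (λ (k , k∈ , x≈k) → isEigenvalue k∈ x≈k)
    where
    index : Any (x ≈_) spectrum → ∃[ k ] (k ℕ.+ 2 ≤ n ⊎ k ≡ n) × x ≈ fromℕ k
    index (here x≈n)   = n , inj₂ ≡.refl , x≈n
    index (there x∈) with Any.applyUpTo⁻ (λ i → i) (Any.map⁻ x∈)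
    ... | k , k<n′ , x≈k = k , inj₁ (k<n′⇒k+2≤n k<n′) , x≈k

  spectrum-eigenvalues : All (IsEigenvalue (t n)) spectrum
  spectrum-eigenvalues = isEigenvalue (inj₂ ≡.refl) refl
    ∷ All.map⁺ (All.map (λ k<n′ → isEigenvalue (inj₁ (k<n′⇒k+2≤n k<n′)) refl) (All.all-upTo n′))

  P-isMinimalPolynomial : IsMinimalPolynomial (t n) (P n)
  P-isMinimalPolynomial = ≡.subst (IsMinimalPolynomial (t n))
    (≡.cong (λ L → (K[x].X- fromℕ n) K[x].*ᴬ K[x].productᴬ L) (≡.sym (List.map-∘ (upTo n′))))
    (MinimalPolynomial.product-isMinimal F leftModule (rightMul-linear (τ n)) spectrum spectrum-apart
      spectrum-annihilates spectrum-eigenvalues)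

  t-diagonalizable : IsDiagonalizable (t n)
  t-diagonalizable = diagonalizable spectrum-apart spectrum-annihilates
    (singles-basis (allPermutations-unique n) (allPermutations-complete n))

module GeneratingSeries {c ℓ₁ ℓ₂} (F : HeytingField c ℓ₁ ℓ₂) (char0 : CharacteristicZero F) where
  open Scalars F hiding (zero)
  open HeytingField F using (#⇒invertible)
  open FieldProperties F
  open Factorials F char0
  open Tsetlin F char0 using (S; 1/!; D; D₀; module Series)
  open MonoidAlgebra commutativeRing (List.++-monoid ℕ) (List.≡-dec ℕ._≟_)
  open MonoidAlgebraProperties commutativeRing (List.++-monoid ℕ) (List.≡-dec ℕ._≟_)
  open Permutations using (hook)
  open LeftModule leftModule using (+ᴹ-identityʳ; *ₗ-assoc; *ₗ-distribˡ; *ₗ-distribʳ)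
  open RingProperties ring using (-‿distribʳ-*; -1*x≈-x)
  private
    module K = SetoidReasoning setoid
    module V = SetoidReasoning ≈ᴬ-setoid

  coefficient-sucʳ : ∀ i k → fromℕ (suc k) * coefficient i (suc k) ≈ coefficient i k
  coefficient-sucʳ zero    k = 1/!-suc k
  coefficient-sucʳ (suc i) k = K.begin
    fromℕ (suc k) * - (z * coefficient i (suc k))      K.≈⟨ -‿distribʳ-* _ _ ⟨
    - (fromℕ (suc k) * (z * coefficient i (suc k)))    K.≈⟨ -‿cong (x∙yz≈y∙xz _ _ _) ⟩
    - (z * (fromℕ (suc k) * coefficient i (suc k)))    K.≈⟨ -‿cong (*-congˡ (coefficient-sucʳ i k)) ⟩
    - (z * coefficient i k)                            K.∎
    where
    z = proj₁ (#⇒invertible (char0 i))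
    open CommutativeSemigroupProperties *-commutativeSemigroup using (x∙yz≈y∙xz)

  Σ< : ℕ → (ℕ → Element) → Element
  Σ< m φ = ∑ᴬ {m} (φ ∘ toℕ)

  Σ<-cong : ∀ m {φ ψ} → (∀ i → φ i ≈ᴬ ψ i) → Σ< m φ ≈ᴬ Σ< m ψ
  Σ<-cong m φ≈ψ = ∑ᴬ-cong {m} λ i → φ≈ψ (toℕ i)

  Σ<-zero : ∀ m {φ} → (∀ i → φ i ≈ᴬ 0ᴬ) → Σ< m φ ≈ᴬ 0ᴬ
  Σ<-zero zero    φ≈0 = ≈ᴬ-refl
  Σ<-zero (suc m) φ≈0 = +ᴬ-cong (φ≈0 0) (Σ<-zero m (φ≈0 ∘ suc))

  Σ<-last : ∀ m {φ} → (∀ i → i < m → φ i ≈ᴬ 0ᴬ) → Σ< (suc m) φ ≈ᴬ φ m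
  Σ<-last zero    {φ} φ≈0 = +ᴹ-identityʳ (φ 0)
  Σ<-last (suc m) {φ} φ≈0 = +ᴬ-cong (φ≈0 0 (s≤s z≤n)) (Σ<-last m {φ ∘ suc} λ i i<m → φ≈0 (suc i) (s≤s i<m))

  sumᴬ-applyUpTo : ∀ m {a} {A : Set a} (h : A → Element) (g : ℕ → A) → sumᴬ (map h (applyUpTo g m)) ≡ Σ< m (h ∘ g)
  sumᴬ-applyUpTo zero    h g = ≡.refl
  sumᴬ-applyUpTo (suc m) h g = ≡.cong (h (g 0) +ᴬ_) (sumᴬ-applyUpTo m h (g ∘ suc))

  sumᴬ-++ : ∀ xs ys → sumᴬ (xs ++ ys) ≡ sumᴬ xs +ᴬ sumᴬ ys
  sumᴬ-++ []       ys = ≡.refl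
  sumᴬ-++ (x ∷ xs) ys = ≡.trans (≡.cong (x +ᴬ_) (sumᴬ-++ xs ys)) (≡.sym (List.++-assoc x (sumᴬ xs) (sumᴬ ys)))

  sumᴬ-concatMap-applyUpTo : ∀ m {a b} {A : Set a} {B : Set b} (h : B → Element) (f : A → List B) (g : ℕ → A) →
    sumᴬ (map h (concatMap f (applyUpTo g m))) ≡ Σ< m (λ i → sumᴬ (map h (f (g i))))
  sumᴬ-concatMap-applyUpTo zero    h f g = ≡.refl
  sumᴬ-concatMap-applyUpTo (suc m) h f g = ≡.trans
    (≡.cong sumᴬ (List.map-++ h (f (g 0)) (concatMap f (applyUpTo (g ∘ suc) m))))
    (≡.trans (sumᴬ-++ (map h (f (g 0))) _)
      (≡.cong (sumᴬ (map h (f (g 0))) +ᴬ_) (sumᴬ-concatMap-applyUpTo m h f (g ∘ suc))))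

  module SeriesProperties (d : ℕ) where
    open Series d

    sum-splits-∷ : ∀ {d} a (e : Vec ℕ d) h → sumᴬ (map h (splits (a ∷ e)))
                   ≡ Σ< (suc a) (λ i → sumᴬ (map (λ (p , q) → h (i ∷ p , (a ∸ i) ∷ q)) (splits e)))
    sum-splits-∷ a e h = ≡.trans
      (sumᴬ-concatMap-applyUpTo (suc a) h (λ i → map (λ (p , q) → (i ∷ p , (a ∸ i) ∷ q)) (splits e)) (λ i → i))
      (CommutativeMonoidSum.sum-cong-≗ (LeftModule.+ᴹ-commutativeMonoid leftModule) {suc a}
        λ i → ≡.cong sumᴬ (≡.sym (List.map-∘ {g = h} {f = λ (p , q) → (toℕ i ∷ p , (a ∸ toℕ i) ∷ q)} (splits e))))

    sum-zero : ∀ {a} {A : Set a} (xs : List A) {h : A → Element} → (∀ x → h x ≈ᴬ 0ᴬ) → sumᴬ (map h xs) ≈ᴬ 0ᴬ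
    sum-zero []       h≈0 = ≈ᴬ-refl
    sum-zero (x ∷ xs) h≈0 = +ᴬ-cong (h≈0 x) (sum-zero xs h≈0)

    sum-splits-const : ∀ {d} (e : Vec ℕ d) h → (∀ p q → q ≢ Vec.replicate d 0 → h (p , q) ≈ᴬ 0ᴬ) →
                       sumᴬ (map h (splits e)) ≈ᴬ h (e , Vec.replicate d 0)
    sum-splits-const []      h h≈0 = +ᴹ-identityʳ (h ([] , []))
    sum-splits-const {suc d} (a ∷ e) h h≈0 = V.begin
      sumᴬ (map h (splits (a ∷ e)))
        V.≡⟨ sum-splits-∷ a e h ⟩
      Σ< (suc a) φ
        V.≈⟨ Σ<-last a {φ} (λ i i<a → sum-zero (splits e) λ (p , q) → h≈0 (i ∷ p) ((a ∸ i) ∷ q)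
               λ eq → ℕ.m>n⇒m∸n≢0 i<a (Vec.∷-injectiveˡ eq)) ⟩
      φ a
        V.≈⟨ sum-splits-const e _ (λ p q q≢0 → h≈0 (a ∷ p) ((a ∸ a) ∷ q) λ eq → q≢0 (Vec.∷-injectiveʳ eq)) ⟩
      h (a ∷ e , (a ∸ a) ∷ Vec.replicate d 0)
        V.≡⟨ ≡.cong (λ x → h (a ∷ e , x ∷ Vec.replicate d 0)) (ℕ.n∸n≡0 a) ⟩
      h (a ∷ e , 0 ∷ Vec.replicate d 0) V.∎
      where
      φ : ℕ → Element
      φ i = sumᴬ (map (λ (p , q) → h (i ∷ p , (a ∸ i) ∷ q)) (splits e))

    *ˢ-const : ∀ f s e → (f *ˢ const s) e ≈ᴬ f e *ᴬ s
    *ˢ-const f s e = ≈ᴬ-trans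
      (sum-splits-const e (λ (p , q) → f p *ᴬ const s q) λ p q q≢0 →
        ≈ᴬ-trans (*ᴬ-cong (≈ᴬ-refl {x = f p}) (≈ᴬ-reflexive (≡.cong (if_then s else 0ᴬ)
                   (dec-false (Vec.≡-dec ℕ._≟_ (Vec.replicate d 0) q) (q≢0 ∘ ≡.sym)))))
                 (*ᴬ-zeroʳ (f p)))
      (*ᴬ-cong (≈ᴬ-refl {x = f e}) (≈ᴬ-reflexive (≡.cong (if_then s else 0ᴬ)
        (dec-true (Vec.≡-dec ℕ._≟_ (Vec.replicate d 0) (Vec.replicate d 0)) ≡.refl))))

  private
    module S₁ = Series 1
    module S₂ = Series 2
    module P₁ = SeriesProperties 1
    module P₂ = SeriesProperties 2

  *ˢ₁ : ∀ f g a → (f S₁.*ˢ g) (a ∷ []) ≈ᴬ Σ< (suc a) (λ i → f (i ∷ []) *ᴬ g (a ∸ i ∷ []))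
  *ˢ₁ f g a = ≈ᴬ-trans (≈ᴬ-reflexive (P₁.sum-splits-∷ a [] (λ (p , q) → f p *ᴬ g q)))
    (Σ<-cong (suc a) λ i → +ᴹ-identityʳ (f (i ∷ []) *ᴬ g (a ∸ i ∷ [])))

  *ˢ₂ : ∀ f g a b → (f S₂.*ˢ g) (a ∷ b ∷ []) ≈ᴬ
        Σ< (suc a) (λ i → Σ< (suc b) (λ l → f (i ∷ l ∷ []) *ᴬ g (a ∸ i ∷ b ∸ l ∷ [])))
  *ˢ₂ f g a b = ≈ᴬ-trans (≈ᴬ-reflexive (P₂.sum-splits-∷ a (b ∷ []) (λ (p , q) → f p *ᴬ g q)))
    (Σ<-cong (suc a) λ i → ≈ᴬ-trans
      (≈ᴬ-reflexive (P₂.sum-splits-∷ b [] (λ (p , q) → f (i ∷ p) *ᴬ g ((a ∸ i) ∷ q))))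
      (Σ<-cong (suc b) λ l → +ᴹ-identityʳ (f (i ∷ l ∷ []) *ᴬ g (a ∸ i ∷ b ∸ l ∷ []))))

  [u-t]S₁ : S₂.Series
  [u-t]S₁ = (S₂.var (suc zero) S₂.-ˢ S₂.var zero) S₂.*ˢ S₂.const (S 1)

  private
    f : ℕ → ℕ → Element
    f a b = [u-t]S₁ (a ∷ b ∷ [])

    u-t : ℕ → ℕ → Element
    u-t a b = (S₂.var (suc zero) S₂.-ˢ S₂.var zero) (a ∷ b ∷ [])

    f≈ : ∀ a b → f a b ≈ᴬ u-t a b *ᴬ S 1
    f≈ a b = P₂.*ˢ-const (S₂.var (suc zero) S₂.-ˢ S₂.var zero) (S 1) (a ∷ b ∷ [])

    f01 : f 0 1 ≈ᴬ S 1
    f01 = ≈ᴬ-trans (f≈ 0 1) (*ᴬ-identityˡ (S 1))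

    f10 : f 1 0 ≈ᴬ (- 1#) ∙ᴬ S 1
    f10 = ≈ᴬ-trans (f≈ 1 0) (≈ᴬ-trans (*ᴬ-cong (coeff-neg-one 1ᴬ) (≈ᴬ-refl {x = S 1}))
      (≈ᴬ-trans (∙ᴬ-*ᴬ-assoc (- 1#) 1ᴬ (S 1)) (∙ᴬ-cong refl (*ᴬ-identityˡ (S 1)))))

    f*≈0 : ∀ a b {g} → u-t a b ≡ [] → f a b *ᴬ g ≈ᴬ 0ᴬ
    f*≈0 a b {g} eq = *ᴬ-cong (≈ᴬ-trans (f≈ a b) (≈ᴬ-reflexive (≡.cong (_*ᴬ S 1) eq))) (≈ᴬ-refl {x = g})

    step : (ℕ → ℕ → Element) → ℕ → ℕ → Element
    step g zero    zero    = 0ᴬ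
    step g zero    (suc b) = S 1 *ᴬ g 0 b
    step g (suc a) zero    = (- 1#) ∙ᴬ (S 1 *ᴬ g a 0)
    step g (suc a) (suc b) = S 1 *ᴬ g (suc a) b +ᴬ (- 1#) ∙ᴬ (S 1 *ᴬ g a (suc b))

    row₀ : ∀ b (g : ℕ → Element) → Σ< (suc (suc b)) (λ l → f 0 l *ᴬ g (suc b ∸ l)) ≈ᴬ S 1 *ᴬ g b
    row₀ b g = +ᴬ-cong (f*≈0 0 0 {g (suc b)} ≡.refl) (≈ᴬ-trans
      (+ᴬ-cong (*ᴬ-cong f01 (≈ᴬ-refl {x = g b})) (Σ<-zero b {λ l → f 0 (suc (suc l)) *ᴬ g (b ∸ suc l)} λ l → f*≈0 0 (suc (suc l)) {g (b ∸ suc l)} ≡.refl))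
      (+ᴹ-identityʳ _))

    row₁ : ∀ b (g : ℕ → Element) → Σ< (suc b) (λ l → f 1 l *ᴬ g (b ∸ l)) ≈ᴬ (- 1#) ∙ᴬ (S 1 *ᴬ g b)
    row₁ b g = ≈ᴬ-trans
      (+ᴬ-cong (≈ᴬ-trans (*ᴬ-cong f10 (≈ᴬ-refl {x = g b})) (∙ᴬ-*ᴬ-assoc (- 1#) (S 1) (g b)))
               (Σ<-zero b {λ l → f 1 (suc l) *ᴬ g (b ∸ suc l)} λ l → f*≈0 1 (suc l) {g (b ∸ suc l)} ≡.refl))
      (+ᴹ-identityʳ _)

    rows : ∀ a b (g : ℕ → ℕ → Element) →
           Σ< a (λ i → Σ< (suc b) (λ l → f (suc (suc i)) l *ᴬ g (a ∸ suc i) (b ∸ l))) ≈ᴬ 0ᴬ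
    rows a b g = Σ<-zero a {λ i → Σ< (suc b) (λ l → f (suc (suc i)) l *ᴬ g (a ∸ suc i) (b ∸ l))} λ i →
      Σ<-zero (suc b) {λ l → f (suc (suc i)) l *ᴬ g (a ∸ suc i) (b ∸ l)} λ l →
        f*≈0 (suc (suc i)) l {g (a ∸ suc i) (b ∸ l)} ≡.refl

  [u-t]S₁-* : ∀ h a b → ([u-t]S₁ S₂.*ˢ h) (a ∷ b ∷ []) ≈ᴬ step (λ a b → h (a ∷ b ∷ [])) a b
  [u-t]S₁-* h a b = ≈ᴬ-trans (*ˢ₂ [u-t]S₁ h a b) (collect a b)
    where
    g : ℕ → ℕ → Element
    g a b = h (a ∷ b ∷ [])
    collect : ∀ a b → Σ< (suc a) (λ i → Σ< (suc b) (λ l → f i l *ᴬ g (a ∸ i) (b ∸ l))) ≈ᴬ step g a b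
    collect zero    zero    = +ᴬ-cong (+ᴬ-cong (f*≈0 0 0 {g 0 0} ≡.refl) (≈ᴬ-refl {x = 0ᴬ})) (≈ᴬ-refl {x = 0ᴬ})
    collect zero    (suc b) = ≈ᴬ-trans (+ᴹ-identityʳ _) (row₀ b (g 0))
    collect (suc a) zero    = +ᴬ-cong (+ᴬ-cong (f*≈0 0 0 {g (suc a) 0} ≡.refl) (≈ᴬ-refl {x = 0ᴬ}))
      (≈ᴬ-trans (+ᴬ-cong (row₁ 0 (g a)) (rows a 0 g)) (+ᴹ-identityʳ _))
    collect (suc a) (suc b) = +ᴬ-cong (row₀ b (g (suc a)))
      (≈ᴬ-trans (+ᴬ-cong (row₁ (suc b) (g a)) (rows a (suc b) g)) (+ᴹ-identityʳ _))

  power : ℕ → ℕ → ℕ → Element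
  power j a b = ([u-t]S₁ S₂.^ˢ j) (a ∷ b ∷ [])

  power-off : ∀ j a b → a ℕ.+ b ≢ j → power j a b ≈ᴬ 0ᴬ
  power-off zero    zero    zero    0≢0 = ⊥-elim (0≢0 ≡.refl)
  power-off zero    zero    (suc b) _   = ≈ᴬ-refl
  power-off zero    (suc a) b       _   = ≈ᴬ-refl
  power-off (suc j) a b a+b≢1+j = ≈ᴬ-trans ([u-t]S₁-* ([u-t]S₁ S₂.^ˢ j) a b) (vanish a b a+b≢1+j)
    where
    S₁*0 : ∀ {g} → g ≈ᴬ 0ᴬ → S 1 *ᴬ g ≈ᴬ 0ᴬ
    S₁*0 g≈0 = ≈ᴬ-trans (*ᴬ-cong (≈ᴬ-refl {x = S 1}) g≈0) (*ᴬ-zeroʳ (S 1))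
    vanish : ∀ a b → a ℕ.+ b ≢ suc j → step (power j) a b ≈ᴬ 0ᴬ
    vanish zero    zero    _  = ≈ᴬ-refl
    vanish zero    (suc b) ne = S₁*0 (power-off j 0 b (ne ∘ ≡.cong suc))
    vanish (suc a) zero    ne = ∙ᴬ-cong refl (S₁*0 (power-off j a 0 (ne ∘ ≡.cong suc)))
    vanish (suc a) (suc b) ne = +ᴬ-cong
      (S₁*0 (power-off j (suc a) b (ne ∘ λ eq → ≡.cong suc (≡.trans (ℕ.+-suc a b) eq))))
      (∙ᴬ-cong refl (S₁*0 (power-off j a (suc b) (ne ∘ ≡.cong suc))))

  S₁* : ∀ j x {g} → g ≈ᴬ x ∙ᴬ single (replicate j 0) → S 1 *ᴬ g ≈ᴬ x ∙ᴬ single (replicate (suc j) 0)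
  S₁* j x g≈ = ≈ᴬ-trans (*ᴬ-cong (≈ᴬ-refl {x = S 1}) g≈) (≈ᴬ-trans (*ᴬ-∙ᴬ-comm x (S 1) (single (replicate j 0)))
    (∙ᴬ-cong refl (single-* (0 ∷ []) (replicate j 0))))

  power-diagonal : ∀ j a b → a ℕ.+ b ≡ j → 1/! j ∙ᴬ power j a b ≈ᴬ coefficient a b ∙ᴬ single (replicate j 0)
  power-diagonal zero    zero zero ≡.refl = ≈ᴬ-refl
  power-diagonal (suc j) a b a+b≡1+j = V.begin
    (z * 1/! j) ∙ᴬ power (suc j) a b             V.≈⟨ ∙ᴬ-cong refl ([u-t]S₁-* ([u-t]S₁ S₂.^ˢ j) a b) ⟩
    (z * 1/! j) ∙ᴬ step (power j) a b            V.≈⟨ *ₗ-assoc z (1/! j) _ ⟩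
    z ∙ᴬ 1/! j ∙ᴬ step (power j) a b             V.≈⟨ ∙ᴬ-cong refl (stepped a b a+b≡1+j) ⟩
    z ∙ᴬ (fromℕ (suc j) * coefficient a b) ∙ᴬ s  V.≈⟨ *ₗ-assoc z _ s ⟨
    (z * (fromℕ (suc j) * coefficient a b)) ∙ᴬ s V.≈⟨ ∙ᴬ-cong (trans (sym (*-assoc _ _ _)) (trans (*-congʳ z*1+j≈1) (*-identityˡ _))) ≈ᴬ-refl ⟩
    coefficient a b ∙ᴬ s                         V.∎
    where
    z = proj₁ (#⇒invertible (char0 j))
    s = single (replicate (suc j) 0)
    z*1+j≈1 : z * fromℕ (suc j) ≈ 1#
    z*1+j≈1 = trans (*-congˡ (sym (x-0≈x _))) (proj₁ (proj₂ (#⇒invertible (char0 j))))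
    up : ∀ a b → a ℕ.+ b ≡ j → 1/! j ∙ᴬ (S 1 *ᴬ power j a b) ≈ᴬ coefficient a b ∙ᴬ s
    up a b eq = ≈ᴬ-trans (≈ᴬ-sym (*ᴬ-∙ᴬ-comm (1/! j) (S 1) (power j a b))) (S₁* j (coefficient a b) (power-diagonal j a b eq))
    down : ∀ a b → a ℕ.+ b ≡ j → 1/! j ∙ᴬ (- 1#) ∙ᴬ (S 1 *ᴬ power j a b) ≈ᴬ (fromℕ (suc a) * coefficient (suc a) b) ∙ᴬ s
    down a b eq = V.begin
      1/! j ∙ᴬ (- 1#) ∙ᴬ (S 1 *ᴬ power j a b)      V.≈⟨ *ₗ-assoc _ _ _ ⟨
      (1/! j * - 1#) ∙ᴬ (S 1 *ᴬ power j a b)       V.≈⟨ ∙ᴬ-cong (*-comm _ _) ≈ᴬ-refl ⟩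
      (- 1# * 1/! j) ∙ᴬ (S 1 *ᴬ power j a b)       V.≈⟨ *ₗ-assoc _ _ _ ⟩
      (- 1#) ∙ᴬ 1/! j ∙ᴬ (S 1 *ᴬ power j a b)      V.≈⟨ ∙ᴬ-cong refl (up a b eq) ⟩
      (- 1#) ∙ᴬ coefficient a b ∙ᴬ s               V.≈⟨ *ₗ-assoc _ _ _ ⟨
      (- 1# * coefficient a b) ∙ᴬ s                V.≈⟨ ∙ᴬ-cong (trans (-1*x≈-x _) (trans (sym (coefficient-suc a b)) (*-comm _ _))) ≈ᴬ-refl ⟩
      (fromℕ (suc a) * coefficient (suc a) b) ∙ᴬ s V.∎
    stepped : ∀ a b → a ℕ.+ b ≡ suc j → 1/! j ∙ᴬ step (power j) a b ≈ᴬ (fromℕ (suc j) * coefficient a b) ∙ᴬ s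
    stepped zero    (suc b) ≡.refl = ≈ᴬ-trans (up 0 b ≡.refl) (∙ᴬ-cong (sym (coefficient-sucʳ 0 b)) ≈ᴬ-refl)
    stepped (suc a) zero    eq     = ≈ᴬ-trans (down a 0 (ℕ.suc-injective eq))
      (∙ᴬ-cong (*-congʳ (reflexive (≡.cong fromℕ (≡.trans (≡.cong suc (≡.sym (ℕ.+-identityʳ a))) eq)))) ≈ᴬ-refl)
    stepped (suc a) (suc b) eq     = V.begin
      1/! j ∙ᴬ (S 1 *ᴬ power j (suc a) b +ᴬ (- 1#) ∙ᴬ (S 1 *ᴬ power j a (suc b)))
        V.≈⟨ *ₗ-distribˡ (1/! j) (S 1 *ᴬ power j (suc a) b) _ ⟩
      1/! j ∙ᴬ (S 1 *ᴬ power j (suc a) b) +ᴬ 1/! j ∙ᴬ (- 1#) ∙ᴬ (S 1 *ᴬ power j a (suc b))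
        V.≈⟨ +ᴬ-cong (up (suc a) b (≡.trans (≡.sym (ℕ.+-suc a b)) (ℕ.suc-injective eq))) (down a (suc b) (ℕ.suc-injective eq)) ⟩
      coefficient (suc a) b ∙ᴬ s +ᴬ (fromℕ (suc a) * coefficient (suc a) (suc b)) ∙ᴬ s
        V.≈⟨ *ₗ-distribʳ s _ _ ⟨
      (coefficient (suc a) b + fromℕ (suc a) * x) ∙ᴬ s
        V.≈⟨ ∙ᴬ-cong (trans (+-comm _ _) (trans (+-congˡ (sym (coefficient-sucʳ (suc a) b))) (sym (distribʳ x _ _)))) ≈ᴬ-refl ⟩
      ((fromℕ (suc a) + fromℕ (suc b)) * x) ∙ᴬ s
        V.≈⟨ ∙ᴬ-cong (*-congʳ (trans (sym (fromℕ-homo-+ char0 (suc a) (suc b))) (reflexive (≡.cong fromℕ eq)))) ≈ᴬ-refl ⟩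
      (fromℕ (suc j) * x) ∙ᴬ s V.∎
      where x = coefficient (suc a) (suc b)

  exp-[u-t]S₁ : ∀ a b → S₂.exp [u-t]S₁ (a ∷ b ∷ []) ≈ᴬ coefficient a b ∙ᴬ single (replicate (b ℕ.+ a) 0)
  exp-[u-t]S₁ a b = V.begin
    S₂.exp [u-t]S₁ (a ∷ b ∷ [])
      V.≡⟨ sumᴬ-applyUpTo (suc j) (λ j → 1/! j ∙ᴬ power j a b) (λ j → j) ⟩
    Σ< (suc j) (λ j → 1/! j ∙ᴬ power j a b)
      V.≈⟨ Σ<-last j {λ j → 1/! j ∙ᴬ power j a b} (λ i i<j → ∙ᴬ-cong refl (power-off i a b λ a+b≡i → ℕ.<⇒≢ i<j (≡.trans (≡.sym a+b≡i) a+b≡j))) ⟩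
    1/! j ∙ᴬ power j a b
      V.≈⟨ power-diagonal j a b a+b≡j ⟩
    coefficient a b ∙ᴬ single (replicate j 0)
      V.≡⟨ ≡.cong (λ j → coefficient a b ∙ᴬ single (replicate j 0)) (≡.trans (≡.sym a+b≡j) (ℕ.+-comm a b)) ⟩
    coefficient a b ∙ᴬ single (replicate (b ℕ.+ a) 0) V.∎
    where
    j = a ℕ.+ (b ℕ.+ 0)
    a+b≡j : a ℕ.+ b ≡ j
    a+b≡j = ≡.cong (a ℕ.+_) (≡.sym (ℕ.+-identityʳ b))

  complete-0 : ∀ a → S₂.complete zero (a ∷ 0 ∷ []) ≡ S a
  complete-0 a = ≡.cong (if_then S a else 0ᴬ) (dec-true (Vec.≡-dec ℕ._≟_ (a ∷ 0 ∷ []) (a ∷ 0 ∷ [])) ≡.refl)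

  complete-≢0 : ∀ a {b} → b ≢ 0 → S₂.complete zero (a ∷ b ∷ []) ≡ 0ᴬ
  complete-≢0 a {b} b≢0 = ≡.cong (if_then S a else 0ᴬ)
    (dec-false (Vec.≡-dec ℕ._≟_ (a ∷ b ∷ []) (a ∷ 0 ∷ [])) λ eq → b≢0 (Vec.∷-injectiveˡ (Vec.∷-injectiveʳ eq)))

  S≈hook : ∀ m → S m ≈ᴬ single (hook 0 m)
  S≈hook zero    = ≈ᴬ-refl
  S≈hook (suc m) = ≈ᴬ-refl

  replicate-++-hook : ∀ j m → replicate j 0 ++ hook 0 m ≡ hook j m
  replicate-++-hook zero    m = ≡.refl
  replicate-++-hook (suc j) m = ≡.cong (0 ∷_) (replicate-++-hook j m)

  D≈ : ∀ n k → D n k ≈ᴬ Σ< (suc (n ∸ k)) (λ i → coefficient i k ∙ᴬ single (hook (k ℕ.+ i) (n ∸ (k ℕ.+ i))))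
  D≈ n k = ≈ᴬ-trans (*ˢ₂ (S₂.exp [u-t]S₁) (S₂.complete zero) (n ∸ k) k) (Σ<-cong (suc (n ∸ k)) row)
    where
    E : ℕ → ℕ → Element
    E i l = S₂.exp [u-t]S₁ (i ∷ l ∷ [])
    row : ∀ i → Σ< (suc k) (λ l → E i l *ᴬ S₂.complete zero (n ∸ k ∸ i ∷ k ∸ l ∷ []))
              ≈ᴬ coefficient i k ∙ᴬ single (hook (k ℕ.+ i) (n ∸ (k ℕ.+ i)))
    row i = V.begin
      Σ< (suc k) (λ l → E i l *ᴬ S₂.complete zero (n ∸ k ∸ i ∷ k ∸ l ∷ []))
        V.≈⟨ Σ<-last k {λ l → E i l *ᴬ S₂.complete zero (n ∸ k ∸ i ∷ k ∸ l ∷ [])} (λ l l<k → ≈ᴬ-trans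
              (≈ᴬ-reflexive (≡.cong (E i l *ᴬ_) (complete-≢0 (n ∸ k ∸ i) (ℕ.m>n⇒m∸n≢0 l<k)))) (*ᴬ-zeroʳ (E i l))) ⟩
      E i k *ᴬ S₂.complete zero (n ∸ k ∸ i ∷ k ∸ k ∷ [])
        V.≡⟨ ≡.cong (E i k *ᴬ_) (≡.trans (≡.cong (λ x → S₂.complete zero (n ∸ k ∸ i ∷ x ∷ [])) (ℕ.n∸n≡0 k)) (complete-0 (n ∸ k ∸ i))) ⟩
      E i k *ᴬ S (n ∸ k ∸ i)
        V.≡⟨ ≡.cong (λ x → E i k *ᴬ S x) (ℕ.∸-+-assoc n k i) ⟩
      E i k *ᴬ S m
        V.≈⟨ *ᴬ-cong (exp-[u-t]S₁ i k) (S≈hook m) ⟩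
      (coefficient i k ∙ᴬ single (replicate (k ℕ.+ i) 0)) *ᴬ single (hook 0 m)
        V.≈⟨ ∙ᴬ-*ᴬ-assoc (coefficient i k) (single (replicate (k ℕ.+ i) 0)) (single (hook 0 m)) ⟩
      coefficient i k ∙ᴬ (single (replicate (k ℕ.+ i) 0) *ᴬ single (hook 0 m))
        V.≈⟨ ∙ᴬ-cong refl (single-* (replicate (k ℕ.+ i) 0) (hook 0 m)) ⟩
      coefficient i k ∙ᴬ single (replicate (k ℕ.+ i) 0 ++ hook 0 m)
        V.≡⟨ ≡.cong (λ I → coefficient i k ∙ᴬ single I) (replicate-++-hook (k ℕ.+ i) m) ⟩
      coefficient i k ∙ᴬ single (hook (k ℕ.+ i) m) V.∎
      where m = n ∸ (k ℕ.+ i)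

  -- Setting u = 0 turns series in t and u into series in x.
  infix 4 _↾≈_
  _↾≈_ : S₂.Series → S₁.Series → Set _
  f ↾≈ g = ∀ a → f (a ∷ 0 ∷ []) ≈ᴬ g (a ∷ [])

  ↾-* : ∀ {f f′ g g′} → f ↾≈ f′ → g ↾≈ g′ → f S₂.*ˢ g ↾≈ f′ S₁.*ˢ g′
  ↾-* {f} {f′} {g} {g′} f≈ g≈ a = ≈ᴬ-trans (*ˢ₂ f g a 0) (≈ᴬ-trans
    (Σ<-cong (suc a) {λ i → Σ< 1 (λ l → f (i ∷ l ∷ []) *ᴬ g (a ∸ i ∷ 0 ∸ l ∷ []))} λ i → ≈ᴬ-trans (+ᴹ-identityʳ (f (i ∷ 0 ∷ []) *ᴬ g (a ∸ i ∷ 0 ∷ []))) (*ᴬ-cong (f≈ i) (g≈ (a ∸ i))))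
    (≈ᴬ-sym (*ˢ₁ f′ g′ a)))

  ↾-const : ∀ s → S₂.const s ↾≈ S₁.const s
  ↾-const s zero    = ≈ᴬ-refl
  ↾-const s (suc a) = ≈ᴬ-refl

  ↾-^ : ∀ {f f′} → f ↾≈ f′ → ∀ j → f S₂.^ˢ j ↾≈ f′ S₁.^ˢ j
  ↾-^ f≈ zero    = ↾-const 1ᴬ
  ↾-^ {f} {f′} f≈ (suc j) = ↾-* {f} {f′} {f S₂.^ˢ j} {f′ S₁.^ˢ j} f≈ (↾-^ {f} {f′} f≈ j)

  ↾-exp : ∀ {f f′} → f ↾≈ f′ → S₂.exp f ↾≈ S₁.exp f′
  ↾-exp {f} {f′} f≈ a = V.begin
    S₂.exp f (a ∷ 0 ∷ [])
      V.≡⟨ sumᴬ-applyUpTo (suc (a ℕ.+ 0)) (λ j → 1/! j ∙ᴬ (f S₂.^ˢ j) (a ∷ 0 ∷ [])) (λ j → j) ⟩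
    Σ< (suc (a ℕ.+ 0)) (λ j → 1/! j ∙ᴬ (f S₂.^ˢ j) (a ∷ 0 ∷ []))
      V.≈⟨ Σ<-cong (suc (a ℕ.+ 0)) (λ j → ∙ᴬ-cong (refl {1/! j}) (↾-^ {f} {f′} f≈ j a)) ⟩
    Σ< (suc (a ℕ.+ 0)) (λ j → 1/! j ∙ᴬ (f′ S₁.^ˢ j) (a ∷ []))
      V.≡⟨ sumᴬ-applyUpTo (suc (a ℕ.+ 0)) (λ j → 1/! j ∙ᴬ (f′ S₁.^ˢ j) (a ∷ [])) (λ j → j) ⟨
    S₁.exp f′ (a ∷ []) V.∎

  -xS₁ : S₁.Series
  -xS₁ = S₁.-ˢ (S₁.var zero S₁.*ˢ S₁.const (S 1))

  ↾-[u-t]S₁ : [u-t]S₁ ↾≈ -xS₁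
  ↾-[u-t]S₁ a = V.begin
    f a 0                                      V.≈⟨ f≈ a 0 ⟩
    u-t a 0 *ᴬ S 1                             V.≡⟨ ≡.cong (_*ᴬ S 1) (restrict a) ⟩
    (-ᴬ x) *ᴬ S 1                              V.≈⟨ *ᴬ-cong (coeff-neg-one x) (≈ᴬ-refl {x = S 1}) ⟩
    ((- 1#) ∙ᴬ x) *ᴬ S 1                       V.≈⟨ ∙ᴬ-*ᴬ-assoc (- 1#) x (S 1) ⟩
    (- 1#) ∙ᴬ (x *ᴬ S 1)                       V.≈⟨ ∙ᴬ-cong refl (P₁.*ˢ-const (S₁.var zero) (S 1) (a ∷ [])) ⟨
    (- 1#) ∙ᴬ (S₁.var zero S₁.*ˢ S₁.const (S 1)) (a ∷ [])  V.≈⟨ coeff-neg-one ((S₁.var zero S₁.*ˢ S₁.const (S 1)) (a ∷ [])) ⟨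
    -xS₁ (a ∷ [])                              V.∎
    where
    x = S₁.var zero (a ∷ [])
    restrict : ∀ a → u-t a 0 ≡ -ᴬ S₁.var zero (a ∷ [])
    restrict zero          = ≡.refl
    restrict (suc zero)    = ≡.refl
    restrict (suc (suc a)) = ≡.refl

  ↾-complete : S₂.complete zero ↾≈ S₁.complete zero
  ↾-complete a = ≈ᴬ-reflexive (≡.trans (complete-0 a)
    (≡.sym (≡.cong (if_then S a else 0ᴬ) (dec-true (Vec.≡-dec ℕ._≟_ (a ∷ []) (a ∷ [])) ≡.refl))))

  D₀≈D : ∀ n → D₀ n ≈ᴬ D n 0
  D₀≈D n = ≈ᴬ-sym (↾-* {S₂.exp [u-t]S₁} {S₁.exp -xS₁} {S₂.complete zero} {S₁.complete zero}
    (↾-exp {[u-t]S₁} { -xS₁} ↾-[u-t]S₁) ↾-complete n)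

module DescentAlgebra {c ℓ₁ ℓ₂} (F : HeytingField c ℓ₁ ℓ₂) (char0 : CharacteristicZero F) (n′ : ℕ) where
  private
    n : ℕ
    n = suc n′
  open import Data.Nat.Base using (_+_)
  open Scalars F hiding (zero; _+_)
  open Factorials F char0
  open GeneratingSeries F char0
  open Shuffles F char0 n′
  open Permutations
  open Tsetlin F char0 using (K𝔖; Vectors; descentSum; α; τ; S; D; InSym; module Sym; module Kᴳ)
  open Kᴳ {n} using (_≈ᴬ_; _∙ᴬ_; _*ᴬ_; _+ᴬ_; 0ᴬ)
  private
    module Symₚ = MonoidAlgebraProperties commutativeRing (List.++-monoid ℕ) (List.≡-dec ℕ._≟_)
    module K𝔖ₚ = MonoidAlgebraProperties commutativeRing (Group.monoid (𝔖 n)) _≟ₚ_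
    module ∑ = CommutativeMonoidSum +-commutativeMonoid
  open Symₚ.Pairing (Vectors n)
  open K𝔖ₚ using (∑ᴬ; ∑ᴬ-cong; ≈ᴬ-refl; ≈ᴬ-sym; ≈ᴬ-trans; ≈ᴬ-reflexive; +ᴬ-cong; ∙ᴬ-cong; *ᴬ-cong; *ᴬ-identityˡ)
  open LeftModule (Vectors n) using (+ᴹ-assoc; +ᴹ-identityʳ; +ᴹ-identityˡ; *ₗ-zeroˡ)

  descend : Composition → K𝔖 n
  descend I = if does (∣ I ∣ᶜ ℕ.≟ n) then descentSum n I else 0ᴬ

  α≈⟪⟫ : ∀ f → α n f ≈ᴬ ⟪ f , descend ⟫
  α≈⟪⟫ []            = ≈ᴬ-refl
  α≈⟪⟫ ((a , I) ∷ f) = +ᴬ-cong (≈ᴬ-reflexive (scale (does (∣ I ∣ᶜ ℕ.≟ n)))) (α≈⟪⟫ f)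
    where
    scale : ∀ b → (if b then a ∙ᴬ descentSum n I else 0ᴬ) ≡ a ∙ᴬ (if b then descentSum n I else 0ᴬ)
    scale true  = ≡.refl
    scale false = ≡.refl

  α-cong : ∀ {f g} → f Sym.≈ᴬ g → α n f ≈ᴬ α n g
  α-cong {f} {g} f≈g = ≈ᴬ-trans (α≈⟪⟫ f) (≈ᴬ-trans
    (⟪⟫-congˡ {descend} (λ { ≡.refl → ≈ᴬ-refl }) f≈g) (≈ᴬ-sym (α≈⟪⟫ g)))

  ⟪⟫-∑ : ∀ {m} (a : Fin m → Carrier) (I : Fin m → Composition) →
         ⟪ Symₚ.∑ᴬ (λ i → a i Sym.∙ᴬ Sym.single (I i)) , descend ⟫ ≈ᴬ ∑ᴬ (λ i → a i ∙ᴬ descend (I i))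
  ⟪⟫-∑ {zero}  a I = ≈ᴬ-refl
  ⟪⟫-∑ {suc m} a I = ≈ᴬ-trans (⟪⟫-+ˡ (a zero Sym.∙ᴬ Sym.single (I zero)) (Symₚ.∑ᴬ (λ i → a (suc i) Sym.∙ᴬ Sym.single (I (suc i)))) descend) (+ᴬ-cong
    (≈ᴬ-trans (⟪⟫-∙ˡ (a zero) (Sym.single (I zero)) descend) (∙ᴬ-cong refl (⟪⟫-single (I zero) descend)))
    (⟪⟫-∑ (a ∘ suc) (I ∘ suc)))

  descend-hook : ∀ {j} → j ≤ n → descend (hook j (n ∸ j)) ≡ B j
  descend-hook {j} j≤n = ≡.cong (if_then descentSum n (hook j (n ∸ j)) else 0ᴬ)
    (dec-true (∣ hook j (n ∸ j) ∣ᶜ ℕ.≟ n) (≡.trans (∣hook∣ j (n ∸ j)) (ℕ.m+[n∸m]≡n j≤n)))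

  index-bound : ∀ {k} → k ≤ n → (i : Fin (suc (n ∸ k))) → k + toℕ i ≤ n
  index-bound {k} k≤n i = ℕ.≤-trans (ℕ.+-monoʳ-≤ k (Fin.toℕ≤pred[n] i)) (ℕ.≤-reflexive (ℕ.m+[n∸m]≡n k≤n))

  ∑-last : ∀ m (φ : ℕ → K𝔖 n) → ∑ᴬ {suc m} (φ ∘ toℕ) ≈ᴬ ∑ᴬ {m} (φ ∘ toℕ) +ᴬ φ m
  ∑-last zero    φ = +ᴹ-identityʳ (φ 0)
  ∑-last (suc m) φ = ≈ᴬ-trans (+ᴬ-cong (≈ᴬ-refl {x = φ 0}) (∑-last m (φ ∘ suc)))
                              (≈ᴬ-sym (+ᴹ-assoc (φ 0) (∑ᴬ {m} (φ ∘ suc ∘ toℕ)) (φ (suc m))))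

  ∑≈partialProjector : ∀ k N → ∑ᴬ {suc N} (λ i → coefficient (toℕ i) k ∙ᴬ B (k + toℕ i)) ≈ᴬ partialProjector k N
  ∑≈partialProjector k zero    = +ᴹ-identityʳ (coefficient 0 k ∙ᴬ B (k + 0))
  ∑≈partialProjector k (suc N) = ≈ᴬ-trans (∑-last (suc N) λ i → coefficient i k ∙ᴬ B (k + i))
    (+ᴬ-cong (∑≈partialProjector k N) ≈ᴬ-refl)

  α-D : ∀ {k} → k ≤ n → α n (D n k) ≈ᴬ projector k
  α-D {k} k≤n = ≈ᴬ-trans (α≈⟪⟫ (D n k)) (≈ᴬ-trans
    (⟪⟫-congˡ {descend} (λ { ≡.refl → ≈ᴬ-refl }) (D≈ n k)) (≈ᴬ-trans
    (⟪⟫-∑ {suc (n ∸ k)} (λ i → coefficient (toℕ i) k) (λ i → hook (k + toℕ i) (n ∸ (k + toℕ i)))) (≈ᴬ-trans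
    (∑ᴬ-cong {suc (n ∸ k)}
      {λ i → coefficient (toℕ i) k ∙ᴬ descend (hook (k + toℕ i) (n ∸ (k + toℕ i)))}
      {λ i → coefficient (toℕ i) k ∙ᴬ B (k + toℕ i)}
      λ i → ∙ᴬ-cong (refl {coefficient (toℕ i) k}) (≈ᴬ-reflexive (descend-hook (index-bound k≤n i))))
    (∑≈partialProjector k (n ∸ k)))))

  α-S₁Sₙ₋₁ : α n (S 1 Sym.*ᴬ S n′) ≈ᴬ τ n
  α-S₁Sₙ₋₁ = ≈ᴬ-trans (α≈⟪⟫ (S 1 Sym.*ᴬ S n′)) (≈ᴬ-trans
    (⟪⟫-congˡ {descend} (λ { ≡.refl → ≈ᴬ-refl }) S₁Sₙ₋₁≈hook) (≈ᴬ-trans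
    (⟪⟫-single (hook 1 n′) descend) (≈ᴬ-trans
    (≈ᴬ-reflexive (descend-hook {1} (s≤s z≤n))) B₁≈τ)))
    where
    S₁Sₙ₋₁≈hook : S 1 Sym.*ᴬ S n′ Sym.≈ᴬ Sym.single (hook 1 n′)
    S₁Sₙ₋₁≈hook = Symₚ.≈ᴬ-trans (Symₚ.*ᴬ-cong (Symₚ.≈ᴬ-refl {x = S 1}) (S≈hook n′)) (Symₚ.single-* (0 ∷ []) (hook 0 n′))
    B₁≈τ : B 1 ≈ᴬ τ n
    B₁≈τ = ≈ᴬ-sym (≈ᴬ-trans (≈ᴬ-sym (*ᴬ-identityˡ (τ n))) (≈ᴬ-trans
      (*ᴬ-cong (≈ᴬ-sym B-zero) (≈ᴬ-refl {x = τ n})) (≈ᴬ-trans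
      (B-τ {0} (s≤s z≤n)) (≈ᴬ-trans (+ᴬ-cong (*ₗ-zeroˡ (B 0)) (≈ᴬ-refl {x = B 1})) (+ᴹ-identityˡ (B 1))))))

  D-homogeneous : ∀ {k} → k ≤ n → InSym n (D n k)
  D-homogeneous {k} k≤n I ∣I∣≢n = trans (Sym.at (D≈ n k) I)
    (trans (Symₚ.coeff-∑ {suc (n ∸ k)} (λ i → coefficient (toℕ i) k Sym.∙ᴬ Sym.single (J i)) I)
      (trans (∑.sum-cong-≋ {suc (n ∸ k)} {λ i → Sym.coeff (coefficient (toℕ i) k Sym.∙ᴬ Sym.single (J i)) I} {λ _ → 0#} term) (∑.sum-replicate-zero (suc (n ∸ k)))))
    where
    J : Fin (suc (n ∸ k)) → Composition
    J i = hook (k + toℕ i) (n ∸ (k + toℕ i))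
    term : ∀ i → Sym.coeff (coefficient (toℕ i) k Sym.∙ᴬ Sym.single (J i)) I ≈ 0#
    term i = trans (Sym.coeff-∙ (coefficient (toℕ i) k) (Sym.single (J i)) I) (trans
      (*-congˡ (trans (+-identityʳ _) (Symₚ.δ-no 1# {J i} {I} λ J≡I → ∣I∣≢n (≡.trans (≡.cong ∣_∣ᶜ (≡.sym J≡I))
        (≡.trans (∣hook∣ (k + toℕ i) _) (ℕ.m+[n∸m]≡n (index-bound k≤n i)))))))
      (zeroʳ _))

open import Data.Nat.Base using (_+_)

mainTheorem6 :
    ∀ {c ℓ₁ ℓ₂} (F : HeytingField c ℓ₁ ℓ₂) (char0 : CharacteristicZero F) (n : ℕ) → 1 ≤ n →
    let open Tsetlin F char0
        open LinearAlgebra commutativeRing (Vectors n)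
    in IsLinear (t n)
       × IsDiagonalizable (t n)
       × (∀ x → IsEigenvalue (t n) x ⇔ (∃[ k ] (k + 2 ≤ n ⊎ k ≡ n) × x ≈ fromℕ k))
       × IsMinimalPolynomial (t n) (P n)
       × α n (S 1 Sym.*ᴬ S (n ∸ 1)) Kᴳ.≈ᴬ τ n
       × (∀ k → k ≤ n →
            InSym n (D n k)
            × IsSpectralProjector (t n) (fromℕ k) (rightMul (α n (D n k)))
            × (¬ IsEigenvalue (t n) (fromℕ k) → ∀ f → rightMul (α n (D n k)) f Kᴳ.≈ᴬ Kᴳ.0ᴬ))
       × D₀ n Sym.≈ᴬ D n 0
       × IsSpectralProjector (t n) 0# (rightMul (α n (D₀ n)))
mainTheorem6 F char0 n@(suc n′) (s≤s z≤n) =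
    rightMul-linear (τ n)
  , t-diagonalizable
  , eigenvalues
  , P-isMinimalPolynomial
  , α-S₁Sₙ₋₁
  , (λ k k≤n → let spectral = projector-isSpectral k≤n (α-D k≤n) in
       D-homogeneous k≤n , spectral , projector-zero {k} {α n (D n k)} spectral)
  , D₀≈D n
  , projector-isSpectral {0} z≤n
      (MonoidAlgebraProperties.≈ᴬ-trans commutativeRing (Group.monoid (𝔖 n)) _≟ₚ_ (α-cong {D₀ n} {D n 0} (D₀≈D n)) (α-D {0} z≤n))
  where
  open Tsetlin F char0 using (commutativeRing; τ; α; D; D₀)
  open Shuffles F char0 n′
  open DescentAlgebra F char0 n′
  open GeneratingSeries F char0
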